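{- Let $G$ be a graph with $f(G)\le 13$. Then (a) $|V(G)|\ge\chi(G)+2f(G)-4$; (b) if $f(G)=12$ and $R(10,3)\le 41$, then $|V(G)|>\chi(G)+2f(G)-4$.
   Context: All graphs are finite, simple and undirected. $\chi(G)$ is the chromatic number, $\omega(G)$ the clique number, $\alpha(G)$ the independence number, and $f(G)=\chi(G)-\omega(G)$. $R(10,3)$ is the smallest $n$ such that every graph on at least $n$ vertices has $\omega(G)\ge 10$ or $\alpha(G)\ge 3$. -}

module Defs where

open import Data.Nat using (ℕ; _+_; _*_; _∸_; _≤_; _<_)
open import Data.Fin using (Fin)
open import Data.Bool using (Bool; true; false)
open import Data.Product using (Σ; _×_)
open import Data.Sum using (_⊎_)
open import Relation.Binary.PropositionalEquality using (_≡_; _≢_)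
open import Function.Definitions using (Injective)

record Graph (n : ℕ) : Set where
  field
    adj   : Fin n → Fin n → Bool
    sym   : ∀ u v → adj u v ≡ adj v u
    irrefl : ∀ v → adj v v ≡ false
open Graph public

∣V∣ : ∀ {n} → Graph n → ℕ
∣V∣ {n} _ = n

Colouring : ∀ {n} → Graph n → ℕ → Set
Colouring {n} G k =
  Σ (Fin n → Fin k) λ c → ∀ u v → adj G u v ≡ true → c u ≢ c v

Clique : ∀ {n} → Graph n → ℕ → Set
Clique {n} G k =
  Σ (Fin k → Fin n) λ f → Injective _≡_ _≡_ f ×
    (∀ i j → i ≢ j → adj G (f i) (f j) ≡ true)

IndepSet : ∀ {n} → Graph n → ℕ → Set
IndepSet {n} G k =
  Σ (Fin k → Fin n) λ f → Injective _≡_ _≡_ f ×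
    (∀ i j → adj G (f i) (f j) ≡ false)

IsChromaticNumber : ∀ {n} → Graph n → ℕ → Set
IsChromaticNumber G k = Colouring G k × (∀ j → Colouring G j → k ≤ j)

IsCliqueNumber : ∀ {n} → Graph n → ℕ → Set
IsCliqueNumber G k = Clique G k × (∀ j → Clique G j → j ≤ k)

RamseyLe : ℕ → ℕ → ℕ → Set
RamseyLe s t m = ∀ n → m ≤ n → (G : Graph n) → Clique G s ⊎ IndepSet G t

{-# OPTIONS --safe #-}
module Submission where

-- Removing an independent triple lowers n − χ by at least 2 and the gap f = χ − ω by at most 1, so one may
-- assume α(G) ≤ 2; then n − χ is the matching number of the complement.  If a vertex can be removed without
-- lowering χ, induct.  Otherwise every vertex is missed by a maximum matching, and by Gallai's exchange argument
-- the vertices that are never missed together with a given one are joined in G to all the others: either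
-- G is a join, over which both f and n − χ are additive, or n = 2χ − 1.  The last case is a Ramsey problem, settled
-- by R(k+1,3) ≤ 3, 6, 9, 14, 19, 24, 30, 37, 43 for k = 1, …, 9.
--
-- These bounds follow from lower bounds for the number e of edges of a triangle-free graph with n vertices and
-- α ≤ k, by induction on k: if H_v is induced by the non-neighbours of v, then Σ e(H_v) = n e − Σ d(v)².
-- Where this identity falls short it still forces some H_v to be one of a few explicit graphs.  The ways to put
-- back v and its neighbours are then enumerated, or excluded by linear programming duality: an independent set
-- of k − 1 vertices of H_v avoids the neighbourhood of at most one neighbour of v.

-- The argument runs in the complement of G: there cliques of G are independent sets, colour classes
-- are cliques, and independent triples are triangles. So `Alpha≤ w` bounds ω(G), and `TriFree` says
-- α(G) ≤ 2.
--
-- The bound n - χ ≥ 2f - 4 cannot be carried through the induction as it stands: over a join the 4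
-- would be lost twice. It is replaced by a function g with g(f + 1) ≤ g(f) + 2 and g(a + c) ≤ g(a)
-- + g(c), which is larger than 2f - 4 for small f. If n = 2χ - 1 and n - χ ≥ g(f) fails, then χ ≤
-- g(f), so the extreme case is a triangle-free graph on 2g(f) - 1 vertices with independence number
-- at most g(f) - f. The values `savings` grow by 2 at each step as long as the Ramsey bounds
-- exclude that graph, and by 1 at f = 6, 8, 10, 12, where they do not. At f = 12 an increment of 2
-- would mean 41 vertices and independence number 9; hence the hypothesis of (b).

open import Defs hiding (sym)
open import Data.Bool using (Bool; true; false; not; _∧_; _∨_; T; if_then_else_)
open import Data.Empty using (⊥; ⊥-elim)
open import Data.Fin using (Fin; zero; suc)
open import Data.Fin.Properties using () renaming (_≟_ to _≟ᶠ_)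
open import Data.List using (List; []; _∷_; _++_; _ʳ++_; map; length; filterᵇ; concat; zipWith; drop;
  replicate; reverse; lookup; allFin; tabulate)
open import Data.List.Membership.Propositional using (_∈_; _∉_)
open import Data.List.Membership.Propositional.Properties
  using (∈-++⁺ˡ; ∈-++⁺ʳ; ∈-++⁻; ∈-filter⁺; ∈-filter⁻; ∈-map⁺; ∈-map⁻; ∈-lookup; ∈-allFin; ∈-tabulate⁻)
open import Data.List.Properties using (length-++; length-map; map-++; ++-identityʳ; length-tabulate)
open import Data.List.Relation.Binary.Permutation.Propositional as Perm
  using (_↭_; prep; swap; ↭-sym; ↭-refl; ↭-trans; ↭-reflexive)
open import Data.List.Relation.Binary.Permutation.Propositional.Properties
  using (∈-resp-↭; ↭-length; ++⁺; ++⁺ˡ; ++⁺ʳ; shift)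
open import Data.List.Relation.Unary.All as All using (All; []; _∷_)
open import Data.List.Relation.Unary.AllPairs as AllPairs using (AllPairs; []; _∷_)
open import Data.List.Relation.Unary.AllPairs.Properties using (tabulate⁺; filter⁺; map⁺)
open import Data.List.Relation.Unary.Any using (Any; here; there; any?)
open import Data.List.Relation.Unary.Unique.Propositional using (Unique)
open import Data.List.Relation.Unary.Unique.Propositional.Properties using (allFin⁺)
open import Data.Nat hiding (_≟_)
open import Data.Nat.DivMod using (_/_; _%_)
open import Data.Nat.Properties hiding (_≟_)
open import Data.Nat.Tactic.RingSolver using (solve-∀)
open import Data.Product using (∃; ∃₂; _×_; _,_; proj₁; proj₂)
open import Data.Sum using (_⊎_; inj₁; inj₂)
open import Data.Unit using (⊤; tt)
open import Function using (_∘_; id)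
open import Relation.Binary using (DecidableEquality)
open import Relation.Binary.PropositionalEquality hiding ([_])
open import Relation.Nullary using (¬_; Dec; yes; no; does)
open import Relation.Nullary.Decidable using (¬?; _×-dec_; T?; decidable-stable; ¬¬-excluded-middle)

-- Sums over lists

b : Bool → ℕ
b true = 1
b false = 0

b≤1 : ∀ x → b x ≤ 1
b≤1 true = ≤-refl
b≤1 false = z≤n

T⇒≡ : ∀ {x} → T x → x ≡ true
T⇒≡ {true} _ = refl

≡⇒T : ∀ {x} → x ≡ true → T x
≡⇒T refl = tt

∧-true : ∀ {x y} → x ∧ y ≡ true → x ≡ true × y ≡ true
∧-true {true} {true} _ = refl , refl

not-true : ∀ {x} → not x ≡ true → x ≡ false
not-true {false} _ = refl

≤ᵇ-sound : ∀ {m n} → (m ≤ᵇ n) ≡ true → m ≤ n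
≤ᵇ-sound {m} {n} p = ≤ᵇ⇒≤ m n (≡⇒T p)

<ᵇ-sound : ∀ {m n} → (m <ᵇ n) ≡ true → m < n
<ᵇ-sound {m} {n} p = <ᵇ⇒< m n (≡⇒T p)

0<∸⇒< : ∀ {m n} → 0 < m ∸ n → n < m
0<∸⇒< q = m∸n≢0⇒n<m (m<n⇒n≢0 q)

module _ {A : Set} where

  ∈-filterᵇ⁻ : ∀ (p : A → Bool) {x} xs → x ∈ filterᵇ p xs → x ∈ xs × p x ≡ true
  ∈-filterᵇ⁻ p xs m with ∈-filter⁻ (T? ∘ p) {xs = xs} m
  ... | i , t = i , T⇒≡ t

  ∈-filterᵇ⁺ : ∀ (p : A → Bool) {x} {xs} → x ∈ xs → p x ≡ true → x ∈ filterᵇ p xs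
  ∈-filterᵇ⁺ p i e = ∈-filter⁺ (T? ∘ p) i (≡⇒T e)

  filterᵇ-split : ∀ (p : A → Bool) xs → xs ↭ filterᵇ p xs ++ filterᵇ (not ∘ p) xs
  filterᵇ-split p [] = ↭-refl
  filterᵇ-split p (x ∷ xs) with p x
  ... | true = prep x (filterᵇ-split p xs)
  ... | false = ↭-trans (prep x (filterᵇ-split p xs)) (↭-sym (shift x (filterᵇ p xs) _))

  AllPairs-↭ : ∀ {R : A → A → Set} → (∀ {x y} → R x y → R y x) →
               ∀ {xs ys} → xs ↭ ys → AllPairs R xs → AllPairs R ys
  AllPairs-↭ s Perm.refl r = r
  AllPairs-↭ s (prep x p) (a ∷ r) = All.tabulate (λ i → All.lookup a (∈-resp-↭ (↭-sym p) i)) ∷ AllPairs-↭ s p r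
  AllPairs-↭ s (swap x y p) ((xy ∷ a) ∷ (a' ∷ r)) =
    (s xy ∷ All.tabulate (λ i → All.lookup a' (∈-resp-↭ (↭-sym p) i)))
    ∷ (All.tabulate (λ i → All.lookup a (∈-resp-↭ (↭-sym p) i)) ∷ AllPairs-↭ s p r)
  AllPairs-↭ s (Perm.trans p q) r = AllPairs-↭ s q (AllPairs-↭ s p r)

  Unique-↭ : ∀ {xs ys : List A} → xs ↭ ys → Unique xs → Unique ys
  Unique-↭ = AllPairs-↭ (λ ne e → ne (sym e))

  AllPairs-++⁻ : ∀ {R : A → A → Set} xs {ys} → AllPairs R (xs ++ ys) → AllPairs R xs × AllPairs R ys
  AllPairs-++⁻ [] r = [] , r
  AllPairs-++⁻ (x ∷ xs) (a ∷ r) with AllPairs-++⁻ xs r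
  ... | l , m = (All.tabulate (λ i → All.lookup a (∈-++⁺ˡ i)) ∷ l) , m

  AllPairs-filterᵇ : ∀ {R : A → A → Set} (p : A → Bool) {xs} → AllPairs R xs → AllPairs R (filterᵇ p xs)
  AllPairs-filterᵇ p = filter⁺ (T? ∘ p)

  ∈-extract : ∀ {x : A} {xs} → x ∈ xs → ∃ λ ys → xs ↭ x ∷ ys
  ∈-extract (here refl) = _ , ↭-refl
  ∈-extract {xs = y ∷ _} (there i) with ∈-extract i
  ... | ys , p = y ∷ ys , ↭-trans (prep y p) (swap y _ ↭-refl)

  sum : (A → ℕ) → List A → ℕ
  sum f [] = 0
  sum f (x ∷ xs) = f x + sum f xs

  sum-++ : ∀ f xs ys → sum f (xs ++ ys) ≡ sum f xs + sum f ys
  sum-++ f [] ys = refl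
  sum-++ f (x ∷ xs) ys = begin
    f x + sum f (xs ++ ys) ≡⟨ cong (f x +_) (sum-++ f xs ys) ⟩
    f x + (sum f xs + sum f ys) ≡⟨ +-assoc (f x) _ _ ⟨
    f x + sum f xs + sum f ys ∎
    where open ≡-Reasoning

  sum-↭ : ∀ f {xs ys} → xs ↭ ys → sum f xs ≡ sum f ys
  sum-↭ f Perm.refl = refl
  sum-↭ f (prep x p) = cong (f x +_) (sum-↭ f p)
  sum-↭ f (swap {ys = ys} x y p) rewrite sum-↭ f p = lem (f x) (f y) (sum f ys)
    where lem : ∀ a c d → a + (c + d) ≡ c + (a + d)
          lem = solve-∀
  sum-↭ f (Perm.trans p q) = trans (sum-↭ f p) (sum-↭ f q)

  sum-cong : ∀ {f g} xs → (∀ x → x ∈ xs → f x ≡ g x) → sum f xs ≡ sum g xs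
  sum-cong [] h = refl
  sum-cong (x ∷ xs) h = cong₂ _+_ (h x (here refl)) (sum-cong xs (λ y i → h y (there i)))

  sum-mono : ∀ {f g} xs → (∀ x → x ∈ xs → f x ≤ g x) → sum f xs ≤ sum g xs
  sum-mono [] h = z≤n
  sum-mono (x ∷ xs) h = +-mono-≤ (h x (here refl)) (sum-mono xs (λ y i → h y (there i)))

  sum-+ : ∀ f g xs → sum (λ x → f x + g x) xs ≡ sum f xs + sum g xs
  sum-+ f g [] = refl
  sum-+ f g (x ∷ xs) rewrite sum-+ f g xs = lem (f x) (g x) (sum f xs) (sum g xs)
    where lem : ∀ a c d e → a + c + (d + e) ≡ a + d + (c + e)
          lem = solve-∀

  sum-* : ∀ c f xs → sum (λ x → c * f x) xs ≡ c * sum f xs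
  sum-* c f [] = sym (*-zeroʳ c)
  sum-* c f (x ∷ xs) rewrite sum-* c f xs = sym (*-distribˡ-+ c (f x) _)

  sum-const : ∀ c xs → sum (λ _ → c) xs ≡ length xs * c
  sum-const c [] = refl
  sum-const c (x ∷ xs) = cong (c +_) (sum-const c xs)

  sum-filterᵇ : ∀ f (p : A → Bool) xs → sum f (filterᵇ p xs) ≡ sum (λ x → b (p x) * f x) xs
  sum-filterᵇ f p [] = refl
  sum-filterᵇ f p (x ∷ xs) with p x
  ... | true = cong₂ _+_ (sym (+-identityʳ (f x))) (sum-filterᵇ f p xs)
  ... | false = sum-filterᵇ f p xs

  length-filterᵇ : ∀ (p : A → Bool) xs → length (filterᵇ p xs) ≡ sum (b ∘ p) xs
  length-filterᵇ p [] = refl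
  length-filterᵇ p (x ∷ xs) with p x
  ... | true = cong suc (length-filterᵇ p xs)
  ... | false = length-filterᵇ p xs

  ∈⇒≤sum : ∀ f {x xs} → x ∈ xs → f x ≤ sum f xs
  ∈⇒≤sum f (here refl) = m≤m+n _ _
  ∈⇒≤sum f {xs = y ∷ _} (there i) = ≤-trans (∈⇒≤sum f i) (m≤n+m _ (f y))

  sum-pos : ∀ f xs → 0 < sum f xs → ∃ λ x → x ∈ xs × 0 < f x
  sum-pos f (x ∷ xs) h with f x in eq
  ... | suc m = x , here refl , subst (0 <_) (sym eq) (s≤s z≤n)
  ... | zero with sum-pos f xs h
  ... | y , i , q = y , there i , q

sum-swap : ∀ {A B : Set} (f : A → B → ℕ) xs ys →
           sum (λ x → sum (f x) ys) xs ≡ sum (λ y → sum (λ x → f x y) xs) ys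
sum-swap f [] ys = sym (trans (sum-const 0 ys) (*-zeroʳ (length ys)))
sum-swap f (x ∷ xs) ys rewrite sum-swap f xs ys = sym (sum-+ (f x) _ ys)

sum-map : ∀ {A B : Set} (f : B → ℕ) (g : A → B) xs → sum f (map g xs) ≡ sum (f ∘ g) xs
sum-map f g [] = refl
sum-map f g (x ∷ xs) = cong (f (g x) +_) (sum-map f g xs)

-- Triangle-free graphs: an induced subgraph of the ambient graph is the list of its vertices

-- Multipliers for one averaging argument: `pos * d + const + gap * (height ∸ d)` is to be a
-- minorant of `scale * (d * d + t d)`, and `gain` is the deficiency guaranteed around each vertex
-- of degree below `height`.
record LP : Set where
  constructor lp
  field scale pos const gap height gain : ℕ

module Ambient {V : Set} (_≟_ : DecidableEquality V) (adj : V → V → Bool)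
  (adj-sym : ∀ u v → adj u v ≡ adj v u) (adj-irr : ∀ v → adj v v ≡ false) where

  deg : V → List V → ℕ
  deg v xs = sum (λ w → b (adj v w)) xs

  edges : List V → ℕ
  edges [] = 0
  edges (x ∷ xs) = deg x xs + edges xs

  nbrs : V → List V → List V
  nbrs v xs = filterᵇ (adj v) xs

  far : V → V → Bool
  far v w = not (adj v w) ∧ not (does (v ≟ w))

  rest : V → List V → List V
  rest v xs = filterᵇ (far v) xs

  nbrDegrees : V → List V → ℕ
  nbrDegrees v xs = sum (λ x → b (adj v x) * deg x xs) xs

  TriFree : List V → Set
  TriFree xs = ∀ {x y z} → x ∈ xs → y ∈ xs → z ∈ xs →
               adj x y ≡ true → adj y z ≡ true → adj x z ≡ true → ⊥

  Indep : List V → Set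
  Indep = AllPairs (λ x y → adj x y ≡ false)

  Alpha≤ : ℕ → List V → Set
  Alpha≤ k xs = ∀ zs → Unique zs → (∀ {z} → z ∈ zs → z ∈ xs) → Indep zs → length zs ≤ k

  deg-length : ∀ v xs → length (nbrs v xs) ≡ deg v xs
  deg-length v xs = length-filterᵇ (adj v) xs

  handshake : ∀ xs → sum (λ v → deg v xs) xs ≡ 2 * edges xs
  handshake [] = refl
  handshake (x ∷ xs) = begin
    b (adj x x) + deg x xs + sum (λ v → b (adj v x) + deg v xs) xs
      ≡⟨ cong₂ (λ p q → b p + deg x xs + q) (adj-irr x) (sum-+ (λ v → b (adj v x)) (λ v → deg v xs) xs) ⟩
    deg x xs + (sum (λ v → b (adj v x)) xs + sum (λ v → deg v xs) xs)
      ≡⟨ cong₂ (λ p q → deg x xs + (p + q)) (sum-cong xs (λ v _ → cong b (adj-sym v x))) (handshake xs) ⟩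
    deg x xs + (deg x xs + 2 * edges xs)
      ≡⟨ lem (deg x xs) (edges xs) ⟩
    2 * (deg x xs + edges xs) ∎
    where open ≡-Reasoning
          lem : ∀ a c → a + (a + 2 * c) ≡ 2 * (a + c)
          lem = solve-∀

  -- `edges` counts an edge at whichever end comes first in the list; by `handshake` its double is a
  -- sum in which the order is irrelevant.
  edges-↭ : ∀ {xs ys} → xs ↭ ys → edges xs ≡ edges ys
  edges-↭ {xs} {ys} p = *-cancelˡ-≡ _ _ 2 (begin
    2 * edges xs ≡⟨ handshake xs ⟨
    sum (λ v → deg v xs) xs ≡⟨ sum-cong xs (λ v _ → sum-↭ _ p) ⟩
    sum (λ v → deg v ys) xs ≡⟨ sum-↭ _ p ⟩
    sum (λ v → deg v ys) ys ≡⟨ handshake ys ⟩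
    2 * edges ys ∎)
    where open ≡-Reasoning

  edges-++ : ∀ xs ys → edges (xs ++ ys) ≡ edges xs + sum (λ x → deg x ys) xs + edges ys
  edges-++ [] ys = refl
  edges-++ (x ∷ xs) ys rewrite edges-++ xs ys | sum-++ (λ w → b (adj x w)) xs ys =
    lem (deg x xs) (deg x ys) (edges xs) (sum (λ x → deg x ys) xs) (edges ys)
    where lem : ∀ a c d e f → a + c + (d + e + f) ≡ a + d + (c + e) + f
          lem = solve-∀

  Indep-deg : ∀ x xs → All (λ y → adj x y ≡ false) xs → deg x xs ≡ 0
  Indep-deg x [] [] = refl
  Indep-deg x (y ∷ xs) (p ∷ ps) rewrite p = Indep-deg x xs ps

  Indep-edges : ∀ xs → Indep xs → edges xs ≡ 0
  Indep-edges [] [] = refl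
  Indep-edges (x ∷ xs) (p ∷ ps) rewrite Indep-deg x xs p = Indep-edges xs ps

  Indep-from-∈ : ∀ xs → (∀ {x y} → x ∈ xs → y ∈ xs → adj x y ≡ false) → Indep xs
  Indep-from-∈ [] h = []
  Indep-from-∈ (x ∷ xs) h =
    All.tabulate (λ i → h (here refl) (there i)) ∷ Indep-from-∈ xs (λ i j → h (there i) (there j))

  nbrs-⊆ : ∀ v xs {x} → x ∈ nbrs v xs → x ∈ xs
  nbrs-⊆ v xs i = proj₁ (∈-filterᵇ⁻ (adj v) xs i)

  nbrs-adj : ∀ v xs {x} → x ∈ nbrs v xs → adj v x ≡ true
  nbrs-adj v xs i = proj₂ (∈-filterᵇ⁻ (adj v) xs i)

  rest-⊆ : ∀ v xs {x} → x ∈ rest v xs → x ∈ xs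
  rest-⊆ v xs i = proj₁ (∈-filterᵇ⁻ (far v) xs i)

  rest-far : ∀ v xs {x} → x ∈ rest v xs → adj v x ≡ false
  rest-far v xs i = not-true (proj₁ (∧-true (proj₂ (∈-filterᵇ⁻ (far v) xs i))))

  rest-≢ : ∀ v xs {x} → x ∈ rest v xs → v ≢ x
  rest-≢ v xs {x} i e with v ≟ x | proj₂ (∧-true {not (adj v x)} (proj₂ (∈-filterᵇ⁻ (far v) xs i)))
  ... | no ne | _ = ne e

  non-nbrs-∉ : ∀ v xs → All (v ≢_) xs → filterᵇ (not ∘ adj v) xs ≡ rest v xs
  non-nbrs-∉ v [] [] = refl
  non-nbrs-∉ v (x ∷ xs) (p ∷ ps) with adj v x | v ≟ x
  ... | true | _ = non-nbrs-∉ v xs ps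
  ... | false | yes q = ⊥-elim (p q)
  ... | false | no _ = cong (x ∷_) (non-nbrs-∉ v xs ps)

  non-nbrs-∈ : ∀ {v xs} → v ∈ xs → Unique xs → filterᵇ (not ∘ adj v) xs ↭ v ∷ rest v xs
  non-nbrs-∈ {v} {x ∷ xs} (here refl) (p ∷ ps) rewrite adj-irr v with v ≟ v
  ... | yes _ rewrite non-nbrs-∉ v xs p = ↭-refl
  ... | no q = ⊥-elim (q refl)
  non-nbrs-∈ {v} {x ∷ xs} (there i) (p ∷ ps) with adj v x | v ≟ x
  ... | true | _ = non-nbrs-∈ i ps
  ... | false | yes refl = ⊥-elim (All.lookup p i refl)
  ... | false | no _ = ↭-trans (prep x (non-nbrs-∈ i ps)) (swap x v ↭-refl)

  split : ∀ {v xs} → v ∈ xs → Unique xs → xs ↭ v ∷ nbrs v xs ++ rest v xs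
  split {v} {xs} i u = ↭-trans (filterᵇ-split (adj v) xs)
    (↭-trans (++⁺ˡ (nbrs v xs) (non-nbrs-∈ i u)) (shift v (nbrs v xs) (rest v xs)))

  TriFree-⊆ : ∀ {xs ys} → (∀ {x} → x ∈ ys → x ∈ xs) → TriFree xs → TriFree ys
  TriFree-⊆ s h i j k = h (s i) (s j) (s k)

  Alpha≤-⊆ : ∀ {k xs ys} → (∀ {x} → x ∈ ys → x ∈ xs) → Alpha≤ k xs → Alpha≤ k ys
  Alpha≤-⊆ s h zs u m = h zs u (s ∘ m)

  nbrs-nonadj : ∀ {v xs} → v ∈ xs → TriFree xs → ∀ {x y} → x ∈ nbrs v xs → y ∈ nbrs v xs → adj x y ≡ false
  nbrs-nonadj {v} {xs} i tf {x} {y} p q with adj x y in eq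
  ... | false = refl
  ... | true = ⊥-elim (tf i (nbrs-⊆ v xs p) (nbrs-⊆ v xs q) (nbrs-adj v xs p) eq (nbrs-adj v xs q))

  nbrs-indep : ∀ {v xs} → v ∈ xs → TriFree xs → Indep (nbrs v xs)
  nbrs-indep {v} {xs} i tf = Indep-from-∈ (nbrs v xs) (nbrs-nonadj i tf)

  deg≤ : ∀ {k v xs} → v ∈ xs → Unique xs → TriFree xs → Alpha≤ k xs → deg v xs ≤ k
  deg≤ {k} {v} {xs} i u tf al = subst (_≤ k) (deg-length v xs)
    (al (nbrs v xs) (AllPairs-filterᵇ (adj v) u) (nbrs-⊆ v xs) (nbrs-indep i tf))

  rest-Alpha≤ : ∀ {k v xs} → v ∈ xs → Alpha≤ (suc k) xs → Alpha≤ k (rest v xs)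
  rest-Alpha≤ {k} {v} {xs} i al zs u m ind = s≤s⁻¹ (al (v ∷ zs)
    (All.tabulate (λ j → rest-≢ v xs (m j)) ∷ u)
    (λ { (here refl) → i ; (there j) → rest-⊆ v xs (m j) })
    (All.tabulate (λ j → rest-far v xs (m j)) ∷ ind))

  rest-length : ∀ {v xs} → v ∈ xs → Unique xs → suc (deg v xs + length (rest v xs)) ≡ length xs
  rest-length {v} {xs} i u = begin
    suc (deg v xs + length (rest v xs)) ≡⟨ cong (λ d → suc (d + length (rest v xs))) (deg-length v xs) ⟨
    suc (length (nbrs v xs) + length (rest v xs)) ≡⟨ cong suc (length-++ (nbrs v xs)) ⟨
    length (v ∷ nbrs v xs ++ rest v xs) ≡⟨ ↭-length (split i u) ⟨
    length xs ∎
    where open ≡-Reasoning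

  nbr-deg : ∀ {v xs x} → v ∈ xs → Unique xs → TriFree xs → x ∈ nbrs v xs → deg x xs ≡ 1 + deg x (rest v xs)
  nbr-deg {v} {xs} {x} i u tf j = begin
    deg x xs ≡⟨ sum-↭ _ (split i u) ⟩
    b (adj x v) + deg x (nbrs v xs ++ rest v xs)
      ≡⟨ cong₂ _+_ (cong b (trans (adj-sym x v) (nbrs-adj v xs j))) (sum-++ _ (nbrs v xs) (rest v xs)) ⟩
    1 + (deg x (nbrs v xs) + deg x (rest v xs))
      ≡⟨ cong (λ z → 1 + (z + deg x (rest v xs))) (Indep-deg x (nbrs v xs) (All.tabulate (nbrs-nonadj i tf j))) ⟩
    1 + deg x (rest v xs) ∎
    where open ≡-Reasoning

  cross : V → List V → ℕ
  cross v xs = sum (λ x → deg x (rest v xs)) (nbrs v xs)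

  edges-cross : ∀ {v xs} → v ∈ xs → Unique xs → TriFree xs →
                edges xs ≡ deg v xs + cross v xs + edges (rest v xs)
  edges-cross {v} {xs} i u tf = begin
    edges xs ≡⟨ edges-↭ (split i u) ⟩
    deg v (nbrs v xs ++ rest v xs) + edges (nbrs v xs ++ rest v xs)
      ≡⟨ cong₂ _+_ degv (edges-++ (nbrs v xs) (rest v xs)) ⟩
    deg v xs + (edges (nbrs v xs) + cross v xs + edges (rest v xs))
      ≡⟨ cong (λ z → deg v xs + (z + cross v xs + edges (rest v xs))) (Indep-edges _ (nbrs-indep i tf)) ⟩
    deg v xs + (cross v xs + edges (rest v xs)) ≡⟨ +-assoc (deg v xs) _ _ ⟨
    deg v xs + cross v xs + edges (rest v xs) ∎
    where
      open ≡-Reasoning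
      degv : deg v (nbrs v xs ++ rest v xs) ≡ deg v xs
      degv = sym (trans (sum-↭ _ (split i u)) (cong (λ z → b z + deg v (nbrs v xs ++ rest v xs)) (adj-irr v)))

  -- The neighbours of v are pairwise non-adjacent, so every edge outside H_v has exactly one end
  -- among them.
  edges-nbrDegrees : ∀ {v xs} → v ∈ xs → Unique xs → TriFree xs →
                     edges xs ≡ nbrDegrees v xs + edges (rest v xs)
  edges-nbrDegrees {v} {xs} i u tf = trans (edges-cross i u tf) (cong (_+ edges (rest v xs)) (sym (begin
    nbrDegrees v xs ≡⟨ sum-filterᵇ (λ x → deg x xs) (adj v) xs ⟨
    sum (λ x → deg x xs) (nbrs v xs) ≡⟨ sum-cong (nbrs v xs) (λ x j → nbr-deg i u tf j) ⟩
    sum (λ x → 1 + deg x (rest v xs)) (nbrs v xs) ≡⟨ sum-+ (λ _ → 1) _ (nbrs v xs) ⟩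
    sum (λ _ → 1) (nbrs v xs) + cross v xs
      ≡⟨ cong (_+ cross v xs) (trans (sum-const 1 (nbrs v xs)) (trans (*-identityʳ _) (deg-length v xs))) ⟩
    deg v xs + cross v xs ∎)))
    where open ≡-Reasoning

  -- The degree of x is counted once for each of its neighbours v.
  sum-nbrDegrees : ∀ xs → sum (λ v → nbrDegrees v xs) xs ≡ sum (λ v → deg v xs * deg v xs) xs
  sum-nbrDegrees xs = begin
    sum (λ v → sum (λ x → b (adj v x) * deg x xs) xs) xs
      ≡⟨ sum-swap (λ v x → b (adj v x) * deg x xs) xs xs ⟩
    sum (λ x → sum (λ v → b (adj v x) * deg x xs) xs) xs
      ≡⟨ sum-cong xs (λ x _ → trans (sum-cong xs (λ v _ → trans (*-comm (b (adj v x)) _)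
           (cong (λ z → deg x xs * b z) (adj-sym v x)))) (sum-* (deg x xs) _ xs)) ⟩
    sum (λ x → deg x xs * deg x xs) xs ∎
    where open ≡-Reasoning

  2edges≤ : ∀ {k xs} → Unique xs → TriFree xs → Alpha≤ k xs → 2 * edges xs ≤ length xs * k
  2edges≤ {k} {xs} u tf al = begin
    2 * edges xs ≡⟨ handshake xs ⟨
    sum (λ v → deg v xs) xs ≤⟨ sum-mono xs (λ v i → deg≤ i u tf al) ⟩
    sum (λ _ → k) xs ≡⟨ sum-const k xs ⟩
    length xs * k ∎
    where open ≤-Reasoning

  sum-edges-rest : ∀ xs → Unique xs → TriFree xs →
    length xs * edges xs ≡ sum (λ v → deg v xs * deg v xs + edges (rest v xs)) xs
  sum-edges-rest xs u tf = begin
    length xs * edges xs ≡⟨ sum-const (edges xs) xs ⟨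
    sum (λ _ → edges xs) xs ≡⟨ sum-cong xs (λ v i → edges-nbrDegrees i u tf) ⟩
    sum (λ v → nbrDegrees v xs + edges (rest v xs)) xs ≡⟨ sum-+ (λ v → nbrDegrees v xs) _ xs ⟩
    sum (λ v → nbrDegrees v xs) xs + sum (λ v → edges (rest v xs)) xs
      ≡⟨ cong (_+ sum (λ v → edges (rest v xs)) xs) (sum-nbrDegrees xs) ⟩
    sum (λ v → deg v xs * deg v xs) xs + sum (λ v → edges (rest v xs)) xs
      ≡⟨ sum-+ (λ v → deg v xs * deg v xs) _ xs ⟨
    sum (λ v → deg v xs * deg v xs + edges (rest v xs)) xs ∎
    where open ≡-Reasoning

  deficiency : ℕ → List V → V → ℕ
  deficiency h xs v = h ∸ deg v xs

  -- Adjacent low vertices have disjoint neighbourhoods, which doubles the deficiency.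
  deficiency-doubles : ∀ h r xs → TriFree xs → 2 * edges xs < length xs * h →
    (∀ v → v ∈ xs → deg v xs < h → r ≤ sum (λ x → b (adj v x) * deficiency h xs x) xs) →
    2 * r ≤ sum (deficiency h xs) xs
  deficiency-doubles h zero xs tf lt low = z≤n
  deficiency-doubles h r@(suc _) xs tf lt low
    with sum-pos (deficiency h xs) xs (≮⇒≥ noLow)
    where
      noLow : ¬ (sum (deficiency h xs) xs < 1)
      noLow (s≤s z) = <⇒≱ lt (begin
        length xs * h ≡⟨ sum-const h xs ⟨
        sum (λ _ → h) xs ≤⟨ sum-mono xs (λ v _ → m≤n+m∸n h (deg v xs)) ⟩
        sum (λ v → deg v xs + deficiency h xs v) xs ≡⟨ sum-+ (λ v → deg v xs) _ xs ⟩
        sum (λ v → deg v xs) xs + sum (deficiency h xs) xs ≤⟨ +-monoʳ-≤ _ z ⟩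
        sum (λ v → deg v xs) xs + 0 ≡⟨ +-identityʳ _ ⟩
        sum (λ v → deg v xs) xs ≡⟨ handshake xs ⟩
        2 * edges xs ∎)
        where open ≤-Reasoning
  ... | v , i , p
    with sum-pos (λ x → b (adj v x) * deficiency h xs x) xs (≤-trans (s≤s z≤n) (low v i (0<∸⇒< p)))
  ... | x , j , q with adj v x in eq
  ... | true = begin
    2 * r ≡⟨ cong (r +_) (+-identityʳ r) ⟩
    r + r ≤⟨ +-mono-≤ (low v i (0<∸⇒< p)) (low x j (0<∸⇒< (subst (0 <_) (+-identityʳ _) q))) ⟩
    sum (λ y → b (adj v y) * deficiency h xs y) xs + sum (λ y → b (adj x y) * deficiency h xs y) xs
      ≡⟨ sum-+ (λ y → b (adj v y) * deficiency h xs y) _ xs ⟨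
    sum (λ y → b (adj v y) * deficiency h xs y + b (adj x y) * deficiency h xs y) xs
      ≤⟨ sum-mono xs (λ y k → once k) ⟩
    sum (deficiency h xs) xs ∎
    where
      open ≤-Reasoning
      once : ∀ {y} → y ∈ xs → b (adj v y) * deficiency h xs y + b (adj x y) * deficiency h xs y ≤ deficiency h xs y
      once {y} k with adj v y in e₁ | adj x y in e₂
      ... | true | true = ⊥-elim (tf i j k eq e₂ e₁)
      ... | true | false = ≤-reflexive (trans (+-identityʳ _) (+-identityʳ _))
      ... | false | true = ≤-reflexive (+-identityʳ _)
      ... | false | false = z≤n

  -- By `edges-nbrDegrees` the degrees of the neighbours of v add up to e - e(H_v), hence to at most
  -- E - t(d), which falls short of d · h by at least r.
  low-deficiency : ∀ {h r} {t : ℕ → ℕ} {E v} xs → Unique xs → TriFree xs → v ∈ xs → edges xs ≤ E →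
    t (deg v xs) ≤ edges (rest v xs) → E + r ≤ t (deg v xs) + deg v xs * h →
    r ≤ sum (λ x → b (adj v x) * deficiency h xs x) xs
  low-deficiency {h} {r} {t} {E} {v} xs u tf i eE te bound = +-cancelˡ-≤ (edges xs) _ _ (begin
    edges xs + r ≤⟨ +-monoˡ-≤ r eE ⟩
    E + r ≤⟨ bound ⟩
    t (deg v xs) + deg v xs * h ≤⟨ +-mono-≤ te total ⟩
    edges (rest v xs) + (nbrDegrees v xs + D) ≡⟨ lem (edges (rest v xs)) (nbrDegrees v xs) D ⟩
    (nbrDegrees v xs + edges (rest v xs)) + D ≡⟨ cong (_+ D) (edges-nbrDegrees i u tf) ⟨
    edges xs + D ∎)
    where
      open ≤-Reasoning
      D = sum (λ x → b (adj v x) * deficiency h xs x) xs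
      lem : ∀ a c d → a + (c + d) ≡ (c + a) + d
      lem = solve-∀
      total : deg v xs * h ≤ nbrDegrees v xs + D
      total = begin
        deg v xs * h ≡⟨ *-comm (deg v xs) h ⟩
        h * deg v xs ≡⟨ sum-* h (λ x → b (adj v x)) xs ⟨
        sum (λ x → h * b (adj v x)) xs
          ≤⟨ sum-mono xs (λ x _ → ≤-trans (≤-reflexive (*-comm h (b (adj v x))))
               (≤-trans (*-monoʳ-≤ (b (adj v x)) (m≤n+m∸n h (deg x xs)))
               (≤-reflexive (*-distribˡ-+ (b (adj v x)) (deg x xs) _)))) ⟩
        sum (λ x → b (adj v x) * deg x xs + b (adj v x) * deficiency h xs x) xs
          ≡⟨ sum-+ (λ x → b (adj v x) * deg x xs) _ xs ⟩
        nbrDegrees v xs + D ∎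

  -- A linear lower bound for scale · (d² + t d) is summed over all vertices, using sum-edges-rest and handshake.
  module _ (c : LP) (k n E : ℕ) (t : ℕ → ℕ) where
    open LP c

    slope : ℕ
    slope = scale * n ∸ 2 * pos

    record LPValid : Set where
      field
        slope≥0 : 2 * pos ≤ scale * n
        total : slope * E < n * const + gap * (2 * gain)
        local : ∀ d → d ≤ k → suc d ≤ n → pos * d + const + gap * (height ∸ d) ≤ scale * (d * d + t d)
        -- An average degree below `height` provides a low vertex; the inequality for each d is the
        -- hypothesis of `low-deficiency`.
        lows : gain ≡ 0 ⊎ (2 * E < n * height × (∀ d → d < height → suc d ≤ n → E + gain ≤ t d + d * height))

    -- In this form valid multipliers yield more than a bound: a graph with at most E edges must
    -- contain a vertex v whose H_v is sparser than t, and this H_v can then be looked up in a list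
    -- of explicit graphs.
    lp-bound : LPValid → ∀ xs → Unique xs → TriFree xs → Alpha≤ k xs → length xs ≡ n → edges xs ≤ E →
               ¬ (∀ v → v ∈ xs → t (deg v xs) ≤ edges (rest v xs))
    lp-bound ok xs u tf al refl eE te = <⇒≱ total (begin
      length xs * const + gap * (2 * gain) ≤⟨ +-monoʳ-≤ (length xs * const) (*-monoʳ-≤ gap gain≤) ⟩
      length xs * const + gap * D ≤⟨ weighted ⟩
      slope * edges xs ≤⟨ *-monoʳ-≤ slope eE ⟩
      slope * E ∎)
      where
        open LPValid ok
        open ≤-Reasoning
        D e : ℕ
        D = sum (deficiency height xs) xs
        e = edges xs
        dg : V → ℕ
        dg v = deg v xs
        size : ∀ v → v ∈ xs → suc (dg v) ≤ length xs
        size v i = ≤-trans (s≤s (m≤m+n _ _)) (≤-reflexive (rest-length i u))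
        gain≤ : 2 * gain ≤ D
        gain≤ with lows
        ... | inj₁ z rewrite z = z≤n
        ... | inj₂ (lt , lw) = deficiency-doubles height gain xs tf (≤-<-trans (*-monoʳ-≤ 2 eE) lt)
                (λ v i l → low-deficiency {t = t} xs u tf i eE (te v i) (lw (dg v) l (size v i)))
        sumLeft : pos * (2 * e) + (length xs * const + gap * D) ≡ sum (λ v → pos * dg v + const + gap * deficiency height xs v) xs
        sumLeft = sym (begin-equality
          sum (λ v → pos * dg v + const + gap * deficiency height xs v) xs
            ≡⟨ sum-+ (λ v → pos * dg v + const) _ xs ⟩
          sum (λ v → pos * dg v + const) xs + sum (λ v → gap * deficiency height xs v) xs
            ≡⟨ cong₂ _+_ (sum-+ (λ v → pos * dg v) _ xs) (sum-* gap _ xs) ⟩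
          sum (λ v → pos * dg v) xs + sum (λ _ → const) xs + gap * D
            ≡⟨ cong₂ (λ p q → p + q + gap * D) (trans (sum-* pos _ xs) (cong (pos *_) (handshake xs))) (sum-const const xs) ⟩
          pos * (2 * e) + length xs * const + gap * D ≡⟨ +-assoc (pos * (2 * e)) _ _ ⟩
          pos * (2 * e) + (length xs * const + gap * D) ∎)
        sumRight : sum (λ v → scale * (dg v * dg v + edges (rest v xs))) xs ≡ scale * (length xs * e)
        sumRight = trans (sum-* scale _ xs) (cong (scale *_) (sym (sum-edges-rest xs u tf)))
        weighted : length xs * const + gap * D ≤ slope * e
        weighted = +-cancelˡ-≤ (pos * (2 * e)) _ _ (begin
          pos * (2 * e) + (length xs * const + gap * D) ≡⟨ sumLeft ⟩
          sum (λ v → pos * dg v + const + gap * deficiency height xs v) xs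
            ≤⟨ sum-mono xs (λ v i → ≤-trans (local (dg v) (deg≤ i u tf al) (size v i))
                 (*-monoʳ-≤ scale (+-monoʳ-≤ (dg v * dg v) (te v i)))) ⟩
          sum (λ v → scale * (dg v * dg v + edges (rest v xs))) xs ≡⟨ sumRight ⟩
          scale * (length xs * e) ≡⟨ *-assoc scale (length xs) e ⟨
          scale * length xs * e ≡⟨ cong (_* e) (m+[n∸m]≡n slope≥0) ⟨
          (2 * pos + slope) * e ≡⟨ lem′ pos slope e ⟩
          pos * (2 * e) + slope * e ∎)
          where
            lem′ : ∀ p a e → (2 * p + a) * e ≡ p * (2 * e) + a * e
            lem′ = solve-∀

-- Extending a known graph by a vertex and its neighbours

Row : Set
Row = List Bool

-- A graph given by the upper triangle of its adjacency matrix.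
Gr : Set
Gr = List Row

ones : Row → ℕ
ones = sum b

grEdges : Gr → ℕ
grEdges = sum ones

disjoint : Row → Row → Bool
disjoint (true ∷ xs) (true ∷ ys) = false
disjoint (true ∷ xs) (false ∷ ys) = disjoint xs ys
disjoint (false ∷ xs) (_ ∷ ys) = disjoint xs ys
disjoint _ _ = true

extendSets : Row → List Row → List Row
extendSets r ss = map (false ∷_) ss ++ map (true ∷_) (filterᵇ (disjoint r) ss)

indepSets : Gr → List Row
indepSets [] = [] ∷ []
indepSets (r ∷ H) = extendSets r (indepSets H)

data IndepRow : Gr → Row → Set where
  []  : IndepRow [] []
  _∷_ : ∀ {r H x S} → (x ≡ true → disjoint r S ≡ true) → IndepRow H S → IndepRow (r ∷ H) (x ∷ S)

indepSets-complete : ∀ {H S} → IndepRow H S → S ∈ indepSets H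
indepSets-complete [] = here refl
indepSets-complete {r ∷ H} {false ∷ S} (_ ∷ p) = ∈-++⁺ˡ (∈-map⁺ (false ∷_) (indepSets-complete p))
indepSets-complete {r ∷ H} {true ∷ S} (d ∷ p) = ∈-++⁺ʳ (map (false ∷_) (indepSets H))
  (∈-map⁺ (true ∷_) (∈-filterᵇ⁺ (disjoint r) (indepSets-complete p) (d refl)))

indepSets-sound : ∀ H {S} → S ∈ indepSets H → IndepRow H S
indepSets-sound [] (here refl) = []
indepSets-sound (r ∷ H) i with ∈-++⁻ (map (false ∷_) (indepSets H)) i
... | inj₁ j with ∈-map⁻ (false ∷_) j
... | S , k , refl = (λ ()) ∷ indepSets-sound H k
indepSets-sound (r ∷ H) i | inj₂ j with ∈-map⁻ (true ∷_) j
... | S , k , refl with ∈-filterᵇ⁻ (disjoint r) (indepSets H) k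
... | l , d = (λ _ → d) ∷ indepSets-sound H l

select : ∀ {A : Set} → Row → List A → List A
select (true ∷ m) (x ∷ xs) = x ∷ select m xs
select (false ∷ m) (x ∷ xs) = select m xs
select _ _ = []

select-⊆ : ∀ {A : Set} m (xs : List A) {x} → x ∈ select m xs → x ∈ xs
select-⊆ (true ∷ m) (y ∷ xs) (here p) = here p
select-⊆ (true ∷ m) (y ∷ xs) (there i) = there (select-⊆ m xs i)
select-⊆ (false ∷ m) (y ∷ xs) i = there (select-⊆ m xs i)

select-AllPairs : ∀ {A : Set} {R : A → A → Set} m {xs} → AllPairs R xs → AllPairs R (select m xs)
select-AllPairs [] {[]} _ = []
select-AllPairs [] {_ ∷ _} _ = []
select-AllPairs (true ∷ m) [] = []
select-AllPairs (false ∷ m) [] = []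
select-AllPairs (true ∷ m) {x ∷ xs} (a ∷ r) =
  All.tabulate (λ i → All.lookup a (select-⊆ m xs i)) ∷ select-AllPairs m r
select-AllPairs (false ∷ m) (a ∷ r) = select-AllPairs m r

select-length : ∀ {A : Set} m (xs : List A) → length m ≡ length xs → length (select m xs) ≡ ones m
select-length [] [] _ = refl
select-length (true ∷ m) (x ∷ xs) e = cong suc (select-length m xs (suc-injective e))
select-length (false ∷ m) (x ∷ xs) e = select-length m xs (suc-injective e)

IndepRow-length : ∀ {H S} → IndepRow H S → length S ≡ length H
IndepRow-length [] = refl
IndepRow-length (_ ∷ p) = cong suc (IndepRow-length p)

delete : ∀ {A : Set} → ℕ → List A → List A
delete _ [] = []
delete zero (x ∷ xs) = xs
delete (suc j) (x ∷ xs) = x ∷ delete j xs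

bitAt : ℕ → Row → Bool
bitAt _ [] = false
bitAt zero (x ∷ r) = x
bitAt (suc j) (x ∷ r) = bitAt j r

-- Only the upper triangle is stored, so the adjacencies of vertex j to earlier vertices have to be
-- collected from their rows.
pull : ℕ → Gr → Row × Gr
pull _ [] = [] , []
pull zero (r ∷ H) = r , H
pull (suc j) (r ∷ H) = cons (pull j H)
  where cons : Row × Gr → Row × Gr
        cons (a , H′) = bitAt j r ∷ a , delete j r ∷ H′

eqRow : Row → Row → Bool
eqRow [] [] = true
eqRow (true ∷ x) (true ∷ y) = eqRow x y
eqRow (false ∷ x) (false ∷ y) = eqRow x y
eqRow _ _ = false

eqRow-sound : ∀ x y → eqRow x y ≡ true → x ≡ y
eqRow-sound [] [] _ = refl
eqRow-sound (true ∷ x) (true ∷ y) e = cong (true ∷_) (eqRow-sound x y e)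
eqRow-sound (false ∷ x) (false ∷ y) e = cong (false ∷_) (eqRow-sound x y e)

rowAt? : ℕ → List Row → Row → Bool
rowAt? _ [] r = false
rowAt? zero (a ∷ as) r = eqRow a r
rowAt? (suc j) (a ∷ as) r = rowAt? j as r

-- A preselection only: `assignAny` compares the row again at each proposed position, so its
-- soundness holds for any list of positions.
positions : ℕ → List Row → List ℕ → Row → ℕ → List ℕ
positions j (a ∷ as) (i ∷ is) r v =
  if i ≡ᵇ v then (if eqRow a r then j ∷ positions (suc j) as is r v else positions (suc j) as is r v)
  else positions (suc j) as is r v
positions _ _ _ _ _ = []

-- The last vertices of the target are assigned first; accs holds, for each vertex still
-- available, its adjacencies to the suffix assigned so far.
mutual
  assign : List (ℕ × Row) → List Row → List ℕ → Gr → Bool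
  assign [] accs invs [] = true
  assign [] accs invs (_ ∷ _) = false
  assign ((v , r) ∷ rs) accs invs G = assignAny v r rs accs invs G (positions 0 accs invs r v)

  assignAny : ℕ → Row → List (ℕ × Row) → List Row → List ℕ → Gr → List ℕ → Bool
  assignAny v r rs accs invs G [] = false
  assignAny v r rs accs invs G (j ∷ js) =
    (rowAt? j accs r ∧ assignAt rs (delete j accs) (delete j invs) (pull j G)) ∨ assignAny v r rs accs invs G js

  assignAt : List (ℕ × Row) → List Row → List ℕ → Row × Gr → Bool
  assignAt rs accs invs (a , G) = assign rs (zipWith _∷_ a accs) invs G

addTo : ℕ → Row → List ℕ → List ℕ
addTo x (true ∷ r) (s ∷ ss) = (x + s) ∷ addTo x r ss
addTo x (false ∷ r) (s ∷ ss) = s ∷ addTo x r ss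
addTo x _ ss = ss

dot : Row → List ℕ → ℕ
dot (true ∷ r) (s ∷ ss) = s + dot r ss
dot (false ∷ r) (s ∷ ss) = dot r ss
dot _ _ = 0

nbrSums : Gr → List ℕ → List ℕ
nbrSums (r ∷ H) (x ∷ xs) = dot r xs ∷ addTo x r (nbrSums H xs)
nbrSums _ _ = []

-- Only a heuristic: an isomorphism is looked for among the bijections preserving these values.
invariants : Gr → List ℕ
invariants G = round (round (round (map (λ _ → 1) G)))
  where round : List ℕ → List ℕ
        round xs = nbrSums G (map (λ x → x * x + 1) xs)

zip′ : List ℕ → Gr → List (ℕ × Row)
zip′ (i ∷ is) (r ∷ rs) = (i , r) ∷ zip′ is rs
zip′ _ _ = []

record Target : Set where
  constructor target
  field
    graph : Gr
    code : List (ℕ × Row)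
    hash : ℕ

hashOf : List ℕ → ℕ
hashOf = sum (λ x → x * x)

mkTarget : Gr → Target
mkTarget G = target G (zip′ (reverse (invariants G)) (reverse G)) (hashOf (invariants G))

eqGr : Gr → Gr → Bool
eqGr [] [] = true
eqGr (x ∷ xs) (y ∷ ys) = eqRow x y ∧ eqGr xs ys
eqGr _ _ = false

eqGr-sound : ∀ x y → eqGr x y ≡ true → x ≡ y
eqGr-sound [] [] _ = refl
eqGr-sound (x ∷ xs) (y ∷ ys) e with ∧-true {eqRow x y} e
... | p , q = cong₂ _∷_ (eqRow-sound x y p) (eqGr-sound xs ys q)

-- The code is compared with the target graph before it is used, so that soundness depends neither
-- on how `mkTarget` builds the code nor on the hash.
isoWith : Gr → List ℕ → ℕ → Target → Bool
isoWith G invs h (target T code k) =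
  if h ≡ᵇ k then eqGr (map proj₂ code ʳ++ []) T ∧ assign code (map (λ _ → []) G) invs G else false

anyIso : Gr → List ℕ → List Target → Bool
anyIso G invs [] = false
anyIso G invs (T ∷ Ts) = isoWith G invs (hashOf invs) T ∨ anyIso G invs Ts

-- The trace (row) of a neighbour of v on the known graph, with the independent sets of each relevant size that it
-- misses; an entry (i , levels) of the search records the sets missed by i + 1 chosen traces at once.
record Cand : Set where
  constructor cand
  field
    row : Row
    size : ℕ
    miss : List Row

mkCand : List (List Row) → Row → Cand
mkCand fams S = cand S (ones S) (map (map (disjoint S)) fams)

bothRows : Row → Row → Row
bothRows = zipWith _∧_

Entry : Set
Entry = ℕ × List Row

headDisjoint : List Row → List Row → Bool
headDisjoint (x ∷ _) (y ∷ _) = disjoint x y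
headDisjoint _ _ = true

-- An entry with index i stands for i + 1 chosen neighbours of v, and its head level for the
-- independent sets of k - i - 1 vertices of H_v. If a set is missed by all of these neighbours and
-- by the new one, there are k + 1 independent vertices in all.
addOK : List Entry → Cand → Bool
addOK [] c = true
addOK ((i , lv) ∷ es) c = headDisjoint lv (drop i (Cand.miss c)) ∧ addOK es c

merge : Cand → Entry → Entry
merge c (i , lv) = suc i , drop 1 (zipWith bothRows lv (drop i (Cand.miss c)))

push : List Entry → Cand → List Entry
push es c = (0 , Cand.miss c) ∷ map (merge c) es ++ es

compat : Cand → Cand → Bool
compat c d = headDisjoint (Cand.miss c) (Cand.miss d)

-- A candidate at the head of the list is either the trace of one of the remaining neighbours, or dropped;
-- pruning relies on the list being sorted by size.
module Search (leaf : List Row → Bool) where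

  mutual
    search : ℕ → ℕ → List Entry → List Row → List Cand → Bool
    search zero left es rows cs = leaf rows
    search (suc r) left es rows [] = true
    search (suc r) left es rows (c ∷ cs) =
      if Cand.size c * suc r ≤ᵇ left
      then searchWith r left es rows c cs (addOK es c) ∧ search (suc r) left es rows cs
      else true

    searchWith : ℕ → ℕ → List Entry → List Row → Cand → List Cand → Bool → Bool
    searchWith r left es rows c cs false = true
    searchWith r left es rows c cs true =
      -- The candidate `c` itself stays available, since several neighbours of v may have the same
      -- trace.
      search r (left ∸ Cand.size c) (push es c) (Cand.row c ∷ rows) (filterᵇ (compat c) (c ∷ cs))

families : ℕ → List Row → ℕ → ℕ → List (List Row)
families k all i zero = []
families k all i (suc c) = filterᵇ (λ J → ones J + i ≡ᵇ k) all ∷ families k all (suc i) c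

bySize : List Row → ℕ → ℕ → List Row
bySize all s zero = []
bySize all s (suc c) = filterᵇ (λ S → ones S ≡ᵇ s) all ++ bySize all (suc s) c

-- Here d is the degree of v, and `tot` bounds the number of edges between its neighbours and H_v.
-- The conflict of j neighbours involves sets of k + 1 - j vertices, for 2 ≤ j ≤ d, whence `pred d`
-- families.
glueWith : (List Row → Bool) → ℕ → ℕ → ℕ → List Row → Bool
glueWith leaf k d tot sets = Search.search leaf d tot [] []
  (map (mkCand (families k sets 1 (pred d))) (bySize sets 0 (suc tot)))

glue : (List Row → Bool) → ℕ → ℕ → ℕ → Gr → Bool
glue leaf k d tot H = glueWith leaf k d tot (indepSets H)

coneRows : List Row → Gr → Gr
coneRows [] H = H
coneRows (S ∷ Ss) H = (replicate (length Ss) false ++ S) ∷ coneRows Ss H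

-- Vertex order: the new vertex, its neighbours, the old graph.
glued : Gr → List Row → Gr
glued H Ss = (replicate (length Ss) true ++ replicate (length H) false) ∷ coneRows Ss H

-- With no targets every leaf fails, so that a successful search then means that no extension
-- exists.
isoLeaf : List Target → Gr → List Row → Bool
isoLeaf Ts H Ss = withGraph (glued H Ss)
  where withInvs : Gr → List ℕ → Bool
        withInvs G invs = anyIso G invs Ts
        withGraph : Gr → Bool
        withGraph G = withInvs G (invariants G)

-- Soundness of the isomorphism test and of the search for extensions

AllPairs-++⁺ : ∀ {A : Set} {R : A → A → Set} {xs ys} → AllPairs R xs → AllPairs R ys →
  (∀ {x y} → x ∈ xs → y ∈ ys → R x y) → AllPairs R (xs ++ ys)
AllPairs-++⁺ [] q h = q
AllPairs-++⁺ {xs = x ∷ xs} {ys} (a ∷ p) q h =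
  All.tabulate (λ i → go (∈-++⁻ xs i)) ∷ AllPairs-++⁺ p q (λ i j → h (there i) j)
  where
    go : ∀ {y} → y ∈ xs ⊎ y ∈ ys → _
    go (inj₁ i) = All.lookup a i
    go (inj₂ j) = h (here refl) j

∨-true : ∀ {x y} → x ∨ y ≡ true → x ≡ true ⊎ y ≡ true
∨-true {true} _ = inj₁ refl
∨-true {false} e = inj₂ e

module Gluing {V : Set} (_≟_ : DecidableEquality V) (adj : V → V → Bool)
  (adj-sym : ∀ u v → adj u v ≡ adj v u) (adj-irr : ∀ v → adj v v ≡ false) where

  open Ambient _≟_ adj adj-sym adj-irr

  -- The vertices are taken in the order of the list, so an isomorphism with H is a permutation of
  -- the list followed by `Matches`.
  data Matches : Gr → List V → Set where
    []  : Matches [] []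
    _∷_ : ∀ {r H y ys} → map (adj y) ys ≡ r → Matches H ys → Matches (r ∷ H) (y ∷ ys)

  Matches-length : ∀ {H ys} → Matches H ys → length H ≡ length ys
  Matches-length [] = refl
  Matches-length (_ ∷ m) = cong suc (Matches-length m)

  cone : List V → V → Row
  cone ys x = map (adj x) ys

  cone-ones : ∀ ys x → ones (cone ys x) ≡ deg x ys
  cone-ones ys x = sum-map b (adj x) ys

  Matches-edges : ∀ {H ys} → Matches H ys → edges ys ≡ grEdges H
  Matches-edges [] = refl
  Matches-edges {ys = y ∷ ys} (refl ∷ m) = cong₂ _+_ (sym (cone-ones ys y)) (Matches-edges m)

  disjoint-cones : ∀ ys x y → (∀ {z} → z ∈ ys → adj y z ≡ true → adj x z ≡ true → ⊥) →
                   disjoint (cone ys y) (cone ys x) ≡ true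
  disjoint-cones [] x y h = refl
  disjoint-cones (z ∷ ys) x y h with adj y z in e₁ | adj x z in e₂
  ... | true | true = ⊥-elim (h (here refl) e₁ e₂)
  ... | true | false = disjoint-cones ys x y (h ∘ there)
  ... | false | _ = disjoint-cones ys x y (h ∘ there)

  cone-indep : ∀ {H ys} x → Matches H ys →
    (∀ {y z} → y ∈ ys → z ∈ ys → adj x y ≡ true → adj x z ≡ true → adj y z ≡ true → ⊥) →
    IndepRow H (cone ys x)
  cone-indep x [] h = []
  cone-indep {ys = y ∷ ys} x (refl ∷ m) h =
    (λ e → disjoint-cones ys x y (λ i p q → h (here refl) (there i) e q p))
    ∷ cone-indep x m (λ i j → h (there i) (there j))

  disjoint-select : ∀ (f : V → Bool) ys J → disjoint (map f ys) J ≡ true → ∀ {z} → z ∈ select J ys → f z ≡ false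
  disjoint-select f (y ∷ ys) (true ∷ J) e (here refl) with f y
  ... | false = refl
  disjoint-select f (y ∷ ys) (true ∷ J) e (there i) with f y
  ... | false = disjoint-select f ys J e i
  disjoint-select f (y ∷ ys) (false ∷ J) e i with f y
  ... | true = disjoint-select f ys J e i
  ... | false = disjoint-select f ys J e i

  select-indep : ∀ {H ys J} → Matches H ys → IndepRow H J → Indep (select J ys)
  select-indep [] [] = []
  select-indep {ys = y ∷ ys} {true ∷ J} (refl ∷ m) (d ∷ p) =
    All.tabulate (λ i → disjoint-select (adj y) ys J (d refl) i) ∷ select-indep m p
  select-indep {J = false ∷ J} (refl ∷ m) (d ∷ p) = select-indep m p

  Matches-glued : ∀ {H ys v} zs → Matches H ys → Indep zs →
    (∀ {x} → x ∈ zs → adj v x ≡ true) → (∀ {x} → x ∈ ys → adj v x ≡ false) →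
    Matches (glued H (map (cone ys) zs)) (v ∷ zs ++ ys)
  Matches-glued {H} {ys} {v} zs m ind nb fr = top ∷ go zs ind
    where
      const-row : ∀ u c us → (∀ {x} → x ∈ us → adj u x ≡ c) → map (adj u) us ≡ replicate (length us) c
      const-row u c [] h = refl
      const-row u c (x ∷ us) h = cong₂ _∷_ (h (here refl)) (const-row u c us (h ∘ there))
      top : map (adj v) (zs ++ ys) ≡ replicate (length (map (cone ys) zs)) true ++ replicate (length H) false
      top = trans (map-++ (adj v) zs ys) (cong₂ _++_
        (trans (const-row v true zs nb) (cong (λ n → replicate n true) (sym (length-map (cone ys) zs))))
        (trans (const-row v false ys fr) (cong (λ n → replicate n false) (sym (Matches-length m)))))
      go : ∀ us → Indep us → Matches (coneRows (map (cone ys) us) H) (us ++ ys)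
      go [] [] = m
      go (u ∷ us) (a ∷ i) = trans (map-++ (adj u) us ys) (cong (_++ cone ys u)
        (trans (const-row u false us (All.lookup a)) (cong (λ n → replicate n false) (sym (length-map (cone ys) us)))))
        ∷ go us i

  delete-map : ∀ {A B : Set} j (f : A → B) xs → delete j (map f xs) ≡ map f (delete j xs)
  delete-map _ f [] = refl
  delete-map zero f (x ∷ xs) = refl
  delete-map (suc j) f (x ∷ xs) = cong (f x ∷_) (delete-map j f xs)

  -- The last two components, for arbitrary f, tie position j of any list computed from `zs` to the
  -- same vertex z.
  pull-sound : ∀ j {G zs} → Matches G zs → j < length zs → ∃ λ z → (zs ↭ z ∷ delete j zs) ×
    (map (adj z) (delete j zs) ≡ proj₁ (pull j G)) × Matches (proj₂ (pull j G)) (delete j zs) ×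
    (∀ (f : V → Row) r → rowAt? j (map f zs) r ≡ true → f z ≡ r) ×
    (∀ {f : V → Bool} → bitAt j (map f zs) ≡ f z)
  pull-sound zero {zs = z ∷ zs} (e ∷ m) _ = z , ↭-refl , e , m , (λ f r q → eqRow-sound (f z) r q) , refl
  pull-sound (suc j) {zs = y ∷ zs} (refl ∷ m) (s≤s l) with pull-sound j m l
  ... | z , p , a , m′ , at , bt =
    z , ↭-trans (prep y p) (swap y z ↭-refl) ,
    cong₂ _∷_ (trans (adj-sym z y) (sym bt)) a ,
    (sym (delete-map j (adj y) zs) ∷ m′) , at , bt

  rowAt?-length : ∀ j (f : V → Row) zs r → rowAt? j (map f zs) r ≡ true → j < length zs
  rowAt?-length zero f (z ∷ zs) r e = s≤s z≤n
  rowAt?-length (suc j) f (z ∷ zs) r e = s≤s (rowAt?-length j f zs r e)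

  zip-cons : ∀ z chosen zs → zipWith _∷_ (map (adj z) zs) (map (λ u → map (adj u) chosen) zs)
             ≡ map (λ u → map (adj u) (z ∷ chosen)) zs
  zip-cons z chosen [] = refl
  zip-cons z chosen (u ∷ zs) = cong₂ _∷_ (cong (_∷ map (adj u) chosen) (adj-sym z u)) (zip-cons z chosen zs)

  mutual
    -- The invariant: `chosen` realises the suffix `Ts` of the target, and the accumulated rows are
    -- the adjacencies to `chosen`. A vertex whose row agrees with the next target row can be put in
    -- front of both.
    assign-sound : ∀ rs {invs G avail chosen Ts} → Matches G avail → Matches Ts chosen →
      assign rs (map (λ z → map (adj z) chosen) avail) invs G ≡ true →
      ∃ λ full → full ↭ avail ++ chosen × Matches (map proj₂ rs ʳ++ Ts) full
    assign-sound [] [] mT e = _ , ↭-refl , mT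
    assign-sound ((v , r) ∷ rs) {invs} {G} {avail} {chosen} mG mT e =
      assignAny-sound v r rs (positions 0 (map (λ z → map (adj z) chosen) avail) invs r v) mG mT e

    assignAny-sound : ∀ v r rs js {invs G avail chosen Ts} → Matches G avail → Matches Ts chosen →
      assignAny v r rs (map (λ z → map (adj z) chosen) avail) invs G js ≡ true →
      ∃ λ full → full ↭ avail ++ chosen × Matches (map proj₂ rs ʳ++ (r ∷ Ts)) full
    assignAny-sound v r rs (j ∷ js) {invs} {G} {avail} {chosen} mG mT e
      with rowAt? j (map (λ z → map (adj z) chosen) avail) r in at
    ... | false = assignAny-sound v r rs js mG mT e
    ... | true with assignAt rs (delete j (map (λ z → map (adj z) chosen) avail)) (delete j invs) (pull j G) in ass
    ... | false = assignAny-sound v r rs js mG mT e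
    ... | true with pull-sound j mG (rowAt?-length j _ avail r at)
    ... | z , p , a , mG′ , row , _
      with assign-sound rs {delete j invs} {proj₂ (pull j G)} {delete j avail} {z ∷ chosen} mG′ (row _ r at ∷ mT)
             (subst (λ q → assign rs q (delete j invs) (proj₂ (pull j G)) ≡ true)
               (trans (cong₂ (zipWith _∷_) (sym a) (delete-map j _ avail)) (zip-cons z chosen (delete j avail))) ass)
    ... | full , q , mF = full , ↭-trans q (↭-trans (shift z (delete j avail) chosen) (++⁺ʳ chosen (↭-sym p))) , mF

  anyIso-sound : ∀ {G zs invs} Ts → Matches G zs → anyIso G invs (map mkTarget Ts) ≡ true →
                 Any (λ T → ∃ λ full → full ↭ zs × Matches T full) Ts
  anyIso-sound {G} {zs} {invs} (T ∷ Ts) m e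
    with hashOf invs ≡ᵇ Target.hash (mkTarget T)
  ... | false = there (anyIso-sound Ts m e)
  ... | true with eqGr (map proj₂ (Target.code (mkTarget T)) ʳ++ []) T in eq
  ... | false = there (anyIso-sound Ts m e)
  ... | true with assign (Target.code (mkTarget T)) (map (λ _ → []) G) invs G in as
  ... | false = there (anyIso-sound Ts m e)
  ... | true with assign-sound (Target.code (mkTarget T)) {invs} {G} {zs} {[]} m []
                    (subst (λ q → assign (Target.code (mkTarget T)) q invs G ≡ true) (accs m) as)
    where
      accs : ∀ {G zs} → Matches G zs → map {B = Row} (λ _ → []) G ≡ map (λ z → map (adj z) []) zs
      accs [] = refl
      accs (_ ∷ m) = cong ([] ∷_) (accs m)
  ... | full , p , mF = here (full , ↭-trans p (Perm.↭-reflexive (++-identityʳ zs)) , subst (λ q → Matches q full) (eqGr-sound _ _ eq) mF)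

≡ᵇ-sound : ∀ {m n} → (m ≡ᵇ n) ≡ true → m ≡ n
≡ᵇ-sound {m} {n} p = ≡ᵇ⇒≡ m n (≡⇒T p)

≡ᵇ-complete : ∀ {m n} → m ≡ n → (m ≡ᵇ n) ≡ true
≡ᵇ-complete {m} {n} p = T⇒≡ (≡⇒≡ᵇ m n p)

Families : ℕ → Gr → ℕ → List (List Row) → Set
Families k H i [] = ⊤
Families k H i (F ∷ fs) = (∀ {J} → J ∈ F → IndepRow H J × ones J + i ≡ k) × Families k H (suc i) fs

families-sound : ∀ k H i c → Families k H i (families k (indepSets H) i c)
families-sound k H i zero = tt
families-sound k H i (suc c) = fam , families-sound k H (suc i) c
  where
    fam : ∀ {J} → J ∈ filterᵇ (λ J → ones J + i ≡ᵇ k) (indepSets H) → IndepRow H J × ones J + i ≡ k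
    fam j with ∈-filterᵇ⁻ (λ J → ones J + i ≡ᵇ k) (indepSets H) j
    ... | p , e = indepSets-sound H p , ≡ᵇ-sound e

Families-drop : ∀ {k H i} j fs → Families k H i fs → Families k H (j + i) (drop j fs)
Families-drop zero fs f = f
Families-drop (suc j) [] f = tt
Families-drop {k} {H} {i} (suc j) (F ∷ fs) (_ , f) =
  subst (λ n → Families k H n (drop j fs)) (+-suc j i) (Families-drop j fs f)

bySize-⊆ : ∀ all s c {S} → S ∈ bySize all s c → s ≤ ones S
bySize-⊆ all s (suc c) {S} i with ∈-++⁻ (filterᵇ (λ S → ones S ≡ᵇ s) all) i
... | inj₁ j = ≤-reflexive (sym (≡ᵇ-sound (proj₂ (∈-filterᵇ⁻ (λ S → ones S ≡ᵇ s) all j))))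
... | inj₂ j = <⇒≤ (bySize-⊆ all (suc s) c j)

bySize-complete : ∀ all s c {S} → S ∈ all → s ≤ ones S → ones S < s + c → S ∈ bySize all s c
bySize-complete all s zero i p q = ⊥-elim (<⇒≱ q (≤-trans (≤-reflexive (+-identityʳ s)) p))
bySize-complete all s (suc c) {S} i p q with ones S ≤? s
... | yes r = ∈-++⁺ˡ (∈-filterᵇ⁺ (λ S → ones S ≡ᵇ s) i (≡ᵇ-complete (≤-antisym r p)))
... | no r = ∈-++⁺ʳ (filterᵇ (λ S → ones S ≡ᵇ s) all)
  (bySize-complete all (suc s) c i (≰⇒> r) (subst (ones S <_) (+-suc s c) q))

bySize-sorted : ∀ all s c → AllPairs (λ S S′ → ones S ≤ ones S′) (bySize all s c)
bySize-sorted all s zero = []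
bySize-sorted all s (suc c) = AllPairs-++⁺ (eq (filterᵇ _ all) (λ j → sound j)) (bySize-sorted all (suc s) c)
  (λ i j → ≤-trans (≤-reflexive (sound i)) (<⇒≤ (bySize-⊆ all (suc s) c j)))
  where
    sound : ∀ {S} → S ∈ filterᵇ (λ S → ones S ≡ᵇ s) all → ones S ≡ s
    sound j = ≡ᵇ-sound (proj₂ (∈-filterᵇ⁻ (λ S → ones S ≡ᵇ s) all j))
    eq : ∀ ss → (∀ {S} → S ∈ ss → ones S ≡ s) → AllPairs (λ S S′ → ones S ≤ ones S′) ss
    eq [] h = []
    eq (S ∷ ss) h = All.tabulate (λ j → ≤-reflexive (trans (h (here refl)) (sym (h (there j))))) ∷ eq ss (h ∘ there)

module Searching {V : Set} (_≟_ : DecidableEquality V) (adj : V → V → Bool)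
  (adj-sym : ∀ u v → adj u v ≡ adj v u) (adj-irr : ∀ v → adj v v ≡ false) where

  open Ambient _≟_ adj adj-sym adj-irr
  open Gluing _≟_ adj adj-sym adj-irr

  module Cones {xs ys N : List V} {H : Gr} {k : ℕ} (al : Alpha≤ k xs) (m : Matches H ys)
    (ys! : Unique ys) (ys⊆ : ∀ {x} → x ∈ ys → x ∈ xs)
    (N! : Unique N) (N⊆ : ∀ {x} → x ∈ N → x ∈ xs)
    (N-indep : ∀ {x y} → x ∈ N → y ∈ N → adj x y ≡ false)
    (N#ys : ∀ {x} → x ∈ N → x ∉ ys)
    (N-cone : ∀ {x} → x ∈ N → IndepRow H (cone ys x)) where

    -- The members of `N` are pairwise non-adjacent, so `X` together with the vertices of `J` is an
    -- independent set of the whole graph.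
    few-miss : ∀ {J X} → IndepRow H J → Unique X → (∀ {x} → x ∈ X → x ∈ N) →
               (∀ {x} → x ∈ X → disjoint (cone ys x) J ≡ true) → length X + ones J ≤ k
    few-miss {J} {X} p X! X⊆ d = subst (_≤ k) (begin
        length (X ++ select J ys) ≡⟨ length-++ X ⟩
        length X + length (select J ys)
          ≡⟨ cong (length X +_) (select-length J ys (trans (IndepRow-length p) (Matches-length m))) ⟩
        length X + ones J ∎)
      (al (X ++ select J ys)
        (AllPairs-++⁺ X! (select-AllPairs J ys!) (λ { i j refl → N#ys (X⊆ i) (select-⊆ J ys j) }))
        sub
        (AllPairs-++⁺ (Indep-from-∈ X (λ i j → N-indep (X⊆ i) (X⊆ j))) (select-indep m p)
          (λ {x} i j → disjoint-select (adj x) ys J (d i) j)))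
      where
        open ≡-Reasoning
        sub : ∀ {z} → z ∈ X ++ select J ys → z ∈ xs
        sub i with ∈-++⁻ X i
        ... | inj₁ j = N⊆ (X⊆ j)
        ... | inj₂ j = ys⊆ (select-⊆ J ys j)

    module _ (leaf : List Row → Bool) (fams : List (List Row)) (famsOK : Families k H 1 fams) where

      open Search leaf

      -- Only one direction is recorded: a true entry certifies a set missed by all of `X`. Two true
      -- entries at the same place then contradict `few-miss`, which is why an admissible choice of
      -- traces is never pruned.
      LevelOK : List V → List Row → Row → Set
      LevelOK X (J ∷ F) (x ∷ l) = (x ≡ true → ∀ {z} → z ∈ X → disjoint (cone ys z) J ≡ true) × LevelOK X F l
      LevelOK X _ _ = ⊤

      LevelsOK : List V → List (List Row) → List Row → Set
      LevelsOK X (F ∷ fs) (l ∷ ls) = LevelOK X F l × LevelsOK X fs ls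
      LevelsOK X _ _ = ⊤

      LevelOK-single : ∀ z F → LevelOK (z ∷ []) F (map (disjoint (cone ys z)) F)
      LevelOK-single z [] = tt
      LevelOK-single z (J ∷ F) = (λ { e (here refl) → e }) , LevelOK-single z F

      LevelsOK-single : ∀ z fs → LevelsOK (z ∷ []) fs (map (map (disjoint (cone ys z))) fs)
      LevelsOK-single z [] = tt
      LevelsOK-single z (F ∷ fs) = LevelOK-single z F , LevelsOK-single z fs

      LevelsOK-drop : ∀ {X} i fs ls → LevelsOK X fs ls → LevelsOK X (drop i fs) (drop i ls)
      LevelsOK-drop zero fs ls p = p
      LevelsOK-drop (suc i) [] ls p = tt
      LevelsOK-drop {X} (suc i) (F ∷ fs) [] p = none (drop i fs)
        where none : ∀ fs → LevelsOK X fs []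
              none [] = tt
              none (_ ∷ _) = tt
      LevelsOK-drop (suc i) (F ∷ fs) (l ∷ ls) (_ , p) = LevelsOK-drop i fs ls p

      LevelOK-both : ∀ {z X} F l l′ → LevelOK X F l → LevelOK (z ∷ []) F l′ → LevelOK (z ∷ X) F (bothRows l l′)
      LevelOK-both [] l l′ p q = tt
      LevelOK-both (J ∷ F) [] l′ p q = tt
      LevelOK-both (J ∷ F) (x ∷ l) [] p q = tt
      LevelOK-both (J ∷ F) (x ∷ l) (y ∷ l′) (p , ps) (q , qs) =
        (λ { e (here refl) → q (proj₂ (∧-true {x} e)) (here refl)
           ; e (there i) → p (proj₁ (∧-true {x} e)) i }) , LevelOK-both F l l′ ps qs

      LevelsOK-both : ∀ {z X} fs ls ls′ → LevelsOK X fs ls → LevelsOK (z ∷ []) fs ls′ →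
                      LevelsOK (z ∷ X) fs (zipWith bothRows ls ls′)
      LevelsOK-both [] ls ls′ p q = tt
      LevelsOK-both (F ∷ fs) [] ls′ p q = tt
      LevelsOK-both (F ∷ fs) (l ∷ ls) [] p q = tt
      LevelsOK-both (F ∷ fs) (l ∷ ls) (l′ ∷ ls′) (p , ps) (q , qs) =
        LevelOK-both F l l′ p q , LevelsOK-both fs ls ls′ ps qs

      LevelOK-disjoint : ∀ {z X} F l l′ → LevelOK X F l → LevelOK (z ∷ []) F l′ → length F ≡ length l →
        (∀ {J} → J ∈ F → (∀ {x} → x ∈ z ∷ X → disjoint (cone ys x) J ≡ true) → ⊥) → disjoint l l′ ≡ true
      LevelOK-disjoint [] [] l′ p q e h = refl
      LevelOK-disjoint (J ∷ F) (true ∷ l) [] p q e h = refl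
      LevelOK-disjoint (J ∷ F) (false ∷ l) [] p q e h = refl
      LevelOK-disjoint (J ∷ F) (true ∷ l) (true ∷ l′) (p , ps) (q , qs) e h =
        ⊥-elim (h (here refl) (λ { (here refl) → q refl (here refl) ; (there i) → p refl i }))
      LevelOK-disjoint (J ∷ F) (true ∷ l) (false ∷ l′) (p , ps) (q , qs) e h =
        LevelOK-disjoint F l l′ ps qs (suc-injective e) (h ∘ there)
      LevelOK-disjoint (J ∷ F) (false ∷ l) (y ∷ l′) (p , ps) (q , qs) e h =
        LevelOK-disjoint F l l′ ps qs (suc-injective e) (h ∘ there)

      -- Entries beyond the end of a family are not controlled by `LevelOK` but would take part in
      -- `disjoint`; hence the lengths are tracked as well.
      SameShape : List (List Row) → List Row → Set
      SameShape (F ∷ fs) (l ∷ ls) = length F ≡ length l × SameShape fs ls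
      SameShape [] (_ ∷ _) = ⊥
      SameShape _ [] = ⊤

      SameShape-[] : ∀ fs → SameShape fs []
      SameShape-[] [] = tt
      SameShape-[] (_ ∷ _) = tt

      SameShape-drop : ∀ i fs ls → SameShape fs ls → SameShape (drop i fs) (drop i ls)
      SameShape-drop zero fs ls p = p
      SameShape-drop (suc i) fs [] p = SameShape-[] (drop (suc i) fs)
      SameShape-drop (suc i) (F ∷ fs) (l ∷ ls) (_ , p) = SameShape-drop i fs ls p

      SameShape-miss : ∀ z fs → SameShape fs (map (map (disjoint (cone ys z))) fs)
      SameShape-miss z [] = tt
      SameShape-miss z (F ∷ fs) = sym (length-map _ F) , SameShape-miss z fs

      SameShape-both : ∀ fs ls ls′ → SameShape fs ls → SameShape fs ls′ → SameShape fs (zipWith bothRows ls ls′)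
      SameShape-both fs [] ls′ p q = SameShape-[] fs
      SameShape-both fs (l ∷ ls) [] p q = SameShape-[] fs
      SameShape-both (F ∷ fs) (l ∷ ls) (l′ ∷ ls′) (p , ps) (q , qs) =
        trans p (len l l′ (trans (sym p) q)) , SameShape-both fs ls ls′ ps qs
        where len : ∀ (l l′ : Row) → length l ≡ length l′ → length l ≡ length (bothRows l l′)
              len [] [] e = refl
              len (x ∷ l) (y ∷ l′) e = cong suc (len l l′ (suc-injective e))

      candOf : V → Cand
      candOf z = mkCand fams (cone ys z)

      EntryOK : List V → Entry → Set
      EntryOK ch (i , lv) = ∃ λ X → length X ≡ suc i × Unique X × (∀ {x} → x ∈ X → x ∈ ch) ×
                            LevelsOK X (drop i fams) lv × SameShape (drop i fams) lv

      headDisjoint-true : ∀ {X z} i fs ls ls′ → length X ≡ suc i → Unique (z ∷ X) →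
        (∀ {x} → x ∈ z ∷ X → x ∈ N) → Families k H (suc i) fs →
        LevelsOK X fs ls → SameShape fs ls → LevelsOK (z ∷ []) fs ls′ → SameShape fs ls′ → headDisjoint ls ls′ ≡ true
      headDisjoint-true i fs [] ls′ len zX! sub F p s q s′ = refl
      headDisjoint-true i fs (l ∷ ls) [] len zX! sub F p s q s′ = refl
      headDisjoint-true {X} {z} i (F ∷ fs) (l ∷ ls) (l′ ∷ ls′) len zX! sub (FJ , _) (p , _) (s , _) (q , _) _ =
        LevelOK-disjoint F l l′ p q s (λ {J} j d → <⇒≱ ≤-refl (begin
          suc k ≡⟨ cong suc (proj₂ (FJ j)) ⟨
          suc (ones J + suc i) ≡⟨ cong suc (+-comm (ones J) (suc i)) ⟩
          suc (suc i) + ones J ≡⟨ cong (λ n → suc n + ones J) len ⟨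
          length (z ∷ X) + ones J ≤⟨ few-miss (proj₁ (FJ j)) zX! sub d ⟩
          k ∎))
        where open ≤-Reasoning

      candOf-levels : ∀ z i → LevelsOK (z ∷ []) (drop i fams) (drop i (Cand.miss (candOf z)))
      candOf-levels z i = LevelsOK-drop i fams _ (LevelsOK-single z fams)

      candOf-shape : ∀ z i → SameShape (drop i fams) (drop i (Cand.miss (candOf z)))
      candOf-shape z i = SameShape-drop i fams _ (SameShape-miss z fams)

      entry-disjoint : ∀ {ch z i lv} → (∀ {x} → x ∈ z ∷ ch → x ∈ N) → z ∉ ch → EntryOK ch (i , lv) →
                       headDisjoint lv (drop i (Cand.miss (candOf z))) ≡ true
      entry-disjoint {ch} {z} {i} {lv} sub z∉ (X , len , X! , X⊆ , lo , sh) =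
        headDisjoint-true i (drop i fams) lv _ len
          (All.tabulate (λ { j refl → z∉ (X⊆ j) }) ∷ X!)
          (λ { (here e) → sub (here e) ; (there j) → sub (there (X⊆ j)) })
          (subst (λ n → Families k H n (drop i fams)) (+-comm i 1) (Families-drop i fams famsOK))
          lo sh (candOf-levels z i) (candOf-shape z i)

      addOK-true : ∀ {ch z} es → (∀ {x} → x ∈ z ∷ ch → x ∈ N) → z ∉ ch → All (EntryOK ch) es →
                   addOK es (candOf z) ≡ true
      addOK-true [] sub z∉ [] = refl
      addOK-true ((i , lv) ∷ es) sub z∉ (e ∷ ok) rewrite entry-disjoint sub z∉ e = addOK-true es sub z∉ ok

      single-entry : ∀ {ch} z → EntryOK (z ∷ ch) (0 , Cand.miss (candOf z))
      single-entry z = z ∷ [] , refl , [] ∷ [] , (λ { (here e) → here e }) , candOf-levels z 0 , candOf-shape z 0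

      weaken-entry : ∀ {ch z e} → EntryOK ch e → EntryOK (z ∷ ch) e
      weaken-entry (X , len , X! , X⊆ , lo , sh) = X , len , X! , there ∘ X⊆ , lo , sh

      merge-entry : ∀ {ch z e} → z ∉ ch → EntryOK ch e → EntryOK (z ∷ ch) (merge (candOf z) e)
      merge-entry {ch} {z} {i , lv} z∉ (X , len , X! , X⊆ , lo , sh) =
        z ∷ X , cong suc len , All.tabulate (λ { j refl → z∉ (X⊆ j) }) ∷ X! ,
        (λ { (here e) → here e ; (there j) → there (X⊆ j) }) ,
        subst (λ fs → LevelsOK (z ∷ X) fs (proj₂ (merge (candOf z) (i , lv)))) (drop-drop fams i)
          (LevelsOK-drop 1 (drop i fams) _ (LevelsOK-both (drop i fams) lv _ lo (candOf-levels z i))) ,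
        subst (λ fs → SameShape fs (proj₂ (merge (candOf z) (i , lv)))) (drop-drop fams i)
          (SameShape-drop 1 (drop i fams) _ (SameShape-both (drop i fams) lv _ sh (candOf-shape z i)))
        where
          drop-drop : ∀ {A : Set} (xs : List A) i → drop 1 (drop i xs) ≡ drop (suc i) xs
          drop-drop xs zero = refl
          drop-drop [] (suc i) = refl
          drop-drop (x ∷ xs) (suc i) = drop-drop xs i

      push-entries : ∀ {ch z} es → z ∉ ch → All (EntryOK ch) es → All (EntryOK (z ∷ ch)) (push es (candOf z))
      push-entries {ch} {z} es z∉ ok = single-entry z ∷ merged es ok
        where
          kept : ∀ es → All (EntryOK ch) es → All (EntryOK (z ∷ ch)) es
          kept es ok = All.map weaken-entry ok
          go : ∀ es′ → All (EntryOK ch) es′ → All (EntryOK (z ∷ ch)) (map (merge (candOf z)) es′ ++ es)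
          go [] [] = kept es ok
          go (e ∷ es′) (p ∷ ps) = merge-entry z∉ p ∷ go es′ ps
          merged = go

      -- The branch of the search to be followed is read off from the membership proofs, so
      -- candidates are never compared.
      scan : ∀ rem {c cs} → (∀ {x} → x ∈ rem → candOf x ∈ c ∷ cs) →
             (∃ λ x → x ∈ rem × candOf x ≡ c) ⊎ (∀ {x} → x ∈ rem → candOf x ∈ cs)
      scan [] h = inj₂ (λ ())
      scan (x ∷ rem) h with h (here refl)
      ... | here e = inj₁ (x , here refl , e)
      ... | there i with scan rem (h ∘ there)
      ... | inj₁ (y , j , e) = inj₁ (y , there j , e)
      ... | inj₂ g = inj₂ (λ { (here refl) → i ; (there j) → g j })

      sizes : List V → ℕ
      sizes = sum (λ x → ones (cone ys x))

      -- The actual neighbours of v are followed through the search tree: `ch` holds those whose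
      -- traces have been chosen, `rem` the others, whose traces are still among the candidates. The
      -- search fixes an order of the traces, so only some permutation of `N` reaches a leaf.
      SearchSound : ℕ → Set
      SearchSound r = ∀ left es ch rem cs → length rem ≡ r → sizes rem ≤ left → All (EntryOK ch) es →
        (rem ++ ch) ↭ N → (∀ {x} → x ∈ rem → candOf x ∈ cs) →
        AllPairs (λ c d → Cand.size c ≤ Cand.size d) cs →
        search r left es (map (cone ys) ch) cs ≡ true →
        ∃ λ zs → zs ↭ N × leaf (map (cone ys) zs) ≡ true

      search-sound-suc : ∀ r → SearchSound r → SearchSound (suc r)
      search-sound-suc r IH left es ch (x ∷ rem) [] len sz ok p h so e with () ← h (here refl)
      search-sound-suc r IH left es ch rem (c ∷ cs) len sz ok p h so@(below ∷ so′) e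
        with Cand.size c * suc r ≤ᵇ left in fits | scan rem h
      ... | false | _ = ⊥-elim (subst T fits (≤⇒≤ᵇ (begin
        Cand.size c * suc r ≡⟨ *-comm (Cand.size c) (suc r) ⟩
        suc r * Cand.size c ≡⟨ cong (_* Cand.size c) len ⟨
        length rem * Cand.size c ≡⟨ sum-const (Cand.size c) rem ⟨
        sum (λ _ → Cand.size c) rem ≤⟨ sum-mono rem (λ x i → smallest (h i)) ⟩
        sizes rem ≤⟨ sz ⟩
        left ∎)))
        where
          open ≤-Reasoning
          smallest : ∀ {d} → d ∈ c ∷ cs → Cand.size c ≤ Cand.size d
          smallest (here refl) = ≤-refl
          smallest (there i) = All.lookup below i
      ... | true | inj₂ g = search-sound-suc r IH left es ch rem cs len sz ok p g so′
              (proj₂ (∧-true {searchWith r left es _ c cs (addOK es c)} e))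
      ... | true | inj₁ (x , i , refl) with ∈-extract i
      ... | rem′ , q = IH (left ∸ ones (cone ys x)) (push es (candOf x)) (x ∷ ch) rem′ _
              (suc-injective (trans (sym (↭-length q)) len))
              (≤-trans (≤-reflexive (sym (m+n∸m≡n (ones (cone ys x)) _)))
                (∸-monoˡ-≤ (ones (cone ys x)) (≤-trans (≤-reflexive (sym (sum-↭ _ q))) sz)))
              (push-entries es x∉ch ok)
              perm
              (λ {y} j → ∈-filterᵇ⁺ (compat (candOf x)) (h (∈-resp-↭ (↭-sym q) (there j)))
                 (entry-disjoint {ch = x ∷ []} {z = y} {i = 0}
                   (λ { (here refl) → ∈-resp-↭ perm (∈-++⁺ˡ j) ; (there (here refl)) → x∈N })
                   (λ { (here refl) → x∉rem′ j }) (single-entry x)))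
              (AllPairs-filterᵇ (compat (candOf x)) so)
              (subst (λ t → searchWith r left es (map (cone ys) ch) (candOf x) cs t ≡ true)
                (addOK-true es (λ { (here refl) → x∈N ; (there j) → ∈-resp-↭ p (∈-++⁺ʳ rem j) }) x∉ch ok)
                (proj₁ (∧-true {searchWith r left es _ (candOf x) cs (addOK es (candOf x))} e)))
        where
          perm₀ : x ∷ rem′ ++ ch ↭ N
          perm₀ = ↭-trans (++⁺ʳ ch (↭-sym q)) p
          perm : rem′ ++ x ∷ ch ↭ N
          perm = ↭-trans (shift x rem′ ch) perm₀
          x∈N : x ∈ N
          x∈N = ∈-resp-↭ perm₀ (here refl)
          un : Unique (x ∷ rem′ ++ ch)
          un = Unique-↭ (↭-sym perm₀) N!
          x∉ : x ∉ rem′ ++ ch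
          x∉ j with un
          ... | a ∷ _ = All.lookup a j refl
          x∉ch : x ∉ ch
          x∉ch j = x∉ (∈-++⁺ʳ rem′ j)
          x∉rem′ : x ∉ rem′
          x∉rem′ j = x∉ (∈-++⁺ˡ j)

      search-sound : ∀ r → SearchSound r
      search-sound zero left es ch [] cs len sz ok p h so e = ch , p , e
      search-sound (suc r) = search-sound-suc r (search-sound r)

    glue-sound : ∀ leaf tot → glue leaf k (length N) tot H ≡ true → sum (λ x → ones (cone ys x)) N ≤ tot →
                 ∃ λ zs → zs ↭ N × leaf (map (cone ys) zs) ≡ true
    glue-sound leaf tot e sz = search-sound leaf fams famsOK (length N) tot [] [] N _ refl sz []
      (Perm.↭-reflexive (++-identityʳ N))
      (λ i → ∈-map⁺ (mkCand fams) (bySize-complete (indepSets H) 0 (suc tot) (indepSets-complete (N-cone i)) z≤n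
        (s≤s (≤-trans (∈⇒≤sum (λ x → ones (cone ys x)) i) sz))))
      (map⁺ (bySize-sorted (indepSets H) 0 (suc tot))) e
      where
        fams = families k (indepSets H) 1 (pred (length N))
        famsOK = families-sound k H 1 (pred (length N))

-- Lower bounds for the number of edges

allBelow : ℕ → (ℕ → Bool) → Bool
allBelow zero p = true
allBelow (suc n) p = p n ∧ allBelow n p

allBelow-sound : ∀ n p → allBelow n p ≡ true → ∀ d → d < n → p d ≡ true
allBelow-sound (suc n) p e d (s≤s l) with m≤n⇒m<n∨m≡n l
... | inj₁ d<n = allBelow-sound n p (proj₂ (∧-true {p n} e)) d d<n
... | inj₂ refl = proj₁ (∧-true {p n} e)

_⇒ᵇ_ : Bool → Bool → Bool
x ⇒ᵇ y = not x ∨ y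

⇒ᵇ-sound : ∀ {x y} → (x ⇒ᵇ y) ≡ true → x ≡ true → y ≡ true
⇒ᵇ-sound {true} e _ = e

lpCheck : LP → ℕ → ℕ → ℕ → (ℕ → ℕ) → Bool
lpCheck (lp s p c g h r) k n E t =
  (2 * p ≤ᵇ s * n) ∧
  ((s * n ∸ 2 * p) * E <ᵇ n * c + g * (2 * r)) ∧
  allBelow (suc k) (λ d → (suc d ≤ᵇ n) ⇒ᵇ (p * d + c + g * (h ∸ d) ≤ᵇ s * (d * d + t d))) ∧
  ((r ≡ᵇ 0) ∨ ((2 * E <ᵇ n * h) ∧ allBelow h (λ d → (suc d ≤ᵇ n) ⇒ᵇ (E + r ≤ᵇ t d + d * h))))

-- Linear programming duality against extensions

missWeight : List (Row × ℕ) → Row → ℕ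
missWeight live S = sum (λ { (J , w) → b (disjoint S J) * w }) live

tails : List (Row × ℕ) → List (Row × ℕ)
tails [] = []
tails ((J , w) ∷ l) = (drop 1 J , w) ∷ tails l

missed : List (Row × ℕ) → List (Row × ℕ)
missed [] = []
missed ((true ∷ J , w) ∷ l) = missed l
missed ((J , w) ∷ l) = (drop 1 J , w) ∷ missed l

-- Whether d · (lam · ∣S∣ + the weight missed by S) exceeds bud for every independent S; forb marks the vertices
-- excluded by the part of S chosen so far.
allAbove : ℕ → ℕ → ℕ → Gr → Row → List (Row × ℕ) → ℕ → Bool
allAbove bud d lam [] forb live acc = bud <ᵇ d * (acc + sum proj₂ live)
allAbove bud d lam (r ∷ H) [] live acc = false
allAbove bud d lam (r ∷ H) (f ∷ fs) live acc =
  allAbove bud d lam H fs (tails live) acc ∧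
  (f ∨ allAbove bud d lam H (zipWith _∨_ fs r) (missed live) (lam + acc))

zipWeights : List Row → List ℕ → List (Row × ℕ)
zipWeights (J ∷ Js) (w ∷ ws) = (J , w) ∷ zipWeights Js ws
zipWeights _ _ = []

weigh : ℕ → Gr → List ℕ → List (Row × ℕ)
weigh k H ws = zipWeights (filterᵇ (λ J → ones J + 1 ≡ᵇ k) (indepSets H)) ws

-- The weights price the constraints that each independent (k - 1)-set is missed by at most one
-- trace, and `lam` the bound `tot` on the total size of the traces. Hence the prices of the d
-- traces add up to at most the sum of the weights plus `lam * tot`, which is impossible if every
-- independent set costs more than the d-th part of it.
kill : ℕ → ℕ → ℕ → ℕ → List ℕ → Gr → Bool
kill k d tot lam ws H = go (weigh k H ws)
  where go : List (Row × ℕ) → Bool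
        go live = allAbove (sum proj₂ live + lam * tot) d lam H (replicate (length H) false) live 0

disjoint-[] : ∀ S → disjoint S [] ≡ true
disjoint-[] [] = refl
disjoint-[] (true ∷ S) = refl
disjoint-[] (false ∷ S) = refl

tails-missWeight : ∀ live S → missWeight live (false ∷ S) ≡ missWeight (tails live) S
tails-missWeight [] S = refl
tails-missWeight (([] , w) ∷ l) S = cong₂ (λ x y → b x * w + y) (sym (disjoint-[] S)) (tails-missWeight l S)
tails-missWeight ((x ∷ J , w) ∷ l) S = cong (b (disjoint S J) * w +_) (tails-missWeight l S)

missed-missWeight : ∀ live S → missWeight live (true ∷ S) ≡ missWeight (missed live) S
missed-missWeight [] S = refl
missed-missWeight (([] , w) ∷ l) S = cong₂ (λ x y → b x * w + y) (sym (disjoint-[] S)) (missed-missWeight l S)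
missed-missWeight ((true ∷ J , w) ∷ l) S = missed-missWeight l S
missed-missWeight ((false ∷ J , w) ∷ l) S = cong (b (disjoint S J) * w +_) (missed-missWeight l S)

disjoint-∨ : ∀ fs r S → disjoint fs S ≡ true → disjoint r S ≡ true → disjoint (zipWith _∨_ fs r) S ≡ true
disjoint-∨ [] r S p q = refl
disjoint-∨ (f ∷ fs) [] S p q = refl
disjoint-∨ (true ∷ fs) (true ∷ r) [] p q = refl
disjoint-∨ (true ∷ fs) (false ∷ r) [] p q = refl
disjoint-∨ (false ∷ fs) (true ∷ r) [] p q = refl
disjoint-∨ (false ∷ fs) (false ∷ r) [] p q = refl
disjoint-∨ (true ∷ fs) (true ∷ r) (false ∷ S) p q = disjoint-∨ fs r S p q
disjoint-∨ (true ∷ fs) (false ∷ r) (false ∷ S) p q = disjoint-∨ fs r S p q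
disjoint-∨ (false ∷ fs) (true ∷ r) (false ∷ S) p q = disjoint-∨ fs r S p q
disjoint-∨ (false ∷ fs) (false ∷ r) (x ∷ S) p q = disjoint-∨ fs r S p q

allAbove-sound : ∀ bud d lam H forb live acc {S} → allAbove bud d lam H forb live acc ≡ true →
  IndepRow H S → disjoint forb S ≡ true → bud < d * (acc + (lam * ones S + missWeight live S))
allAbove-sound bud d lam [] forb live acc e [] q = ≤-trans (<ᵇ-sound e)
  (*-monoʳ-≤ d (+-monoʳ-≤ acc (≤-trans (≤-reflexive (sym (miss-[] live))) (m≤n+m _ (lam * 0)))))
  where
    miss-[] : ∀ live → missWeight live [] ≡ sum proj₂ live
    miss-[] [] = refl
    miss-[] ((J , w) ∷ l) = cong₂ _+_ (+-identityʳ w) (miss-[] l)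
allAbove-sound bud d lam (r ∷ H) (f ∷ fs) live acc {false ∷ S} e (_ ∷ p) q =
  subst (λ m → bud < d * (acc + (lam * ones S + m))) (sym (tails-missWeight live S))
    (allAbove-sound bud d lam H fs (tails live) acc (proj₁ (∧-true e)) p (dis f q))
  where dis : ∀ f → disjoint (f ∷ fs) (false ∷ S) ≡ true → disjoint fs S ≡ true
        dis true q = q
        dis false q = q
allAbove-sound bud d lam (r ∷ H) (false ∷ fs) live acc {true ∷ S} e (i ∷ p) q =
  subst (bud <_) (trans
      (lem d lam acc (ones S) (missWeight (missed live) S))
      (cong (λ m → d * (acc + (lam * suc (ones S) + m))) (sym (missed-missWeight live S))))
    (allAbove-sound bud d lam H (zipWith _∨_ fs r) (missed live) (lam + acc)
      (proj₂ (∧-true {allAbove bud d lam H fs (tails live) acc} e)) p (disjoint-∨ fs r S q (i refl)))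
  where lem : ∀ d l a o m → d * (l + a + (l * o + m)) ≡ d * (a + (l * suc o + m))
        lem = solve-∀

-- Listed graphs with at least t edges are skipped: they cannot be an H_v with fewer than t edges.
-- Of the E edges, d lie at v and `grEdges H` inside H_v; the remainder joins the neighbours of v to
-- H_v.
allGlue : ℕ → List Target → ℕ → ℕ → ℕ → List Gr → Bool
allGlue t Ts k d E [] = true
allGlue t Ts k d E (H ∷ Hs) =
  ((t ≤ᵇ grEdges H) ∨ glue (isoLeaf Ts H) k d (E ∸ (d + grEdges H)) H) ∧ allGlue t Ts k d E Hs

allKill : ℕ → ℕ → ℕ → ℕ → List (ℕ × List ℕ) → List Gr → Bool
allKill t k d E _ [] = true
allKill t k d E [] (H ∷ Hs) = false
allKill t k d E ((lam , ws) ∷ cs) (H ∷ Hs) =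
  ((t ≤ᵇ grEdges H) ∨ kill k d (E ∸ (d + grEdges H)) lam ws H) ∧ allKill t k d E cs Hs

-- How the entry for n vertices in a table of lower bounds for the number of edges is obtained.
data Cert : Set where
  trivial : Cert
  given : ℕ → Cert
  byLP : ℕ → ℕ → LP → Cert

value : Cert → ℕ
value trivial = 0
value (given t) = t
value (byLP E t c) = t

-- The last entry of a table is repeated forever: it stands for the nonexistence of graphs.
at : List ℕ → ℕ → ℕ
at [] m = 0
at (x ∷ []) m = x
at (x ∷ y ∷ l) zero = x
at (x ∷ y ∷ l) (suc m) = at (y ∷ l) m

-- Refuting e ≤ E gives the entry E + 1. A larger one is allowed if E + 1 edges are already too many
-- for the inequality 2e ≤ n α; then there is no graph at all.
certCheck : ℕ → ℕ → List ℕ → Cert → Bool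
certCheck k n prev (byLP E t c) =
  lpCheck c (suc k) n E (λ d → at prev (n ∸ suc d)) ∧ ((t ≤ᵇ suc E) ∨ (n * suc k <ᵇ 2 * suc E))
certCheck k n prev _ = true

certsCheck : ℕ → ℕ → List ℕ → List Cert → Bool
certsCheck k n prev [] = true
certsCheck k n prev (c ∷ cs) = certCheck k n prev c ∧ certsCheck k (suc n) prev cs

-- Soundness of the edge bounds and of the catalogues

module Ramsey {V : Set} (_≟_ : DecidableEquality V) (adj : V → V → Bool)
  (adj-sym : ∀ u v → adj u v ≡ adj v u) (adj-irr : ∀ v → adj v v ≡ false) where

  open Ambient _≟_ adj adj-sym adj-irr
  open Gluing _≟_ adj adj-sym adj-irr
  open Searching _≟_ adj adj-sym adj-irr

  lpCheck-sound : ∀ c k n E t → lpCheck c k n E t ≡ true → LPValid c k n E t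
  lpCheck-sound (lp s p c g h r) k n E t e
    with ∧-true {2 * p ≤ᵇ s * n} e
  ... | e₁ , e′ with ∧-true {(s * n ∸ 2 * p) * E <ᵇ n * c + g * (2 * r)} e′
  ... | e₂ , e″ with ∧-true {allBelow (suc k) _} e″
  ... | e₃ , e₄ = record
    { slope≥0 = ≤ᵇ-sound e₁
    ; total = <ᵇ-sound e₂
    ; local = λ d l q → ≤ᵇ-sound (⇒ᵇ-sound {suc d ≤ᵇ n} (allBelow-sound (suc k) _ e₃ d (s≤s l)) (T⇒≡ (≤⇒≤ᵇ q)))
    ; lows = lows (∨-true {r ≡ᵇ 0} e₄) }
    where
      lows : (r ≡ᵇ 0) ≡ true ⊎ ((2 * E <ᵇ n * h) ∧ allBelow h (λ d → (suc d ≤ᵇ n) ⇒ᵇ (E + r ≤ᵇ t d + d * h))) ≡ true →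
             r ≡ 0 ⊎ (2 * E < n * h × (∀ d → d < h → suc d ≤ n → E + r ≤ t d + d * h))
      lows (inj₁ z) = inj₁ (≡ᵇ-sound z)
      lows (inj₂ z) with ∧-true {2 * E <ᵇ n * h} z
      ... | z₁ , z₂ = inj₂ (<ᵇ-sound z₁ , λ d l q →
        ≤ᵇ-sound (⇒ᵇ-sound {suc d ≤ᵇ n} (allBelow-sound h _ z₂ d l) (T⇒≡ (≤⇒≤ᵇ q))))

  Iso : List V → Gr → Set
  Iso xs H = ∃ λ ys → ys ↭ xs × Matches H ys

  -- Complete k n t [] says that e ≥ t.
  Complete : ℕ → ℕ → ℕ → List Gr → Set
  Complete k n t L = ∀ xs → Unique xs → TriFree xs → Alpha≤ k xs → length xs ≡ n → edges xs < t → Any (Iso xs) L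

  Reducible : ℕ → ℕ → ℕ → (ℕ → ℕ) → List Gr → Set
  Reducible k n E t L = ∀ xs v → v ∈ xs → Unique xs → TriFree xs → Alpha≤ (suc k) xs → length xs ≡ n → edges xs ≤ E →
    edges (rest v xs) < t (deg v xs) → Any (Iso xs) L

  edges-range : ∀ {k E u xs} → Unique xs → TriFree xs → Alpha≤ k xs →
                u ≤ suc E ⊎ length xs * k < 2 * suc E → edges xs < u → edges xs ≤ E
  edges-range xs! tf al (inj₁ r) lt = s≤s⁻¹ (≤-trans lt r)
  edges-range xs! tf al (inj₂ r) lt = s≤s⁻¹ (*-cancelˡ-< 2 _ _ (≤-<-trans (2edges≤ xs! tf al) r))

  -- Either every H_v has at least the edges that the multipliers assume, against `lp-bound`, or
  -- some H_v is too sparse and is passed to `Reducible`.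
  step : ∀ {k n E u L} t c → lpCheck c (suc k) n E t ≡ true → u ≤ suc E ⊎ n * suc k < 2 * suc E →
         Reducible k n E t L → Complete (suc k) n u L
  step {k} {n} {E} {u} {L} t c chk range red xs xs! tf al refl lt
    with any? (λ v → edges (rest v xs) <? t (deg v xs)) xs
  ... | yes p = found p (λ i → i)
    where
      found : ∀ {zs} → Any (λ v → edges (rest v xs) < t (deg v xs)) zs → (∀ {z} → z ∈ zs → z ∈ xs) → Any (Iso xs) L
      found (here q) s = red xs _ (s (here refl)) xs! tf al refl (edges-range xs! tf al range lt) q
      found (there p) s = found p (s ∘ there)
  ... | no ¬p = ⊥-elim (lp-bound c (suc k) n E t (lpCheck-sound c (suc k) n E t chk) xs xs! tf al refl (edges-range xs! tf al range lt)
                  (λ v i → ≮⇒≥ (λ q → ¬p (inject i q))))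
    where
      inject : ∀ {zs v} → v ∈ zs → edges (rest v xs) < t (deg v xs) → Any (λ v → edges (rest v xs) < t (deg v xs)) zs
      inject (here refl) q = here q
      inject (there i) q = there (inject i q)

  module Extension {k xs v ys H} (v∈ : v ∈ xs) (xs! : Unique xs) (tf : TriFree xs) (al : Alpha≤ k xs)
    (p : ys ↭ rest v xs) (m : Matches H ys) where

    ys⇒rest : ∀ {x} → x ∈ ys → x ∈ rest v xs
    ys⇒rest = ∈-resp-↭ p

    ys#nbrs : ∀ {x} → x ∈ nbrs v xs → x ∉ ys
    ys#nbrs i j with trans (sym (nbrs-adj v xs i)) (rest-far v xs (ys⇒rest j))
    ... | ()

    open Cones {xs} {ys} {nbrs v xs} {H} {k} al m
      (Unique-↭ (↭-sym p) (AllPairs-filterᵇ (far v) xs!)) (rest-⊆ v xs ∘ ys⇒rest)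
      (AllPairs-filterᵇ (adj v) xs!) (nbrs-⊆ v xs) (nbrs-nonadj v∈ tf) ys#nbrs
      (λ {x} i → cone-indep x m (λ j l a c d →
        tf (nbrs-⊆ v xs i) (rest-⊆ v xs (ys⇒rest j)) (rest-⊆ v xs (ys⇒rest l)) a d c)) public

    edges-total : edges xs ≡ deg v xs + sum (λ x → ones (cone ys x)) (nbrs v xs) + grEdges H
    edges-total = begin
      edges xs ≡⟨ edges-cross v∈ xs! tf ⟩
      deg v xs + cross v xs + edges (rest v xs)
        ≡⟨ cong₂ (λ a c → deg v xs + a + c)
             (sum-cong (nbrs v xs) (λ x _ → trans (sym (sum-↭ _ p)) (sym (cone-ones ys x))))
             (trans (sym (edges-↭ p)) (Matches-edges m)) ⟩
      deg v xs + sum (λ x → ones (cone ys x)) (nbrs v xs) + grEdges H ∎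
      where open ≡-Reasoning

    sizes≤ : ∀ {E} → edges xs ≤ E → sum (λ x → ones (cone ys x)) (nbrs v xs) ≤ E ∸ (deg v xs + grEdges H)
    sizes≤ {E} le = begin
      C ≡⟨ m+n∸m≡n (deg v xs + grEdges H) C ⟨
      deg v xs + grEdges H + C ∸ (deg v xs + grEdges H)
        ≤⟨ ∸-monoˡ-≤ (deg v xs + grEdges H) (≤-trans (≤-reflexive (trans (lem (deg v xs) (grEdges H) C) (sym edges-total))) le) ⟩
      E ∸ (deg v xs + grEdges H) ∎
      where
        open ≤-Reasoning
        C = sum (λ x → ones (cone ys x)) (nbrs v xs)
        lem : ∀ a c d → a + c + d ≡ a + d + c
        lem = solve-∀

    glue-extend : ∀ {E L} → edges xs ≤ E →
      glue (isoLeaf (map mkTarget L) H) k (deg v xs) (E ∸ (deg v xs + grEdges H)) H ≡ true → Any (Iso xs) L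
    glue-extend {E} {L} le e with glue-sound (isoLeaf (map mkTarget L) H) _
      (subst (λ d → glue (isoLeaf (map mkTarget L) H) k d (E ∸ (deg v xs + grEdges H)) H ≡ true) (sym (deg-length v xs)) e)
      (sizes≤ le)
    ... | zs , q , iso = widen (anyIso-sound L
          (Matches-glued zs m (Indep-from-∈ zs (λ i j → nbrs-nonadj v∈ tf (∈-resp-↭ q i) (∈-resp-↭ q j)))
            (λ i → nbrs-adj v xs (∈-resp-↭ q i)) (λ i → rest-far v xs (ys⇒rest i))) iso)
      where
        whole : v ∷ zs ++ ys ↭ xs
        whole = ↭-trans (prep v (++⁺ q p)) (↭-sym (split v∈ xs!))
        widen : ∀ {L} → Any (Iso (v ∷ zs ++ ys)) L → Any (Iso xs) L
        widen (here (f , r , mf)) = here (f , ↭-trans r whole , mf)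
        widen (there a) = there (widen a)

    one-miss : ∀ {J} → IndepRow H J → ones J + 1 ≡ k →
               sum (λ x → b (disjoint (cone ys x) J)) (nbrs v xs) ≤ 1
    one-miss {J} i o = subst (_≤ 1) (length-filterᵇ (λ x → disjoint (cone ys x) J) (nbrs v xs))
      (+-cancelʳ-≤ (ones J) _ 1 (≤-trans
        (few-miss {J} {filterᵇ (λ x → disjoint (cone ys x) J) (nbrs v xs)} i
          (AllPairs-filterᵇ (λ x → disjoint (cone ys x) J) (AllPairs-filterᵇ (adj v) xs!))
          (λ j → proj₁ (∈-filterᵇ⁻ (λ x → disjoint (cone ys x) J) (nbrs v xs) j))
          (λ j → proj₂ (∈-filterᵇ⁻ (λ x → disjoint (cone ys x) J) (nbrs v xs) j)))
        (≤-reflexive (trans (sym o) (+-comm (ones J) 1)))))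

    kill-sound : ∀ {E lam ws} → edges xs ≤ E → 0 < deg v xs →
                 kill k (deg v xs) (E ∸ (deg v xs + grEdges H)) lam ws H ≡ true → ⊥
    kill-sound {E} {lam} {ws} le pos e = <⇒≱ ≤-refl (*-cancelˡ-≤ (deg v xs) {{>-nonZero pos}} (begin
        deg v xs * suc bud ≡⟨ cong (_* suc bud) (deg-length v xs) ⟨
        length N * suc bud ≡⟨ sum-const (suc bud) N ⟨
        sum (λ _ → suc bud) N ≤⟨ sum-mono N (λ x i → allAbove-sound bud (deg v xs) lam H (replicate (length H) false) live 0 e
            (cone-indep x m (λ j l a c d →
              tf (nbrs-⊆ v xs i) (rest-⊆ v xs (ys⇒rest j)) (rest-⊆ v xs (ys⇒rest l)) a d c))
            (none (length H) (cone ys x))) ⟩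
        sum (λ x → deg v xs * (lam * ones (cone ys x) + missWeight live (cone ys x))) N ≡⟨ sum-* (deg v xs) _ N ⟩
        deg v xs * sum (λ x → lam * ones (cone ys x) + missWeight live (cone ys x)) N
          ≤⟨ *-monoʳ-≤ (deg v xs) (begin
               sum (λ x → lam * ones (cone ys x) + missWeight live (cone ys x)) N ≡⟨ sum-+ (λ x → lam * ones (cone ys x)) _ N ⟩
               sum (λ x → lam * ones (cone ys x)) N + sum (λ x → missWeight live (cone ys x)) N
                 ≤⟨ +-mono-≤ (≤-trans (≤-reflexive (sum-* lam _ N)) (*-monoʳ-≤ lam (sizes≤ le))) missTotal ⟩
               lam * tot + sum proj₂ live ≡⟨ +-comm (lam * tot) _ ⟩
               bud ∎) ⟩
        deg v xs * bud ∎))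
      where
        open ≤-Reasoning
        N = nbrs v xs
        live = weigh k H ws
        tot = E ∸ (deg v xs + grEdges H)
        bud = sum proj₂ live + lam * tot
        none : ∀ n S → disjoint (replicate n false) S ≡ true
        none zero S = refl
        none (suc n) [] = refl
        none (suc n) (x ∷ S) = none n S
        each : ∀ Js ws → (∀ {J} → J ∈ Js → IndepRow H J × ones J + 1 ≡ k) →
               sum (λ x → missWeight (zipWeights Js ws) (cone ys x)) N ≤ sum proj₂ (zipWeights Js ws)
        each [] ws h = ≤-reflexive (trans (sum-const 0 N) (*-zeroʳ (length N)))
        each (J ∷ Js) [] h = ≤-reflexive (trans (sum-const 0 N) (*-zeroʳ (length N)))
        each (J ∷ Js) (w ∷ ws) h = begin
          sum (λ x → b (disjoint (cone ys x) J) * w + missWeight (zipWeights Js ws) (cone ys x)) N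
            ≡⟨ sum-+ (λ x → b (disjoint (cone ys x) J) * w) _ N ⟩
          sum (λ x → b (disjoint (cone ys x) J) * w) N + sum (λ x → missWeight (zipWeights Js ws) (cone ys x)) N
            ≤⟨ +-mono-≤ (≤-trans (≤-reflexive (trans (sum-cong N (λ x _ → *-comm (b (disjoint (cone ys x) J)) w)) (sum-* w _ N)))
                 (*-monoʳ-≤ w (one-miss (proj₁ (h (here refl))) (proj₂ (h (here refl)))))) (each Js ws (h ∘ there)) ⟩
          w * 1 + sum proj₂ (zipWeights Js ws) ≡⟨ cong (_+ _) (*-identityʳ w) ⟩
          w + sum proj₂ (zipWeights Js ws) ∎
        missTotal : sum (λ x → missWeight live (cone ys x)) N ≤ sum proj₂ live
        missTotal = each _ ws fam
          where
            fam : ∀ {J} → J ∈ filterᵇ (λ J → ones J + 1 ≡ᵇ k) (indepSets H) → IndepRow H J × ones J + 1 ≡ k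
            fam j with ∈-filterᵇ⁻ (λ J → ones J + 1 ≡ᵇ k) (indepSets H) j
            ... | q , o = indepSets-sound H q , ≡ᵇ-sound o

override : List (ℕ × ℕ) → (ℕ → ℕ) → ℕ → ℕ
override [] t d = t d
override ((c , u) ∷ o) t d = if c ≡ᵇ d then u else override o t d

allDense : ℕ → List Gr → Bool
allDense t [] = true
allDense t (H ∷ Hs) = (t ≤ᵇ grEdges H) ∧ allDense t Hs

-- Records rather than equations, so that comparing two of these types never evaluates a check.
record Glues (k n E d u : ℕ) (Ls L : List Gr) : Set where
  constructor glues
  field checked : allGlue u (map mkTarget L) (suc k) d E Ls ≡ true

record Kills (k n E d u : ℕ) (Ls : List Gr) : Set where
  constructor kills
  field weights : List (ℕ × List ℕ)
        checked : allKill u (suc k) d E weights Ls ≡ true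

module Tables {V : Set} (_≟_ : DecidableEquality V) (adj : V → V → Bool)
  (adj-sym : ∀ u v → adj u v ≡ adj v u) (adj-irr : ∀ v → adj v v ≡ false) where

  open Ambient _≟_ adj adj-sym adj-irr
  open Gluing _≟_ adj adj-sym adj-irr
  open Ramsey _≟_ adj adj-sym adj-irr

  Handler : ℕ → ℕ → ℕ → ℕ → ℕ → List Gr → Set
  Handler k n E d u L = ∀ xs v → v ∈ xs → Unique xs → TriFree xs → Alpha≤ (suc k) xs → length xs ≡ n → edges xs ≤ E →
    deg v xs ≡ d → edges (rest v xs) < u → Any (Iso xs) L

  rest-size : ∀ {xs v n d} → v ∈ xs → Unique xs → length xs ≡ n → deg v xs ≡ d → length (rest v xs) ≡ n ∸ suc d
  rest-size {xs} {v} i xs! refl refl = sym (begin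
    length xs ∸ suc (deg v xs) ≡⟨ cong (_∸ suc (deg v xs)) (rest-length i xs!) ⟨
    suc (deg v xs) + length (rest v xs) ∸ suc (deg v xs) ≡⟨ m+n∸m≡n (suc (deg v xs)) _ ⟩
    length (rest v xs) ∎)
    where open ≡-Reasoning

  from-rest : ∀ {k m u L xs v} → Complete k m u L → v ∈ xs → Unique xs → TriFree xs → Alpha≤ (suc k) xs →
              length (rest v xs) ≡ m → edges (rest v xs) < u → Any (Iso (rest v xs)) L
  from-rest {xs = xs} {v} C i xs! tf al len lt =
    C (rest v xs) (AllPairs-filterᵇ (far v) xs!) (TriFree-⊆ (rest-⊆ v xs) tf) (rest-Alpha≤ i al) len lt

  by-glue : ∀ {k n E d u Ls L} → Glues k n E d u Ls L → Complete k (n ∸ suc d) u Ls → Handler k n E d u L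
  by-glue {k} {n} {E} {d} {u} {Ls} {L} (glues chk) C xs v i xs! tf al len le refl lt =
    go _ chk (from-rest C i xs! tf al (rest-size i xs! len refl) lt)
    where
      go : ∀ Hs → allGlue u (map mkTarget L) (suc k) d E Hs ≡ true → Any (Iso (rest v xs)) Hs → Any (Iso xs) L
      go (H ∷ Hs) e (there a) = go Hs (proj₂ (∧-true e)) a
      go (H ∷ Hs) e (here (ys , p , m)) with ∨-true {u ≤ᵇ grEdges H} (proj₁ (∧-true {(u ≤ᵇ grEdges H) ∨ _} e))
      ... | inj₁ dense = ⊥-elim (<⇒≱ lt (≤-trans (≤ᵇ-sound dense)
              (≤-reflexive (trans (sym (Matches-edges m)) (edges-↭ p)))))
      ... | inj₂ g = Extension.glue-extend i xs! tf al p m le g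

  by-kill : ∀ {k n E d u Ls L} → Kills k n E d u Ls → 0 < d → Complete k (n ∸ suc d) u Ls → Handler k n E d u L
  by-kill {k} {n} {E} {d} {u} {Ls} {L} (kills cs₀ chk) pos C xs v i xs! tf al len le refl lt =
    go cs₀ _ chk (from-rest C i xs! tf al (rest-size i xs! len refl) lt)
    where
      go : ∀ cs Hs → allKill u (suc k) d E cs Hs ≡ true → Any (Iso (rest v xs)) Hs → Any (Iso xs) L
      go ((lam , ws) ∷ cs) (H ∷ Hs) e (there a) = go cs Hs (proj₂ (∧-true {(u ≤ᵇ grEdges H) ∨ _} e)) a
      go ((lam , ws) ∷ cs) (H ∷ Hs) e (here (ys , p , m))
        with ∨-true {u ≤ᵇ grEdges H} (proj₁ (∧-true {(u ≤ᵇ grEdges H) ∨ _} e))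
      ... | inj₁ dense = ⊥-elim (<⇒≱ lt (≤-trans (≤ᵇ-sound dense)
              (≤-reflexive (trans (sym (Matches-edges m)) (edges-↭ p)))))
      ... | inj₂ g = ⊥-elim (Extension.kill-sound i xs! tf al p m le pos g)

  Level : ℕ → List ℕ → Set
  Level k vals = ∀ m → Complete k m (at vals m) []

  Handlers : ℕ → ℕ → ℕ → List Gr → List (ℕ × ℕ) → Set
  Handlers k n E L = All (λ { (d , u) → Handler k n E d u L })

  -- An override raises the bound assumed for e(H_v) at one degree above the table value; the price
  -- is a `Handler` for the explicit graphs H_v below it.
  thresholds : List ℕ → ℕ → List (ℕ × ℕ) → ℕ → ℕ
  thresholds prev n o = override o (λ d → at prev (n ∸ suc d))

  reducible : ∀ {k n E L} prev o → Level k prev → Handlers k n E L o → Reducible k n E (thresholds prev n o) L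
  reducible prev [] lev [] xs v i xs! tf al len le lt
    with from-rest (lev _) i xs! tf al (rest-size i xs! len refl) lt
  ... | ()
  reducible prev ((d , u) ∷ o) lev (h ∷ hs) xs v i xs! tf al len le lt with d ≡ᵇ deg v xs in eq
  ... | true = h xs v i xs! tf al len le (sym (≡ᵇ-sound eq)) lt
  ... | false = reducible prev o lev hs xs v i xs! tf al len le lt

  catalogue : ∀ {k} prev n E o c {L} → Level k prev → Handlers k n E L o →
              lpCheck c (suc k) n E (thresholds prev n o) ≡ true → Complete (suc k) n (suc E) L
  catalogue prev n E o c lev hs chk = step (thresholds prev n o) c chk (inj₁ ≤-refl) (reducible prev o lev hs)

  Given : ℕ → ℕ → Cert → Set
  Given k n (given u) = Complete k n u []
  Given k n _ = ⊤

  Givens : ℕ → ℕ → List Cert → Set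
  Givens k n [] = ⊤
  Givens k n (c ∷ cs) = Given k n c × Givens k (suc n) cs

  by-cert : ∀ {k} prev n c → Level k prev → certCheck k n prev c ≡ true → Given (suc k) n c → Complete (suc k) n (value c) []
  by-cert prev n trivial lev e g xs xs! tf al len ()
  by-cert prev n (given u) lev e g = g
  by-cert {k} prev n (byLP E u c) lev e g with ∧-true {lpCheck c (suc k) n E (thresholds prev n [])} e
  ... | e₁ , e₂ = step (thresholds prev n []) c e₁ (range (∨-true {u ≤ᵇ suc E} e₂)) (reducible prev [] lev [])
    where
      range : (u ≤ᵇ suc E) ≡ true ⊎ (n * suc k <ᵇ 2 * suc E) ≡ true → u ≤ suc E ⊎ n * suc k < 2 * suc E
      range (inj₁ r) = inj₁ (≤ᵇ-sound r)
      range (inj₂ r) = inj₂ (<ᵇ-sound r)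

  -- Deleting a vertex increases neither the number of edges nor the independence number. This
  -- justifies repeating the last entry of a table.
  monotone : ∀ {k n u} → Complete k n u [] → Complete k (suc n) u []
  monotone C (x ∷ xs) (_ ∷ xs!) tf al len lt
    with C xs xs! (TriFree-⊆ there tf) (Alpha≤-⊆ there al) (suc-injective len) (≤-<-trans (m≤n+m _ (deg x xs)) lt)
  ... | ()

  from-certs : ∀ {k} prev n cs → Level k prev → certsCheck k n prev cs ≡ true → Givens (suc k) n cs →
               ∀ m → Complete (suc k) (m + n) (at (map value cs) m) []
  from-certs prev n [] lev e g m xs xs! tf al len ()
  from-certs prev n (c ∷ []) lev e (g , _) zero = by-cert prev n c lev (proj₁ (∧-true e)) g
  from-certs prev n (c ∷ []) lev e g (suc m) = monotone (from-certs prev n (c ∷ []) lev e g m)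
  from-certs prev n (c ∷ c′ ∷ cs) lev e (g , _) zero = by-cert prev n c lev (proj₁ (∧-true e)) g
  from-certs {k} prev n (c ∷ c′ ∷ cs) lev e (_ , g) (suc m) =
    subst (λ i → Complete (suc k) i (at (map value (c′ ∷ cs)) m) []) (+-suc m n)
      (from-certs prev (suc n) (c′ ∷ cs) lev (proj₂ (∧-true {certCheck k n prev c} e)) g m)

  level : ∀ {k} prev cs → Level k prev → certsCheck k 0 prev cs ≡ true → Givens (suc k) 0 cs → Level (suc k) (map value cs)
  level {k} prev cs lev e g m = subst (λ i → Complete (suc k) i (at (map value cs) m) []) (+-identityʳ m) (from-certs prev 0 cs lev e g m)

  level₀ : ∀ u → Level 0 (0 ∷ u ∷ [])
  level₀ u zero xs xs! tf al len ()
  level₀ u (suc m) (x ∷ xs) xs! tf al len lt with al (x ∷ []) ([] ∷ []) (λ { (here e) → here e }) ([] ∷ [])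
  ... | ()

  dense : ∀ {k n u u′ L} → Complete k n u L → u′ ≤ u → allDense u′ L ≡ true → Complete k n u′ []
  dense {u′ = u′} C le chk xs xs! tf al len lt = ⊥-elim (go _ chk (C xs xs! tf al len (≤-trans lt le)))
    where
      go : ∀ L → allDense u′ L ≡ true → ¬ Any (Iso xs) L
      go (H ∷ L) e (here (ys , p , m)) = <⇒≱ lt (≤-trans (≤ᵇ-sound (proj₁ (∧-true {u′ ≤ᵇ grEdges H} e)))
        (≤-reflexive (trans (sym (Matches-edges m)) (edges-↭ p))))
      go (H ∷ L) e (there a) = go L (proj₂ (∧-true {u′ ≤ᵇ grEdges H} e)) a

-- The explicit graphs and the certificates

bits : ℕ → ℕ → Row
bits zero m = []
bits (suc n) m = (m % 2 ≡ᵇ 1) ∷ bits n (m / 2)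

fromCodes : List ℕ → Gr
fromCodes [] = []
fromCodes (m ∷ ms) = bits (len ms) m ∷ fromCodes ms
  where len : List ℕ → ℕ
        len [] = 0
        len (_ ∷ xs) = suc (len xs)

-- All triangle-free graphs, by number n of vertices, with α ≤ k and at most e edges, found by computer:
-- (n , k , e) = (2,1,1), (4,2,2), (7,3,6), (10,4,11), (11,4,15), (14,5,20), (15,5,26), (19,6,37).
graphs2 : List Gr
graphs2 = map fromCodes
  ( (1 ∷ 0 ∷ [])
  ∷ [])

graphs4 : List Gr
graphs4 = map fromCodes
  ( (1 ∷ 0 ∷ 1 ∷ 0 ∷ [])
  ∷ [])

-- The disjoint union of a 5-cycle and an edge.
graphs7 : List Gr
graphs7 = map fromCodes
  ( (3 ∷ 2 ∷ 2 ∷ 1 ∷ 0 ∷ 1 ∷ 0 ∷ [])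
  ∷ [])

-- Two disjoint 5-cycles; a graph with 8 vertices and 10 edges together with a disjoint edge; two
-- 5-cycles joined by an edge.
graphs10 : List Gr
graphs10 = map fromCodes
  ( (3 ∷ 2 ∷ 2 ∷ 1 ∷ 0 ∷ 3 ∷ 2 ∷ 2 ∷ 1 ∷ 0 ∷ [])
  ∷ (3 ∷ 2 ∷ 6 ∷ 3 ∷ 2 ∷ 2 ∷ 1 ∷ 0 ∷ 1 ∷ 0 ∷ [])
  ∷ (129 ∷ 1 ∷ 1 ∷ 16 ∷ 17 ∷ 1 ∷ 1 ∷ 2 ∷ 1 ∷ 0 ∷ [])
  ∷ [])

graphs11 : List Gr
graphs11 = map fromCodes
  ( (9 ∷ 8 ∷ 17 ∷ 32 ∷ 34 ∷ 17 ∷ 2 ∷ 5 ∷ 1 ∷ 1 ∷ 0 ∷ [])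
  ∷ [])

graphs14 : List Gr
graphs14 = map fromCodes
  ( (65 ∷ 64 ∷ 3 ∷ 2 ∷ 258 ∷ 129 ∷ 8 ∷ 10 ∷ 5 ∷ 9 ∷ 2 ∷ 1 ∷ 1 ∷ 0 ∷ [])
  ∷ [])

graphs15 : List Gr
graphs15 = map fromCodes
  ( (1027 ∷ 258 ∷ 514 ∷ 514 ∷ 34 ∷ 40 ∷ 129 ∷ 17 ∷ 17 ∷ 16 ∷ 3 ∷ 2 ∷ 2 ∷ 1 ∷ 0 ∷ [])
  ∷ (133 ∷ 9 ∷ 18 ∷ 69 ∷ 9 ∷ 33 ∷ 5 ∷ 8 ∷ 9 ∷ 9 ∷ 3 ∷ 2 ∷ 2 ∷ 1 ∷ 0 ∷ [])
  ∷ (137 ∷ 257 ∷ 5 ∷ 9 ∷ 33 ∷ 33 ∷ 5 ∷ 8 ∷ 13 ∷ 9 ∷ 3 ∷ 2 ∷ 2 ∷ 1 ∷ 0 ∷ [])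
  ∷ (3 ∷ 4 ∷ 2053 ∷ 193 ∷ 513 ∷ 9 ∷ 9 ∷ 17 ∷ 17 ∷ 5 ∷ 8 ∷ 3 ∷ 2 ∷ 1 ∷ 0 ∷ [])
  ∷ (73 ∷ 9 ∷ 65 ∷ 17 ∷ 17 ∷ 129 ∷ 17 ∷ 33 ∷ 34 ∷ 17 ∷ 2 ∷ 5 ∷ 1 ∷ 1 ∷ 0 ∷ [])
  ∷ (1033 ∷ 2064 ∷ 529 ∷ 18 ∷ 5 ∷ 257 ∷ 17 ∷ 1 ∷ 33 ∷ 5 ∷ 5 ∷ 4 ∷ 2 ∷ 1 ∷ 0 ∷ [])
  ∷ (69 ∷ 17 ∷ 34 ∷ 1027 ∷ 20 ∷ 33 ∷ 129 ∷ 1 ∷ 10 ∷ 5 ∷ 9 ∷ 2 ∷ 1 ∷ 1 ∷ 0 ∷ [])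
  ∷ (19 ∷ 20 ∷ 265 ∷ 17 ∷ 65 ∷ 258 ∷ 129 ∷ 2 ∷ 10 ∷ 9 ∷ 9 ∷ 1 ∷ 1 ∷ 1 ∷ 0 ∷ [])
  ∷ [])

graphs19 : List Gr
graphs19 = map fromCodes
  ( (147 ∷ 134 ∷ 137 ∷ 136 ∷ 259 ∷ 66 ∷ 34 ∷ 34 ∷ 68 ∷ 65 ∷ 17 ∷ 16 ∷ 18 ∷ 9 ∷ 3 ∷ 4 ∷ 2 ∷ 1 ∷ 0 ∷ [])
  ∷ (8197 ∷ 32777 ∷ 32778 ∷ 8209 ∷ 17 ∷ 6 ∷ 257 ∷ 1026 ∷ 6 ∷ 3 ∷ 2 ∷ 18 ∷ 9 ∷ 9 ∷ 9 ∷ 3 ∷ 2 ∷ 1 ∷ 0 ∷ [])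
  ∷ (521 ∷ 1153 ∷ 1057 ∷ 130 ∷ 10 ∷ 10 ∷ 273 ∷ 516 ∷ 11 ∷ 10 ∷ 17 ∷ 32 ∷ 34 ∷ 17 ∷ 2 ∷ 5 ∷ 1 ∷ 1 ∷ 0 ∷ [])
  ∷ (16389 ∷ 1025 ∷ 8256 ∷ 641 ∷ 641 ∷ 4097 ∷ 65 ∷ 513 ∷ 514 ∷ 50 ∷ 41 ∷ 33 ∷ 5 ∷ 17 ∷ 4 ∷ 1 ∷ 1 ∷ 1 ∷ 0 ∷ [])
  ∷ (273 ∷ 65 ∷ 1281 ∷ 289 ∷ 34 ∷ 4099 ∷ 18 ∷ 261 ∷ 513 ∷ 10 ∷ 129 ∷ 1 ∷ 6 ∷ 3 ∷ 4 ∷ 5 ∷ 1 ∷ 1 ∷ 0 ∷ [])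
  ∷ (259 ∷ 546 ∷ 770 ∷ 259 ∷ 260 ∷ 5 ∷ 21 ∷ 17 ∷ 66 ∷ 33 ∷ 65 ∷ 8 ∷ 34 ∷ 17 ∷ 2 ∷ 5 ∷ 1 ∷ 1 ∷ 0 ∷ [])
  ∷ (525 ∷ 545 ∷ 545 ∷ 2080 ∷ 137 ∷ 33 ∷ 9 ∷ 130 ∷ 18 ∷ 130 ∷ 3 ∷ 8 ∷ 34 ∷ 17 ∷ 2 ∷ 5 ∷ 1 ∷ 1 ∷ 0 ∷ [])
  ∷ (4101 ∷ 9 ∷ 2082 ∷ 18433 ∷ 257 ∷ 10 ∷ 1033 ∷ 9 ∷ 129 ∷ 17 ∷ 33 ∷ 65 ∷ 20 ∷ 5 ∷ 9 ∷ 1 ∷ 2 ∷ 1 ∷ 0 ∷ [])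
  ∷ (19 ∷ 130 ∷ 32786 ∷ 16401 ∷ 17 ∷ 513 ∷ 2065 ∷ 129 ∷ 258 ∷ 129 ∷ 130 ∷ 18 ∷ 10 ∷ 3 ∷ 4 ∷ 5 ∷ 1 ∷ 1 ∷ 0 ∷ [])
  ∷ (25 ∷ 65 ∷ 257 ∷ 18433 ∷ 72 ∷ 4105 ∷ 35 ∷ 260 ∷ 513 ∷ 33 ∷ 130 ∷ 36 ∷ 17 ∷ 5 ∷ 9 ∷ 2 ∷ 1 ∷ 1 ∷ 0 ∷ [])
  ∷ (35 ∷ 16394 ∷ 8706 ∷ 41 ∷ 65 ∷ 68 ∷ 2057 ∷ 257 ∷ 5 ∷ 257 ∷ 40 ∷ 10 ∷ 5 ∷ 17 ∷ 4 ∷ 2 ∷ 2 ∷ 1 ∷ 0 ∷ [])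
  ∷ [])

-- For each graph of graphs19, a dual solution found by multiplicative weights: lam, and the weights of the
-- independent 6-sets in the order of indepSets.
weights19 : List (ℕ × List ℕ)
weights19 =
    (65 , 3 ∷ 3 ∷ 3 ∷ 3 ∷ 5 ∷ 3 ∷ 3 ∷ 3 ∷ 3 ∷ 5 ∷ 6 ∷ 9 ∷ 7 ∷ 11 ∷ 5 ∷ 5 ∷ 5 ∷ 10 ∷ 6 ∷ 11 ∷ 6 ∷ 9 ∷ 9 ∷ 6 ∷
      4 ∷ 6 ∷ 6 ∷ 7 ∷ 5 ∷ 3 ∷ 5 ∷ 3 ∷ 6 ∷ 11 ∷ 4 ∷ 5 ∷ 5 ∷ 16 ∷ 5 ∷ 11 ∷ 5 ∷ 6 ∷ 9 ∷ 7 ∷ 11 ∷ 5 ∷ 6 ∷ 5 ∷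
      15 ∷ 5 ∷ 11 ∷ 5 ∷ 11 ∷ 5 ∷ 6 ∷ 5 ∷ 11 ∷ 6 ∷ 11 ∷ 6 ∷ 9 ∷ 9 ∷ 6 ∷ 4 ∷ 6 ∷ 7 ∷ 7 ∷ 5 ∷ 3 ∷ 5 ∷ 3 ∷ 6 ∷
      9 ∷ 9 ∷ 3 ∷ 5 ∷ 3 ∷ 5 ∷ 6 ∷ 7 ∷ 5 ∷ 11 ∷ 5 ∷ 6 ∷ 11 ∷ 6 ∷ 6 ∷ 6 ∷ 4 ∷ 6 ∷ 7 ∷ 6 ∷ 9 ∷ 5 ∷ 5 ∷ 4 ∷ 11 ∷
      16 ∷ 5 ∷ 5 ∷ 5 ∷ 11 ∷ 10 ∷ 20 ∷ 14 ∷ 11 ∷ 6 ∷ 11 ∷ 5 ∷ 11 ∷ 4 ∷ 5 ∷ 4 ∷ 10 ∷ 9 ∷ 3 ∷ 3 ∷ 3 ∷ 3 ∷ 7 ∷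
      14 ∷ 11 ∷ 5 ∷ 4 ∷ 4 ∷ 5 ∷ 6 ∷ 10 ∷ 4 ∷ 6 ∷ 4 ∷ 9 ∷ 9 ∷ 9 ∷ 3 ∷ 5 ∷ 3 ∷ 5 ∷ 6 ∷ 7 ∷ 6 ∷ 11 ∷ 6 ∷ 5 ∷
      11 ∷ 5 ∷ 7 ∷ 6 ∷ 4 ∷ 6 ∷ 7 ∷ 6 ∷ 9 ∷ 5 ∷ 6 ∷ 5 ∷ 11 ∷ 11 ∷ 5 ∷ 6 ∷ 5 ∷ 11 ∷ 15 ∷ 20 ∷ 14 ∷ 11 ∷ 5 ∷
      12 ∷ 6 ∷ 11 ∷ 4 ∷ 6 ∷ 4 ∷ 10 ∷ 9 ∷ 3 ∷ 3 ∷ 3 ∷ 3 ∷ 7 ∷ 15 ∷ 11 ∷ 5 ∷ 4 ∷ 4 ∷ 5 ∷ 6 ∷ 10 ∷ 4 ∷ 5 ∷ 4 ∷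
      9 ∷ [])
  ∷ (73 , 9 ∷ 6 ∷ 6 ∷ 6 ∷ 7 ∷ 15 ∷ 6 ∷ 4 ∷ 7 ∷ 8 ∷ 7 ∷ 6 ∷ 6 ∷ 6 ∷ 7 ∷ 9 ∷ 6 ∷ 4 ∷ 7 ∷ 8 ∷ 7 ∷ 7 ∷ 5 ∷ 5 ∷
      5 ∷ 5 ∷ 5 ∷ 5 ∷ 5 ∷ 9 ∷ 7 ∷ 7 ∷ 5 ∷ 5 ∷ 20 ∷ 19 ∷ 6 ∷ 6 ∷ 7 ∷ 20 ∷ 15 ∷ 4 ∷ 6 ∷ 6 ∷ 6 ∷ 7 ∷ 13 ∷ 13 ∷
      7 ∷ 10 ∷ 9 ∷ 9 ∷ 7 ∷ 5 ∷ 5 ∷ 6 ∷ 8 ∷ 7 ∷ 7 ∷ 6 ∷ 14 ∷ 14 ∷ 14 ∷ 12 ∷ 12 ∷ 20 ∷ 19 ∷ 9 ∷ 7 ∷ 7 ∷ 6 ∷ 6 ∷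
      4 ∷ 5 ∷ 6 ∷ 6 ∷ 7 ∷ 5 ∷ 5 ∷ 7 ∷ 8 ∷ 5 ∷ 5 ∷ 7 ∷ 14 ∷ 14 ∷ 14 ∷ 12 ∷ 12 ∷ 6 ∷ 6 ∷ 6 ∷ 6 ∷ 6 ∷ 7 ∷ 6 ∷
      9 ∷ 7 ∷ 7 ∷ 6 ∷ 6 ∷ 6 ∷ 6 ∷ 7 ∷ 20 ∷ 16 ∷ 13 ∷ 13 ∷ 9 ∷ 10 ∷ 7 ∷ 7 ∷ 9 ∷ 5 ∷ 5 ∷ 4 ∷ 4 ∷ 4 ∷ 5 ∷ 4 ∷
      9 ∷ 7 ∷ 7 ∷ 5 ∷ 5 ∷ 9 ∷ 6 ∷ 5 ∷ 5 ∷ 4 ∷ 4 ∷ 4 ∷ 6 ∷ 6 ∷ 6 ∷ 9 ∷ 6 ∷ 4 ∷ 4 ∷ 5 ∷ 5 ∷ 5 ∷ 5 ∷ 5 ∷ 5 ∷ 5 ∷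
      4 ∷ 4 ∷ 4 ∷ 6 ∷ 6 ∷ 6 ∷ 15 ∷ 6 ∷ 5 ∷ 5 ∷ 5 ∷ 5 ∷ 5 ∷ 5 ∷ 5 ∷ 7 ∷ 7 ∷ 9 ∷ 5 ∷ 5 ∷ 4 ∷ 4 ∷ 5 ∷ 5 ∷ 5 ∷
      5 ∷ 5 ∷ 5 ∷ 6 ∷ 4 ∷ 4 ∷ 4 ∷ 7 ∷ 7 ∷ 9 ∷ 6 ∷ 6 ∷ 5 ∷ 5 ∷ 4 ∷ 4 ∷ 4 ∷ 5 ∷ 4 ∷ 7 ∷ 7 ∷ 9 ∷ 5 ∷ 5 ∷ 6 ∷ 6 ∷
      6 ∷ 6 ∷ 6 ∷ 6 ∷ 6 ∷ 7 ∷ 7 ∷ 9 ∷ 6 ∷ 6 ∷ [])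
  ∷ (99 , 12 ∷ 12 ∷ 12 ∷ 11 ∷ 6 ∷ 6 ∷ 6 ∷ 6 ∷ 6 ∷ 15 ∷ 12 ∷ 12 ∷ 9 ∷ 9 ∷ 16 ∷ 12 ∷ 6 ∷ 8 ∷ 6 ∷ 6 ∷ 8 ∷ 6 ∷
      6 ∷ 6 ∷ 11 ∷ 6 ∷ 6 ∷ 8 ∷ 6 ∷ 6 ∷ 6 ∷ 6 ∷ 10 ∷ 20 ∷ 19 ∷ 20 ∷ 16 ∷ 20 ∷ 12 ∷ 11 ∷ 11 ∷ 16 ∷ 12 ∷ 12 ∷
      16 ∷ 9 ∷ 12 ∷ 12 ∷ 16 ∷ 9 ∷ 7 ∷ 7 ∷ 7 ∷ 7 ∷ 14 ∷ 7 ∷ 7 ∷ 7 ∷ 7 ∷ 14 ∷ 6 ∷ 10 ∷ 6 ∷ 6 ∷ 6 ∷ 6 ∷ 10 ∷ 6 ∷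
      6 ∷ 6 ∷ 11 ∷ 6 ∷ 20 ∷ 19 ∷ 20 ∷ 20 ∷ 16 ∷ 12 ∷ 15 ∷ 9 ∷ 12 ∷ 12 ∷ 9 ∷ 16 ∷ 7 ∷ 7 ∷ 7 ∷ 13 ∷ 7 ∷ 7 ∷ 7 ∷
      7 ∷ 13 ∷ 7 ∷ 12 ∷ 11 ∷ 11 ∷ 12 ∷ 15 ∷ 6 ∷ 10 ∷ 6 ∷ 6 ∷ 6 ∷ 6 ∷ 10 ∷ 6 ∷ 6 ∷ 6 ∷ 10 ∷ 6 ∷ 13 ∷ 11 ∷ 11 ∷
      12 ∷ 13 ∷ 11 ∷ 16 ∷ 7 ∷ 7 ∷ 7 ∷ 13 ∷ 7 ∷ 7 ∷ 7 ∷ 7 ∷ 13 ∷ 7 ∷ 6 ∷ 8 ∷ 6 ∷ 6 ∷ 6 ∷ 10 ∷ 6 ∷ 6 ∷ 6 ∷ 6 ∷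
      6 ∷ 9 ∷ 12 ∷ 15 ∷ 12 ∷ 9 ∷ 9 ∷ 12 ∷ 17 ∷ 6 ∷ 6 ∷ 8 ∷ 6 ∷ 8 ∷ 6 ∷ 6 ∷ 6 ∷ 6 ∷ 11 ∷ 8 ∷ 6 ∷ 6 ∷ 6 ∷ 6 ∷
      10 ∷ 6 ∷ 5 ∷ 6 ∷ 6 ∷ 6 ∷ 6 ∷ 6 ∷ 10 ∷ 6 ∷ 6 ∷ 6 ∷ 6 ∷ 10 ∷ 6 ∷ 6 ∷ 6 ∷ 6 ∷ 10 ∷ 9 ∷ 6 ∷ 6 ∷ 6 ∷ 6 ∷
      10 ∷ 6 ∷ 6 ∷ 6 ∷ 6 ∷ 10 ∷ 6 ∷ 13 ∷ 12 ∷ 7 ∷ 7 ∷ 7 ∷ 7 ∷ 13 ∷ 7 ∷ 7 ∷ 7 ∷ 7 ∷ 13 ∷ 11 ∷ 12 ∷ 13 ∷ 15 ∷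
      11 ∷ 6 ∷ 8 ∷ 6 ∷ 6 ∷ 6 ∷ 6 ∷ 10 ∷ 6 ∷ 6 ∷ 6 ∷ 9 ∷ 6 ∷ [])
  ∷ (121 , 15 ∷ 15 ∷ 20 ∷ 15 ∷ 18 ∷ 10 ∷ 12 ∷ 17 ∷ 15 ∷ 12 ∷ 15 ∷ 16 ∷ 12 ∷ 11 ∷ 19 ∷ 14 ∷ 10 ∷ 16 ∷ 17 ∷
      15 ∷ 16 ∷ 10 ∷ 10 ∷ 10 ∷ 15 ∷ 17 ∷ 8 ∷ 15 ∷ 12 ∷ 11 ∷ 9 ∷ 10 ∷ 8 ∷ 8 ∷ 16 ∷ 10 ∷ 10 ∷ 9 ∷ 8 ∷ 9 ∷ 9 ∷
      9 ∷ 9 ∷ 8 ∷ 8 ∷ 8 ∷ 10 ∷ 8 ∷ 10 ∷ 8 ∷ 8 ∷ 8 ∷ 8 ∷ 11 ∷ 11 ∷ 7 ∷ 7 ∷ 7 ∷ 7 ∷ 9 ∷ 9 ∷ 6 ∷ 6 ∷ 17 ∷ 16 ∷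
      14 ∷ 15 ∷ 15 ∷ 15 ∷ 16 ∷ 14 ∷ 11 ∷ 10 ∷ 11 ∷ 10 ∷ 11 ∷ 10 ∷ 10 ∷ 13 ∷ 13 ∷ 15 ∷ 14 ∷ 9 ∷ 14 ∷ 9 ∷ 16 ∷
      17 ∷ 13 ∷ 12 ∷ 12 ∷ 12 ∷ 12 ∷ 10 ∷ 9 ∷ 11 ∷ 10 ∷ 9 ∷ 9 ∷ 10 ∷ 12 ∷ 10 ∷ 10 ∷ 15 ∷ 15 ∷ 10 ∷ 10 ∷ 14 ∷
      10 ∷ 10 ∷ 9 ∷ 9 ∷ 9 ∷ 9 ∷ 8 ∷ 9 ∷ 11 ∷ 12 ∷ 12 ∷ 11 ∷ 9 ∷ 12 ∷ 9 ∷ 11 ∷ 14 ∷ 7 ∷ 9 ∷ 14 ∷ 9 ∷ 10 ∷ 11 ∷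
      10 ∷ 11 ∷ 9 ∷ 8 ∷ 8 ∷ 8 ∷ 7 ∷ 7 ∷ 9 ∷ 9 ∷ 6 ∷ 9 ∷ 6 ∷ 12 ∷ 12 ∷ 9 ∷ 16 ∷ 12 ∷ 12 ∷ 9 ∷ 8 ∷ 9 ∷ 13 ∷
      13 ∷ 11 ∷ 8 ∷ 8 ∷ 8 ∷ 9 ∷ 9 ∷ 9 ∷ 7 ∷ 7 ∷ 7 ∷ 7 ∷ 11 ∷ 11 ∷ 12 ∷ 8 ∷ 8 ∷ 8 ∷ 8 ∷ 17 ∷ 14 ∷ 14 ∷ 11 ∷
      13 ∷ 14 ∷ 9 ∷ 9 ∷ 10 ∷ 10 ∷ 15 ∷ 9 ∷ 8 ∷ 8 ∷ 10 ∷ 10 ∷ 8 ∷ 14 ∷ 14 ∷ 15 ∷ 14 ∷ 13 ∷ 10 ∷ 13 ∷ 13 ∷ 13 ∷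
      12 ∷ 12 ∷ 12 ∷ 9 ∷ 9 ∷ 9 ∷ 9 ∷ 9 ∷ 13 ∷ 13 ∷ 15 ∷ 7 ∷ 7 ∷ 12 ∷ 11 ∷ 10 ∷ 9 ∷ 9 ∷ 7 ∷ 7 ∷ 14 ∷ 8 ∷ 8 ∷
      8 ∷ 7 ∷ [])
  ∷ (59 , 13 ∷ 10 ∷ 7 ∷ 7 ∷ 7 ∷ 7 ∷ 9 ∷ 7 ∷ 7 ∷ 10 ∷ 10 ∷ 10 ∷ 11 ∷ 9 ∷ 6 ∷ 7 ∷ 7 ∷ 6 ∷ 7 ∷ 8 ∷ 6 ∷ 7 ∷ 7 ∷
      7 ∷ 7 ∷ 6 ∷ 8 ∷ 7 ∷ 7 ∷ 13 ∷ 6 ∷ 5 ∷ 5 ∷ 5 ∷ 5 ∷ 5 ∷ 5 ∷ 5 ∷ 5 ∷ 5 ∷ 5 ∷ 6 ∷ 6 ∷ 7 ∷ 6 ∷ 6 ∷ 20 ∷ 6 ∷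
      6 ∷ 5 ∷ 7 ∷ 6 ∷ 6 ∷ 6 ∷ 5 ∷ 7 ∷ 6 ∷ 6 ∷ 4 ∷ 4 ∷ 4 ∷ 5 ∷ 5 ∷ 4 ∷ 5 ∷ 5 ∷ 4 ∷ 5 ∷ 8 ∷ 5 ∷ 5 ∷ 3 ∷ 3 ∷ 9 ∷
      5 ∷ 6 ∷ 5 ∷ 6 ∷ 6 ∷ 7 ∷ 6 ∷ 6 ∷ 3 ∷ 3 ∷ 3 ∷ 3 ∷ 3 ∷ 7 ∷ 3 ∷ 3 ∷ 3 ∷ 3 ∷ 7 ∷ 3 ∷ 3 ∷ 3 ∷ 3 ∷ 7 ∷ 3 ∷ 3 ∷
      3 ∷ 3 ∷ 3 ∷ 3 ∷ 3 ∷ 3 ∷ 3 ∷ 3 ∷ 3 ∷ 3 ∷ 3 ∷ 6 ∷ 5 ∷ 6 ∷ 4 ∷ 4 ∷ 14 ∷ 6 ∷ 5 ∷ 4 ∷ 4 ∷ 5 ∷ 5 ∷ 4 ∷ 4 ∷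
      5 ∷ 3 ∷ 3 ∷ 8 ∷ 5 ∷ 7 ∷ 6 ∷ 7 ∷ 7 ∷ 5 ∷ 4 ∷ 5 ∷ 5 ∷ 4 ∷ 4 ∷ 7 ∷ 4 ∷ 3 ∷ 5 ∷ 3 ∷ 6 ∷ 5 ∷ 3 ∷ 3 ∷ 4 ∷ 3 ∷
      3 ∷ 3 ∷ 3 ∷ 4 ∷ 3 ∷ 4 ∷ 6 ∷ 3 ∷ 3 ∷ 3 ∷ 3 ∷ 7 ∷ 3 ∷ 6 ∷ 5 ∷ 6 ∷ 6 ∷ 6 ∷ 6 ∷ 5 ∷ 5 ∷ 5 ∷ 5 ∷ 5 ∷ 4 ∷ 6 ∷
      5 ∷ 4 ∷ 13 ∷ 6 ∷ 6 ∷ 5 ∷ 5 ∷ 5 ∷ 5 ∷ 5 ∷ 4 ∷ 5 ∷ 5 ∷ 4 ∷ 11 ∷ 5 ∷ 7 ∷ 7 ∷ 6 ∷ 7 ∷ 5 ∷ 6 ∷ 4 ∷ 5 ∷ 5 ∷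
      5 ∷ 5 ∷ 4 ∷ 6 ∷ 5 ∷ 4 ∷ 9 ∷ 5 ∷ 3 ∷ 3 ∷ 3 ∷ 3 ∷ 4 ∷ 3 ∷ 3 ∷ 3 ∷ 3 ∷ 3 ∷ 6 ∷ 3 ∷ [])
  ∷ (104 , 9 ∷ 13 ∷ 8 ∷ 9 ∷ 11 ∷ 12 ∷ 10 ∷ 8 ∷ 9 ∷ 10 ∷ 13 ∷ 11 ∷ 15 ∷ 14 ∷ 10 ∷ 12 ∷ 10 ∷ 14 ∷ 10 ∷ 11 ∷
      11 ∷ 12 ∷ 9 ∷ 11 ∷ 18 ∷ 17 ∷ 18 ∷ 10 ∷ 18 ∷ 7 ∷ 6 ∷ 8 ∷ 7 ∷ 8 ∷ 8 ∷ 12 ∷ 8 ∷ 8 ∷ 7 ∷ 6 ∷ 7 ∷ 10 ∷ 10 ∷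
      9 ∷ 8 ∷ 9 ∷ 13 ∷ 9 ∷ 13 ∷ 10 ∷ 14 ∷ 11 ∷ 14 ∷ 12 ∷ 11 ∷ 11 ∷ 8 ∷ 12 ∷ 11 ∷ 9 ∷ 11 ∷ 9 ∷ 11 ∷ 9 ∷ 12 ∷
      12 ∷ 12 ∷ 11 ∷ 8 ∷ 13 ∷ 9 ∷ 10 ∷ 8 ∷ 9 ∷ 11 ∷ 8 ∷ 10 ∷ 7 ∷ 8 ∷ 14 ∷ 7 ∷ 8 ∷ 8 ∷ 11 ∷ 9 ∷ 12 ∷ 11 ∷ 8 ∷
      11 ∷ 10 ∷ 10 ∷ 10 ∷ 10 ∷ 23 ∷ 8 ∷ 10 ∷ 8 ∷ 10 ∷ 11 ∷ 8 ∷ 11 ∷ 9 ∷ 10 ∷ 10 ∷ 9 ∷ 30 ∷ 9 ∷ 10 ∷ 8 ∷ 11 ∷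
      9 ∷ 12 ∷ 13 ∷ 12 ∷ 8 ∷ 10 ∷ 10 ∷ 8 ∷ 11 ∷ 8 ∷ 10 ∷ 8 ∷ 10 ∷ 10 ∷ 10 ∷ 9 ∷ 7 ∷ 9 ∷ 7 ∷ 6 ∷ 8 ∷ 7 ∷ 8 ∷
      7 ∷ 11 ∷ 8 ∷ 8 ∷ 7 ∷ 6 ∷ 7 ∷ 6 ∷ 7 ∷ 7 ∷ 8 ∷ 12 ∷ 6 ∷ 7 ∷ 4 ∷ 4 ∷ 6 ∷ 6 ∷ 7 ∷ 6 ∷ 4 ∷ 6 ∷ 7 ∷ 6 ∷ 4 ∷
      6 ∷ 6 ∷ 6 ∷ 6 ∷ 6 ∷ 7 ∷ 8 ∷ 8 ∷ 8 ∷ 12 ∷ 8 ∷ 8 ∷ 14 ∷ 10 ∷ 9 ∷ 9 ∷ 10 ∷ 30 ∷ 8 ∷ 8 ∷ 7 ∷ 11 ∷ 8 ∷ 6 ∷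
      7 ∷ 6 ∷ 7 ∷ 6 ∷ 7 ∷ 6 ∷ 6 ∷ 6 ∷ 6 ∷ 6 ∷ 15 ∷ 8 ∷ 8 ∷ 7 ∷ 6 ∷ 7 ∷ 9 ∷ 8 ∷ 12 ∷ 10 ∷ 9 ∷ 8 ∷ 10 ∷ 12 ∷
      10 ∷ 10 ∷ 10 ∷ 15 ∷ 8 ∷ 7 ∷ 10 ∷ 9 ∷ 9 ∷ 8 ∷ 12 ∷ 8 ∷ 8 ∷ 7 ∷ 6 ∷ 7 ∷ [])
  ∷ (90 , 12 ∷ 12 ∷ 9 ∷ 10 ∷ 10 ∷ 15 ∷ 13 ∷ 5 ∷ 7 ∷ 6 ∷ 7 ∷ 6 ∷ 8 ∷ 8 ∷ 6 ∷ 7 ∷ 8 ∷ 8 ∷ 8 ∷ 6 ∷ 7 ∷ 6 ∷ 7 ∷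
      6 ∷ 9 ∷ 8 ∷ 9 ∷ 9 ∷ 10 ∷ 7 ∷ 10 ∷ 9 ∷ 9 ∷ 10 ∷ 7 ∷ 10 ∷ 7 ∷ 8 ∷ 8 ∷ 5 ∷ 7 ∷ 7 ∷ 5 ∷ 7 ∷ 6 ∷ 8 ∷ 6 ∷ 9 ∷
      8 ∷ 7 ∷ 7 ∷ 5 ∷ 9 ∷ 12 ∷ 12 ∷ 11 ∷ 9 ∷ 13 ∷ 10 ∷ 15 ∷ 9 ∷ 9 ∷ 9 ∷ 7 ∷ 10 ∷ 9 ∷ 9 ∷ 9 ∷ 7 ∷ 10 ∷ 7 ∷ 6 ∷
      8 ∷ 7 ∷ 7 ∷ 6 ∷ 7 ∷ 8 ∷ 6 ∷ 8 ∷ 6 ∷ 9 ∷ 6 ∷ 7 ∷ 8 ∷ 7 ∷ 10 ∷ 6 ∷ 7 ∷ 7 ∷ 7 ∷ 19 ∷ 5 ∷ 8 ∷ 5 ∷ 7 ∷ 7 ∷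
      8 ∷ 7 ∷ 7 ∷ 7 ∷ 7 ∷ 8 ∷ 11 ∷ 8 ∷ 7 ∷ 7 ∷ 8 ∷ 20 ∷ 13 ∷ 9 ∷ 16 ∷ 12 ∷ 13 ∷ 13 ∷ 14 ∷ 7 ∷ 6 ∷ 9 ∷ 7 ∷ 7 ∷
      7 ∷ 8 ∷ 4 ∷ 6 ∷ 6 ∷ 7 ∷ 6 ∷ 8 ∷ 8 ∷ 4 ∷ 6 ∷ 6 ∷ 7 ∷ 6 ∷ 4 ∷ 6 ∷ 5 ∷ 7 ∷ 6 ∷ 8 ∷ 7 ∷ 13 ∷ 15 ∷ 11 ∷ 6 ∷
      14 ∷ 6 ∷ 7 ∷ 6 ∷ 4 ∷ 6 ∷ 9 ∷ 13 ∷ 12 ∷ 16 ∷ 13 ∷ 14 ∷ 13 ∷ 5 ∷ 5 ∷ 8 ∷ 8 ∷ 11 ∷ 7 ∷ 7 ∷ 7 ∷ 8 ∷ 7 ∷ 7 ∷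
      7 ∷ 7 ∷ 8 ∷ 8 ∷ 7 ∷ 20 ∷ 6 ∷ 6 ∷ 10 ∷ 7 ∷ 8 ∷ 7 ∷ 6 ∷ 7 ∷ 7 ∷ 19 ∷ 6 ∷ 7 ∷ 7 ∷ 9 ∷ 7 ∷ 8 ∷ 7 ∷ 14 ∷
      13 ∷ 15 ∷ 6 ∷ 11 ∷ 5 ∷ 4 ∷ 7 ∷ 6 ∷ 5 ∷ 4 ∷ 6 ∷ 7 ∷ 5 ∷ 7 ∷ 6 ∷ 8 ∷ 6 ∷ 4 ∷ 7 ∷ 6 ∷ 8 ∷ 6 ∷ 9 ∷ 7 ∷ 6 ∷
      6 ∷ 4 ∷ 6 ∷ [])
  ∷ (76 , 8 ∷ 8 ∷ 5 ∷ 6 ∷ 8 ∷ 9 ∷ 8 ∷ 20 ∷ 6 ∷ 5 ∷ 18 ∷ 7 ∷ 16 ∷ 6 ∷ 14 ∷ 10 ∷ 8 ∷ 6 ∷ 7 ∷ 7 ∷ 6 ∷ 7 ∷ 7 ∷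
      9 ∷ 8 ∷ 6 ∷ 8 ∷ 6 ∷ 8 ∷ 6 ∷ 9 ∷ 7 ∷ 6 ∷ 9 ∷ 5 ∷ 8 ∷ 5 ∷ 7 ∷ 4 ∷ 11 ∷ 9 ∷ 15 ∷ 7 ∷ 12 ∷ 6 ∷ 5 ∷ 4 ∷ 6 ∷
      5 ∷ 14 ∷ 5 ∷ 10 ∷ 9 ∷ 9 ∷ 5 ∷ 8 ∷ 5 ∷ 6 ∷ 6 ∷ 7 ∷ 5 ∷ 5 ∷ 9 ∷ 7 ∷ 6 ∷ 9 ∷ 6 ∷ 6 ∷ 5 ∷ 6 ∷ 5 ∷ 5 ∷ 7 ∷
      5 ∷ 8 ∷ 5 ∷ 6 ∷ 6 ∷ 6 ∷ 7 ∷ 5 ∷ 6 ∷ 5 ∷ 5 ∷ 9 ∷ 10 ∷ 9 ∷ 7 ∷ 9 ∷ 6 ∷ 6 ∷ 6 ∷ 9 ∷ 6 ∷ 6 ∷ 6 ∷ 8 ∷ 9 ∷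
      5 ∷ 6 ∷ 6 ∷ 8 ∷ 5 ∷ 5 ∷ 7 ∷ 5 ∷ 5 ∷ 6 ∷ 8 ∷ 5 ∷ 7 ∷ 6 ∷ 7 ∷ 6 ∷ 6 ∷ 5 ∷ 5 ∷ 9 ∷ 10 ∷ 9 ∷ 9 ∷ 6 ∷ 6 ∷
      6 ∷ 7 ∷ 6 ∷ 6 ∷ 8 ∷ 9 ∷ 6 ∷ 6 ∷ 8 ∷ 9 ∷ 5 ∷ 7 ∷ 6 ∷ 9 ∷ 11 ∷ 5 ∷ 5 ∷ 6 ∷ 4 ∷ 11 ∷ 7 ∷ 7 ∷ 8 ∷ 9 ∷ 6 ∷
      5 ∷ 5 ∷ 5 ∷ 6 ∷ 9 ∷ 5 ∷ 4 ∷ 5 ∷ 5 ∷ 6 ∷ 4 ∷ 7 ∷ 5 ∷ 5 ∷ 18 ∷ 15 ∷ 11 ∷ 8 ∷ 15 ∷ 7 ∷ 7 ∷ 6 ∷ 8 ∷ 4 ∷ 6 ∷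
      6 ∷ 8 ∷ 9 ∷ 6 ∷ 5 ∷ 5 ∷ 7 ∷ 6 ∷ 6 ∷ 5 ∷ 5 ∷ 5 ∷ 6 ∷ 5 ∷ 4 ∷ 11 ∷ 8 ∷ 15 ∷ 11 ∷ 8 ∷ 4 ∷ 10 ∷ 10 ∷ 6 ∷
      5 ∷ 5 ∷ 7 ∷ 6 ∷ 12 ∷ 9 ∷ 11 ∷ 8 ∷ 15 ∷ 8 ∷ 8 ∷ 8 ∷ 9 ∷ 7 ∷ [])
  ∷ (114 , 16 ∷ 13 ∷ 16 ∷ 20 ∷ 12 ∷ 13 ∷ 16 ∷ 19 ∷ 15 ∷ 12 ∷ 11 ∷ 10 ∷ 16 ∷ 12 ∷ 10 ∷ 14 ∷ 10 ∷ 11 ∷ 11 ∷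
      11 ∷ 12 ∷ 8 ∷ 11 ∷ 10 ∷ 9 ∷ 11 ∷ 16 ∷ 15 ∷ 10 ∷ 11 ∷ 11 ∷ 12 ∷ 11 ∷ 8 ∷ 10 ∷ 12 ∷ 10 ∷ 13 ∷ 8 ∷ 12 ∷
      10 ∷ 16 ∷ 9 ∷ 9 ∷ 9 ∷ 9 ∷ 9 ∷ 10 ∷ 16 ∷ 10 ∷ 8 ∷ 12 ∷ 8 ∷ 16 ∷ 10 ∷ 9 ∷ 10 ∷ 8 ∷ 13 ∷ 13 ∷ 10 ∷ 11 ∷
      7 ∷ 11 ∷ 12 ∷ 10 ∷ 11 ∷ 8 ∷ 10 ∷ 10 ∷ 8 ∷ 8 ∷ 11 ∷ 8 ∷ 8 ∷ 9 ∷ 8 ∷ 7 ∷ 10 ∷ 6 ∷ 9 ∷ 16 ∷ 9 ∷ 11 ∷ 14 ∷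
      10 ∷ 11 ∷ 11 ∷ 8 ∷ 8 ∷ 10 ∷ 11 ∷ 9 ∷ 9 ∷ 11 ∷ 8 ∷ 8 ∷ 9 ∷ 8 ∷ 7 ∷ 10 ∷ 6 ∷ 12 ∷ 8 ∷ 16 ∷ 8 ∷ 8 ∷ 10 ∷
      10 ∷ 7 ∷ 9 ∷ 10 ∷ 9 ∷ 6 ∷ 9 ∷ 14 ∷ 8 ∷ 10 ∷ 8 ∷ 12 ∷ 8 ∷ 15 ∷ 8 ∷ 8 ∷ 9 ∷ 9 ∷ 7 ∷ 9 ∷ 10 ∷ 9 ∷ 6 ∷ 13 ∷
      9 ∷ 16 ∷ 15 ∷ 12 ∷ 14 ∷ 8 ∷ 10 ∷ 12 ∷ 10 ∷ 10 ∷ 8 ∷ 10 ∷ 10 ∷ 11 ∷ 8 ∷ 8 ∷ 8 ∷ 8 ∷ 12 ∷ 11 ∷ 11 ∷ 9 ∷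
      8 ∷ 7 ∷ 8 ∷ 9 ∷ 10 ∷ 6 ∷ 9 ∷ 13 ∷ 9 ∷ 11 ∷ 10 ∷ 11 ∷ 9 ∷ 9 ∷ 8 ∷ 8 ∷ 15 ∷ 12 ∷ 11 ∷ 11 ∷ 10 ∷ 8 ∷ 8 ∷
      10 ∷ 9 ∷ 7 ∷ 9 ∷ 6 ∷ 15 ∷ 9 ∷ 16 ∷ 10 ∷ 10 ∷ 9 ∷ 9 ∷ 7 ∷ 8 ∷ 9 ∷ 10 ∷ 6 ∷ 9 ∷ 13 ∷ 9 ∷ 13 ∷ 9 ∷ 10 ∷
      8 ∷ 10 ∷ 9 ∷ 7 ∷ 9 ∷ 6 ∷ 12 ∷ 10 ∷ 10 ∷ 9 ∷ 8 ∷ 14 ∷ 8 ∷ 15 ∷ 9 ∷ 9 ∷ 8 ∷ 8 ∷ 12 ∷ 15 ∷ 17 ∷ 14 ∷ 8 ∷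
      [])
  ∷ (117 , 16 ∷ 17 ∷ 19 ∷ 14 ∷ 15 ∷ 16 ∷ 17 ∷ 13 ∷ 10 ∷ 9 ∷ 12 ∷ 9 ∷ 12 ∷ 15 ∷ 12 ∷ 14 ∷ 20 ∷ 8 ∷ 10 ∷ 8 ∷
      12 ∷ 7 ∷ 7 ∷ 7 ∷ 8 ∷ 10 ∷ 8 ∷ 8 ∷ 8 ∷ 14 ∷ 10 ∷ 7 ∷ 12 ∷ 15 ∷ 9 ∷ 9 ∷ 9 ∷ 15 ∷ 9 ∷ 13 ∷ 13 ∷ 12 ∷ 20 ∷
      14 ∷ 10 ∷ 10 ∷ 10 ∷ 15 ∷ 7 ∷ 9 ∷ 9 ∷ 8 ∷ 10 ∷ 8 ∷ 12 ∷ 7 ∷ 7 ∷ 7 ∷ 8 ∷ 10 ∷ 8 ∷ 8 ∷ 8 ∷ 11 ∷ 11 ∷ 10 ∷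
      11 ∷ 10 ∷ 13 ∷ 11 ∷ 12 ∷ 11 ∷ 11 ∷ 11 ∷ 10 ∷ 8 ∷ 8 ∷ 9 ∷ 7 ∷ 7 ∷ 11 ∷ 11 ∷ 8 ∷ 10 ∷ 11 ∷ 8 ∷ 10 ∷ 10 ∷
      14 ∷ 8 ∷ 11 ∷ 12 ∷ 11 ∷ 17 ∷ 14 ∷ 12 ∷ 11 ∷ 11 ∷ 16 ∷ 8 ∷ 10 ∷ 10 ∷ 8 ∷ 14 ∷ 8 ∷ 17 ∷ 10 ∷ 12 ∷ 9 ∷
      10 ∷ 17 ∷ 7 ∷ 7 ∷ 10 ∷ 8 ∷ 11 ∷ 8 ∷ 9 ∷ 8 ∷ 9 ∷ 12 ∷ 13 ∷ 11 ∷ 10 ∷ 17 ∷ 10 ∷ 17 ∷ 8 ∷ 10 ∷ 11 ∷ 10 ∷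
      10 ∷ 14 ∷ 10 ∷ 7 ∷ 8 ∷ 11 ∷ 8 ∷ 7 ∷ 11 ∷ 7 ∷ 11 ∷ 14 ∷ 10 ∷ 12 ∷ 10 ∷ 10 ∷ 13 ∷ 9 ∷ 9 ∷ 11 ∷ 13 ∷ 9 ∷
      9 ∷ 10 ∷ 13 ∷ 10 ∷ 12 ∷ 12 ∷ 13 ∷ 9 ∷ 11 ∷ 12 ∷ 12 ∷ 10 ∷ 8 ∷ 8 ∷ 10 ∷ 8 ∷ 7 ∷ 10 ∷ 7 ∷ 8 ∷ 10 ∷ 8 ∷
      10 ∷ 8 ∷ 8 ∷ 10 ∷ 10 ∷ 8 ∷ 8 ∷ 10 ∷ 8 ∷ 19 ∷ 9 ∷ 13 ∷ 11 ∷ 11 ∷ 10 ∷ 10 ∷ 7 ∷ 10 ∷ 16 ∷ 9 ∷ 15 ∷ 11 ∷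
      10 ∷ 10 ∷ 8 ∷ 9 ∷ 8 ∷ 9 ∷ 9 ∷ 13 ∷ 8 ∷ 10 ∷ 15 ∷ 8 ∷ 9 ∷ 10 ∷ 10 ∷ 11 ∷ 9 ∷ 14 ∷ 11 ∷ 9 ∷ 9 ∷ 10 ∷ 15 ∷
      7 ∷ 9 ∷ 9 ∷ [])
  ∷ (65 , 9 ∷ 7 ∷ 6 ∷ 6 ∷ 7 ∷ 7 ∷ 7 ∷ 7 ∷ 6 ∷ 7 ∷ 6 ∷ 6 ∷ 5 ∷ 4 ∷ 5 ∷ 7 ∷ 6 ∷ 18 ∷ 19 ∷ 8 ∷ 8 ∷ 7 ∷ 18 ∷ 17 ∷
      5 ∷ 4 ∷ 5 ∷ 7 ∷ 8 ∷ 7 ∷ 7 ∷ 5 ∷ 5 ∷ 5 ∷ 9 ∷ 6 ∷ 5 ∷ 4 ∷ 6 ∷ 5 ∷ 5 ∷ 5 ∷ 6 ∷ 5 ∷ 7 ∷ 6 ∷ 9 ∷ 9 ∷ 11 ∷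
      8 ∷ 8 ∷ 11 ∷ 7 ∷ 5 ∷ 9 ∷ 5 ∷ 5 ∷ 5 ∷ 20 ∷ 10 ∷ 4 ∷ 5 ∷ 4 ∷ 10 ∷ 9 ∷ 10 ∷ 11 ∷ 9 ∷ 4 ∷ 4 ∷ 9 ∷ 7 ∷ 5 ∷
      9 ∷ 5 ∷ 5 ∷ 5 ∷ 19 ∷ 10 ∷ 7 ∷ 6 ∷ 4 ∷ 6 ∷ 4 ∷ 8 ∷ 6 ∷ 5 ∷ 5 ∷ 6 ∷ 4 ∷ 4 ∷ 6 ∷ 6 ∷ 7 ∷ 6 ∷ 5 ∷ 5 ∷ 5 ∷
      5 ∷ 11 ∷ 9 ∷ 9 ∷ 8 ∷ 11 ∷ 7 ∷ 6 ∷ 10 ∷ 4 ∷ 6 ∷ 4 ∷ 14 ∷ 9 ∷ 4 ∷ 4 ∷ 5 ∷ 4 ∷ 5 ∷ 6 ∷ 9 ∷ 6 ∷ 11 ∷ 7 ∷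
      9 ∷ 11 ∷ 7 ∷ 4 ∷ 3 ∷ 4 ∷ 8 ∷ 5 ∷ 4 ∷ 3 ∷ 5 ∷ 5 ∷ 6 ∷ 4 ∷ 3 ∷ 6 ∷ 4 ∷ 5 ∷ 6 ∷ 5 ∷ 8 ∷ 5 ∷ 5 ∷ 5 ∷ 6 ∷
      4 ∷ 3 ∷ 5 ∷ 5 ∷ 6 ∷ 4 ∷ 6 ∷ 3 ∷ 3 ∷ 4 ∷ 4 ∷ 4 ∷ 4 ∷ 4 ∷ 4 ∷ 4 ∷ 4 ∷ 9 ∷ 4 ∷ 6 ∷ 7 ∷ 5 ∷ 6 ∷ 5 ∷ 16 ∷
      5 ∷ 5 ∷ 5 ∷ 6 ∷ 4 ∷ 6 ∷ 5 ∷ 4 ∷ 4 ∷ 9 ∷ 5 ∷ 3 ∷ 3 ∷ 4 ∷ 4 ∷ 4 ∷ 4 ∷ 4 ∷ 4 ∷ 4 ∷ 4 ∷ 9 ∷ 4 ∷ 6 ∷ 6 ∷ 6 ∷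
      6 ∷ 5 ∷ 4 ∷ 4 ∷ 5 ∷ 6 ∷ 5 ∷ 9 ∷ 5 ∷ [])
  ∷ []

trivials : ℕ → List Cert → List Cert
trivials zero cs = cs
trivials (suc n) cs = trivial ∷ trivials n cs

-- The multipliers were found by computer search; the value 1000 exceeds every number of edges that occurs.
certs1 : List Cert
certs1 = trivials 2 (
    byLP 0 1 (lp 1 0 1 0 0 0) ∷
    byLP 1 1000 (lp 1 0 1000 0 0 0) ∷
    [])

certs2 : List Cert
certs2 = trivials 3 (
    byLP 0 1 (lp 1 0 1 0 0 0) ∷
    byLP 1 2 (lp 1 0 2 0 0 0) ∷
    byLP 4 5 (lp 1 0 5 0 0 0) ∷
    byLP 6 1000 (lp 1 0 1000 0 0 0) ∷
    [])

certs3 : List Cert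
certs3 = trivials 4 (
    byLP 0 1 (lp 1 0 1 0 0 0) ∷
    byLP 1 2 (lp 1 0 2 0 0 0) ∷
    byLP 2 3 (lp 1 0 3 0 0 0) ∷
    byLP 5 6 (lp 1 0 6 0 0 0) ∷
    byLP 9 10 (lp 1 1 7 0 0 0) ∷
    byLP 13 1000 (lp 1 0 14 0 0 0) ∷
    [])

certs4 : List Cert
certs4 = trivials 5 (
    byLP 0 1 (lp 1 0 1 0 0 0) ∷
    byLP 1 2 (lp 1 0 2 0 0 0) ∷
    byLP 2 3 (lp 1 0 3 0 0 0) ∷
    byLP 3 4 (lp 1 0 4 0 0 0) ∷
    byLP 6 7 (lp 1 0 7 0 0 0) ∷
    byLP 9 10 (lp 1 0 10 0 0 0) ∷
    byLP 14 15 (lp 1 1 12 0 0 0) ∷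
    byLP 19 20 (lp 1 1 16 0 0 0) ∷
    byLP 25 26 (lp 1 0 26 0 0 0) ∷
    byLP 28 1000 (lp 1 0 1000 0 0 0) ∷
    [])

certs5 : List Cert
certs5 = trivials 6 (
    byLP 0 1 (lp 1 0 1 0 0 0) ∷
    byLP 1 2 (lp 1 0 2 0 0 0) ∷
    byLP 2 3 (lp 1 0 3 0 0 0) ∷
    byLP 3 4 (lp 1 0 4 0 0 0) ∷
    byLP 4 5 (lp 1 0 5 0 0 0) ∷
    byLP 7 8 (lp 1 0 8 0 0 0) ∷
    byLP 10 11 (lp 1 0 11 0 0 0) ∷
    byLP 14 15 (lp 1 1 12 0 0 0) ∷
    byLP 18 19 (lp 1 0 19 0 0 0) ∷
    byLP 24 25 (lp 1 1 21 0 0 0) ∷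
    byLP 30 31 (lp 1 2 23 0 0 0) ∷
    byLP 37 38 (lp 1 3 24 0 0 0) ∷
    byLP 44 45 (lp 1 3 30 0 0 0) ∷
    byLP 47 1000 (lp 1 0 51 0 0 0) ∷
    [])

-- An entry for n vertices and α ≤ k refers to the orders n - k - 1, ..., n - 1 of the previous
-- table. The last table starts at 43 with k = 9, so the tables for 8, 7 and 6 may start at 43 - 10
-- = 33, 33 - 9 = 24 and 24 - 8 = 16.
certs6 : List Cert
certs6 = trivials 16 (
    byLP 19 20 (lp 1 1 17 0 0 0) ∷
    byLP 23 24 (lp 1 1 21 0 0 0) ∷
    byLP 28 29 (lp 1 1 25 0 0 0) ∷
    given 37 ∷
    given 44 ∷
    byLP 48 49 (lp 1 2 39 0 0 0) ∷
    byLP 56 57 (lp 1 2 46 0 0 0) ∷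
    byLP 65 66 (lp 1 4 43 0 0 0) ∷
    byLP 72 1000 (lp 1 3 55 0 0 0) ∷
    [])

certs7 : List Cert
certs7 = trivials 24 (
    byLP 53 54 (lp 1 1 49 0 0 0) ∷
    byLP 62 63 (lp 1 3 47 1 5 2) ∷
    given 72 ∷
    byLP 79 80 (lp 1 6 44 0 0 0) ∷
    byLP 86 87 (lp 1 8 37 0 0 0) ∷
    byLP 96 97 (lp 1 5 63 0 0 0) ∷
    byLP 105 1000 (lp 1 4 78 0 0 0) ∷
    [])

certs8 : List Cert
certs8 = trivials 33 (
    byLP 110 111 (lp 1 4 84 0 0 0) ∷
    byLP 122 123 (lp 1 6 79 0 0 0) ∷
    byLP 133 134 (lp 1 7 80 0 0 0) ∷
    byLP 143 144 (lp 1 8 80 0 0 0) ∷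
    byLP 148 1000 (lp 1 3 125 0 0 0) ∷
    [])

-- Degrees are at most 9 and 43 · 9 = 387 is odd, so there are at most 193 edges and some vertex has
-- degree below 9. The local inequalities are tight at degrees 8 and 9, and so is the deficiency
-- condition at degree 8: 193 + 2 = 123 + 8 · 9. The slope is 3 · 43 - 2 · 64 = 1, and the
-- contradiction is 193 < 49 · 4 = 196.
certs9 : List Cert
certs9 = trivials 43 (
    byLP 193 1000 (lp 3 64 0 49 9 2) ∷
    [])

glue2 : Glues 0 2 1 1 1 ([] ∷ []) graphs2
glue2 = glues refl

glue4 : Glues 1 4 2 1 2 graphs2 graphs4
glue4 = glues refl

glue7 : Glues 2 7 6 2 3 graphs4 graphs7
glue7 = glues refl

glue10 : Glues 3 10 11 2 7 graphs7 graphs10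
glue10 = glues refl

glue11 : Glues 3 11 15 3 7 graphs7 graphs11
glue11 = glues refl

glue14-2 : Glues 4 14 20 2 16 graphs11 graphs14
glue14-2 = glues refl

glue14-3 : Glues 4 14 20 3 11 graphs10 graphs14
glue14-3 = glues refl

glue15-3 : Glues 4 15 26 3 16 graphs11 graphs15
glue15-3 = glues refl

glue15-4 : Glues 4 15 26 4 12 graphs10 graphs15
glue15-4 = glues refl

-- If v has degree 6 and H_v has 37 edges, then 71 - 6 - 37 = 28 edges are left between the six
-- neighbours and H_v. Excluding this raises the threshold at degree 6 from the table value 37 to
-- 38.
kill26 : Kills 6 26 71 6 38 graphs19
kill26 = kills weights19 refl

glue19-3 : Glues 5 19 37 3 27 graphs15 graphs19
glue19-3 = glues refl

glue19-4 : Glues 5 19 37 4 21 graphs14 graphs19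
glue19-4 = glues refl

glue20-4 : Glues 5 20 43 4 26 graphs15 []
glue20-4 = glues refl

glue20-5 : Glues 5 20 43 5 21 graphs14 []
glue20-5 = glues refl

-- The tables for independence number at most 0, ..., 9

module Chain {V : Set} (_≟_ : DecidableEquality V) (adj : V → V → Bool)
  (adj-sym : ∀ u v → adj u v ≡ adj v u) (adj-irr : ∀ v → adj v v ≡ false) where

  open Ambient _≟_ adj adj-sym adj-irr
  open Gluing _≟_ adj adj-sym adj-irr
  open Ramsey _≟_ adj adj-sym adj-irr
  open Tables _≟_ adj adj-sym adj-irr

  vals : List Cert → List ℕ
  vals = map value

  lev0 : Level 0 (0 ∷ 1000 ∷ [])
  lev0 = level₀ 1000

  lev1 : Level 1 (vals certs1)
  lev1 = level (0 ∷ 1000 ∷ []) certs1 lev0 refl _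

  lev2 : Level 2 (vals certs2)
  lev2 = level (vals certs1) certs2 lev1 refl _

  lev3 : Level 3 (vals certs3)
  lev3 = level (vals certs2) certs3 lev2 refl _

  lev4 : Level 4 (vals certs4)
  lev4 = level (vals certs3) certs4 lev3 refl _

  lev5 : Level 5 (vals certs5)
  lev5 = level (vals certs4) certs5 lev4 refl _

  complete0 : Complete 0 0 1 ([] ∷ [])
  complete0 [] _ _ _ _ _ = here ([] , ↭-refl , [])

  complete2 : Complete 1 2 2 graphs2
  complete2 = catalogue (0 ∷ 1000 ∷ []) 2 1 ((1 , 1) ∷ []) (lp 1 0 2 0 0 0) lev0 (by-glue glue2 complete0 ∷ []) refl

  complete4 : Complete 2 4 3 graphs4
  complete4 = catalogue (vals certs1) 4 2 ((1 , 2) ∷ []) (lp 1 0 3 0 0 0) lev1 (by-glue glue4 complete2 ∷ []) refl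

  complete7 : Complete 3 7 7 graphs7
  complete7 = catalogue (vals certs2) 7 6 ((2 , 3) ∷ []) (lp 1 1 5 0 0 0) lev2 (by-glue glue7 complete4 ∷ []) refl

  complete10 : Complete 4 10 12 graphs10
  complete10 = catalogue (vals certs3) 10 11 ((2 , 7) ∷ []) (lp 1 1 9 0 0 0) lev3 (by-glue glue10 complete7 ∷ []) refl

  complete11 : Complete 4 11 16 graphs11
  complete11 = catalogue (vals certs3) 11 15 ((3 , 7) ∷ []) (lp 1 2 10 0 0 0) lev3 (by-glue glue11 complete7 ∷ []) refl

  weaken : ∀ {k n u u′ L} → u′ ≤ u → Complete k n u L → Complete k n u′ L
  weaken le C xs xs! tf al len lt = C xs xs! tf al len (≤-trans lt le)

  complete14 : Complete 5 14 21 graphs14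
  complete14 = catalogue (vals certs4) 14 20 ((2 , 16) ∷ (3 , 11) ∷ []) (lp 1 1 17 1 3 2) lev4
    (by-glue glue14-2 complete11 ∷ by-glue glue14-3 (weaken (n≤1+n 11) complete10) ∷ []) refl

  complete15 : Complete 5 15 27 graphs15
  complete15 = catalogue (vals certs4) 15 26 ((3 , 16) ∷ (4 , 12) ∷ []) (lp 1 3 16 0 0 0) lev4
    (by-glue glue15-3 complete11 ∷ by-glue glue15-4 complete10 ∷ []) refl

  complete19 : Complete 6 19 38 graphs19
  complete19 = catalogue (vals certs5) 19 37 ((3 , 27) ∷ (4 , 21) ∷ []) (lp 1 3 25 2 4 2) lev5
    (by-glue glue19-3 complete15 ∷ by-glue glue19-4 complete14 ∷ []) refl

  -- The list of targets is empty: no graph of the two catalogues below the thresholds 26 and 21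
  -- extends to 20 vertices and at most 43 edges.
  dense20 : Complete 6 20 44 []
  dense20 = catalogue (vals certs5) 20 43 ((4 , 26) ∷ (5 , 21) ∷ []) (lp 1 4 26 0 0 0) lev5
    (by-glue glue20-4 (weaken (n≤1+n 26) complete15) ∷ by-glue glue20-5 complete14 ∷ []) refl

  lev6 : Level 6 (vals certs6)
  lev6 = level (vals certs5) certs6 lev5 refl (_ , _ , _ , _ , _ , _ , _ , _ , _ , _ , _ , _ , _ , _ , _ , _ , _ , _ , _ ,
    dense complete19 (n≤1+n 37) refl , dense20 , _)

  dense26 : Complete 7 26 72 []
  dense26 = catalogue (vals certs6) 26 71 ((6 , 38) ∷ []) (lp 2 9 93 0 0 0) lev6
    (by-kill kill26 (s≤s z≤n) complete19 ∷ []) refl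

  lev7 : Level 7 (vals certs7)
  lev7 = level (vals certs6) certs7 lev6 refl (_ , _ , _ , _ , _ , _ , _ , _ , _ , _ , _ , _ , _ , _ , _ , _ , _ , _ , _ , _ ,
    _ , _ , _ , _ , _ , _ , dense26 , _)

  lev8 : Level 8 (vals certs8)
  lev8 = level (vals certs7) certs8 lev7 refl _

  lev9 : Level 9 (vals certs9)
  lev9 = level (vals certs8) certs9 lev8 refl _

-- Matchings and Gallai's exchange argument

-- The inequalities to be proved are decidable, hence stable. This permits classical choices in
-- their proofs: minimum matchings, maximum independent sets, a removable vertex, the class of a
-- vertex.
≤-stable : ∀ {m n} → ¬ ¬ (m ≤ n) → m ≤ n
≤-stable {m} {n} = decidable-stable (m ≤? n)

module Matchings {V : Set} (_≟_ : DecidableEquality V) (adj : V → V → Bool)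
  (adj-sym : ∀ u v → adj u v ≡ adj v u) (adj-irr : ∀ v → adj v v ≡ false) where

  open Ambient _≟_ adj adj-sym adj-irr

  is : V → V → ℕ
  is u x = b (does (x ≟ u))

  is-refl : ∀ u → is u u ≡ 1
  is-refl u with u ≟ u
  ... | yes _ = refl
  ... | no q = ⊥-elim (q refl)

  is-≢ : ∀ {u x} → x ≢ u → is u x ≡ 0
  is-≢ {u} {x} q with x ≟ u
  ... | yes p = ⊥-elim (q p)
  ... | no _ = refl

  sum-is : ∀ {u xs} → u ∈ xs → Unique xs → sum (is u) xs ≡ 1
  sum-is {u} {x ∷ xs} (here refl) (a ∷ _) = cong₂ _+_ (is-refl u)
    (trans (sum-cong xs (λ y i → is-≢ (λ e → All.lookup a i (sym e)))) (trans (sum-const 0 xs) (*-zeroʳ (length xs))))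
  sum-is {u} {x ∷ xs} (there i) (a ∷ xs!) = cong₂ _+_ (is-≢ (All.lookup a i)) (sum-is i xs!)

  -- A matching is an involution all of whose 2-cycles are edges; the unmatched vertices are its fixed points.
  record Matching (xs : List V) (σ : V → V) : Set where
    field
      closed : ∀ {x} → x ∈ xs → σ x ∈ xs
      invol : ∀ {x} → x ∈ xs → σ (σ x) ≡ x
      edge : ∀ {x} → x ∈ xs → σ x ≢ x → adj x (σ x) ≡ true

  fixes : (V → V) → List V → ℕ
  fixes σ xs = sum (λ x → is x (σ x)) xs

  Cover : List V → List (List V) → Set
  Cover xs css = concat css ↭ xs × All (AllPairs (λ x y → adj x y ≡ true)) css

  id-matching : ∀ xs → Matching xs id
  id-matching xs = record { closed = id ; invol = λ _ → refl ; edge = λ _ n → ⊥-elim (n refl) }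

  fixes-id : ∀ xs → fixes id xs ≡ length xs
  fixes-id xs = trans (sum-cong xs (λ x _ → is-refl x)) (trans (sum-const 1 xs) (*-identityʳ _))

  fixes≤length : ∀ σ xs → fixes σ xs ≤ length xs
  fixes≤length σ xs = ≤-trans (sum-mono xs (λ x _ → b≤1 _)) (≤-reflexive (trans (sum-const 1 xs) (*-identityʳ _)))

  Matching-↭ : ∀ {xs ys σ} → xs ↭ ys → Matching xs σ → Matching ys σ
  Matching-↭ p M = record
    { closed = λ i → ∈-resp-↭ p (closed (∈-resp-↭ (↭-sym p) i))
    ; invol = λ i → invol (∈-resp-↭ (↭-sym p) i)
    ; edge = λ i → edge (∈-resp-↭ (↭-sym p) i) }
    where open Matching M

  drop-fixed : ∀ {x xs σ} → Unique (x ∷ xs) → σ x ≡ x → Matching (x ∷ xs) σ → Matching xs σ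
  drop-fixed {x} {xs} {σ} (a ∷ _) fx M = record
    { closed = λ {y} i → cl i (closed (there i)) ; invol = invol ∘ there ; edge = edge ∘ there }
    where
      open Matching M
      cl : ∀ {y} → y ∈ xs → σ y ∈ x ∷ xs → σ y ∈ xs
      cl i (there j) = j
      cl {y} i (here e) = ⊥-elim (All.lookup a i (begin
        x ≡⟨ fx ⟨
        σ x ≡⟨ cong σ e ⟨
        σ (σ y) ≡⟨ invol (there i) ⟩
        y ∎))
        where open ≡-Reasoning

  drop-pair : ∀ {x xs σ} → Unique (x ∷ σ x ∷ xs) → Matching (x ∷ σ x ∷ xs) σ → Matching xs σ
  drop-pair {x} {xs} {σ} ((_ ∷ a) ∷ (a′ ∷ _)) M = record
    { closed = λ {y} i → cl i (closed (there (there i))) ; invol = invol ∘ there ∘ there ; edge = edge ∘ there ∘ there }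
    where
      open Matching M
      cl : ∀ {y} → y ∈ xs → σ y ∈ x ∷ σ x ∷ xs → σ y ∈ xs
      cl i (there (there j)) = j
      cl {y} i (here e) = ⊥-elim (All.lookup a′ i (trans (cong σ (sym e)) (invol (there (there i)))))
      cl {y} i (there (here e)) = ⊥-elim (All.lookup a i
        (trans (sym (invol (here refl))) (trans (cong σ (sym e)) (invol (there (there i))))))

  -- The cliques are the 2-cycles and the fixed points of σ. Counting each clique twice counts each
  -- vertex once and each fixed point once more, which avoids halving.
  matching-cover : ∀ n {xs σ} → length xs ≤ n → Unique xs → Matching xs σ →
                   ∃ λ css → Cover xs css × 2 * length css ≡ length xs + fixes σ xs
  matching-cover n {[]} le xs! M = [] , (↭-refl , []) , refl
  matching-cover (suc n) {x ∷ xs} {σ} (s≤s le) xs!@(a ∷ xs!′) M with σ x ≟ x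
  ... | yes fx with matching-cover n le xs!′ (drop-fixed xs! fx M)
  ... | css , (p , c) , e = (x ∷ []) ∷ css , (prep x p , ([] ∷ []) ∷ c) ,
        (begin
          2 * suc (length css) ≡⟨ *-suc 2 (length css) ⟩
          2 + 2 * length css ≡⟨ cong (2 +_) e ⟩
          2 + (length xs + fixes σ xs) ≡⟨ cong suc (sym (+-suc (length xs) (fixes σ xs))) ⟩
          suc (length xs) + suc (fixes σ xs) ∎)
        where open ≡-Reasoning
  matching-cover (suc n) {x ∷ xs} {σ} (s≤s le) xs!@(a ∷ xs!′) M | no nfx
    with Matching.closed M (here refl)
  ... | here e = ⊥-elim (nfx e)
  ... | there i with ∈-extract i
  ... | ys , q with matching-cover n {ys} {σ} (≤-trans (≤-trans (n≤1+n _) (≤-reflexive (sym (↭-length q)))) le) (proj₂ (unique-tail))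
                     (drop-pair (Unique-↭ (prep x q) xs!) (Matching-↭ (prep x q) M))
    where
      unique-tail : _ × Unique ys
      unique-tail with Unique-↭ q xs!′
      ... | a′ ∷ u = a′ , u
  ... | css , (p , c) , e = (x ∷ σ x ∷ []) ∷ css ,
        (prep x (↭-trans (prep (σ x) p) (↭-sym q)) , ((Matching.edge M (here refl) nfx ∷ []) ∷ [] ∷ []) ∷ c) ,
        (begin
          2 * suc (length css) ≡⟨ *-suc 2 (length css) ⟩
          2 + 2 * length css ≡⟨ cong (2 +_) e ⟩
          2 + (length ys + fixes σ ys) ≡⟨ cong₂ (λ l s → suc (l + s)) (↭-length q) fixq ⟨
          suc (length xs + fixes σ xs) ∎)
        where
          open ≡-Reasoning
          fixq : fixes σ xs ≡ fixes σ ys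
          fixq = trans (sum-↭ _ q) (cong (_+ fixes σ ys)
            (is-≢ (λ eq → nfx (sym (trans (sym (Matching.invol M (here refl))) eq)))))

  -- Matches the unmatched vertex x to y, whose former partner becomes unmatched.
  flip : (V → V) → V → V → V → V
  flip σ x y p with p ≟ x | p ≟ y | p ≟ σ y
  ... | yes _ | _ | _ = y
  ... | no _ | yes _ | _ = x
  ... | no _ | no _ | yes _ = p
  ... | no _ | no _ | no _ = σ p

  module Flip {xs σ x y} (M : Matching xs σ) (x∈ : x ∈ xs) (y∈ : y ∈ xs) (x≢y : x ≢ y) (xy : adj x y ≡ true) (fx : σ x ≡ x) where
    open Matching M

    flip-x : flip σ x y x ≡ y
    flip-x with x ≟ x
    ... | yes _ = refl
    ... | no q = ⊥-elim (q refl)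

    flip-y : flip σ x y y ≡ x
    flip-y with y ≟ x | y ≟ y
    ... | yes q | _ = q
    ... | no _ | yes _ = refl
    ... | no _ | no q = ⊥-elim (q refl)

    flip-other : ∀ {p} → p ≢ x → p ≢ y → p ≢ σ y → flip σ x y p ≡ σ p
    flip-other {p} a c d with p ≟ x | p ≟ y | p ≟ σ y
    ... | yes q | _ | _ = ⊥-elim (a q)
    ... | no _ | yes q | _ = ⊥-elim (c q)
    ... | no _ | no _ | yes q = ⊥-elim (d q)
    ... | no _ | no _ | no _ = refl

    flip-σy : ∀ {p} → p ≢ y → p ≡ σ y → flip σ x y p ≡ p
    flip-σy {p} c d with p ≟ x | p ≟ y | p ≟ σ y
    ... | yes refl | _ | _ = ⊥-elim (x≢y (trans (sym fx) (trans (cong σ d) (invol y∈))))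
    ... | no _ | yes q | _ = ⊥-elim (c q)
    ... | no _ | no _ | yes q = refl
    ... | no _ | no _ | no q = ⊥-elim (q d)

    data Kind (p : V) : Set where
      at-x : p ≡ x → Kind p
      at-y : p ≡ y → Kind p
      at-σy : p ≢ x → p ≢ y → p ≡ σ y → Kind p
      other : p ≢ x → p ≢ y → p ≢ σ y → Kind p

    kind : ∀ p → Kind p
    kind p with p ≟ x | p ≟ y | p ≟ σ y
    ... | yes q | _ | _ = at-x q
    ... | no _ | yes q | _ = at-y q
    ... | no a | no c | yes q = at-σy a c q
    ... | no a | no c | no d = other a c d

    σ-other : ∀ {p} → p ∈ xs → p ≢ x → p ≢ y → p ≢ σ y → σ p ≢ x × σ p ≢ y × σ p ≢ σ y
    σ-other {p} i a c d =
      (λ e → a (trans (sym (invol i)) (trans (cong σ e) fx))) ,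
      (λ e → d (trans (sym (invol i)) (cong σ e))) ,
      (λ e → c (trans (sym (invol i)) (trans (cong σ e) (invol y∈))))

    flip-matching : Matching xs (flip σ x y)
    flip-matching = record { closed = λ {p} → cl p (kind p) ; invol = λ {p} → inv p (kind p) ; edge = λ {p} → ed p (kind p) }
      where
        cl : ∀ p → Kind p → p ∈ xs → flip σ x y p ∈ xs
        cl p (at-x refl) i = subst (_∈ xs) (sym flip-x) y∈
        cl p (at-y refl) i = subst (_∈ xs) (sym flip-y) x∈
        cl p (at-σy a c d) i = subst (_∈ xs) (sym (flip-σy c d)) i
        cl p (other a c d) i = subst (_∈ xs) (sym (flip-other a c d)) (closed i)
        inv : ∀ p → Kind p → p ∈ xs → flip σ x y (flip σ x y p) ≡ p
        inv p (at-x refl) i = trans (cong (flip σ x y) flip-x) flip-y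
        inv p (at-y refl) i = trans (cong (flip σ x y) flip-y) flip-x
        inv p (at-σy a c d) i = trans (cong (flip σ x y) (flip-σy c d)) (flip-σy c d)
        inv p (other a c d) i with σ-other i a c d
        ... | a′ , c′ , d′ = trans (cong (flip σ x y) (flip-other a c d)) (trans (flip-other a′ c′ d′) (invol i))
        ed : ∀ p → Kind p → p ∈ xs → flip σ x y p ≢ p → adj p (flip σ x y p) ≡ true
        ed p (at-x refl) i n = trans (cong (adj x) flip-x) xy
        ed p (at-y refl) i n = trans (cong (adj y) flip-y) (trans (adj-sym y x) xy)
        ed p (at-σy a c d) i n = ⊥-elim (n (flip-σy c d))
        ed p (other a c d) i n = trans (cong (adj p) (flip-other a c d)) (edge i (λ e → n (trans (flip-other a c d) e)))

    fixes-augment : Unique xs → σ y ≡ y → fixes (flip σ x y) xs + 2 ≡ fixes σ xs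
    fixes-augment xs! fy = begin
      F + 2 ≡⟨ cong₂ (λ p q → F + (p + q)) (sum-is x∈ xs!) (sum-is y∈ xs!) ⟨
      F + (sum (is x) xs + sum (is y) xs) ≡⟨ cong (F +_) (sum-+ (is x) (is y) xs) ⟨
      F + sum (λ p → is x p + is y p) xs ≡⟨ sum-+ (λ p → is p (flip σ x y p)) _ xs ⟨
      sum (λ p → is p (flip σ x y p) + (is x p + is y p)) xs ≡⟨ sum-cong xs (λ p i → pt p (kind p)) ⟩
      fixes σ xs ∎
      where
        open ≡-Reasoning
        F = fixes (flip σ x y) xs
        pt : ∀ p → Kind p → is p (flip σ x y p) + (is x p + is y p) ≡ is p (σ p)
        pt p (at-x refl) rewrite flip-x | fx | is-refl x | is-≢ x≢y | is-≢ (λ e → x≢y (sym e)) = refl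
        pt p (at-y refl) rewrite flip-y | fy | is-refl y | is-≢ x≢y | is-≢ (λ e → x≢y (sym e)) = refl
        pt p (at-σy a c d) = ⊥-elim (c (trans d fy))
        pt p (other a c d) rewrite flip-other a c d | is-≢ a | is-≢ c = +-identityʳ _

    fixes-swap : Unique xs → σ y ≢ y → fixes (flip σ x y) xs ≡ fixes σ xs
    fixes-swap xs! ny = +-cancelʳ-≡ 1 _ _ (begin
      F + 1 ≡⟨ cong (F +_) (sum-is x∈ xs!) ⟨
      F + sum (is x) xs ≡⟨ sum-+ (λ p → is p (flip σ x y p)) _ xs ⟨
      sum (λ p → is p (flip σ x y p) + is x p) xs ≡⟨ sum-cong xs (λ p i → pt p (kind p) i) ⟩
      sum (λ p → is p (σ p) + is (σ y) p) xs ≡⟨ sum-+ (λ p → is p (σ p)) _ xs ⟩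
      fixes σ xs + sum (is (σ y)) xs ≡⟨ cong (fixes σ xs +_) (sum-is (closed y∈) xs!) ⟩
      fixes σ xs + 1 ∎)
      where
        open ≡-Reasoning
        F = fixes (flip σ x y) xs
        x≢σy : x ≢ σ y
        x≢σy e = x≢y (trans (sym fx) (trans (cong σ e) (invol y∈)))
        pt : ∀ p → Kind p → p ∈ xs → is p (flip σ x y p) + is x p ≡ is p (σ p) + is (σ y) p
        pt p (at-x refl) i rewrite flip-x | fx | is-refl x | is-≢ (λ e → x≢y (sym e)) | is-≢ x≢σy = refl
        pt p (at-y refl) i rewrite flip-y | is-≢ x≢y | is-≢ (λ e → x≢y (sym e)) | is-≢ ny | is-≢ (λ e → ny (sym e)) = refl
        pt p (at-σy a c refl) i rewrite flip-σy c refl | is-refl (σ y) | is-≢ a | invol y∈ | is-≢ (λ e → c (sym e)) = refl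
        pt p (other a c d) i rewrite flip-other a c d | is-≢ a | is-≢ d = refl

module Classes {V : Set} (_≟_ : DecidableEquality V) (adj : V → V → Bool)
  (adj-sym : ∀ u v → adj u v ≡ adj v u) (adj-irr : ∀ v → adj v v ≡ false) where

  open Ambient _≟_ adj adj-sym adj-irr
  open Matchings _≟_ adj adj-sym adj-irr

  adj⇒≢ : ∀ {x y} → adj x y ≡ true → x ≢ y
  adj⇒≢ {x} e refl with trans (sym e) (adj-irr x)
  ... | ()

  agree : (V → V) → (V → V) → List V → ℕ
  agree σ τ xs = sum (λ p → is (σ p) (τ p)) xs

  module Critical (xs : List V) (xs! : Unique xs) (c : ℕ)
    (bound : ∀ σ → Matching xs σ → 2 * c ≤ length xs + fixes σ xs) where

    Minimum : (V → V) → Set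
    Minimum σ = Matching xs σ × length xs + fixes σ xs ≡ 2 * c

    Apart : V → V → Set
    Apart u z = ∃ λ σ → Minimum σ × σ u ≡ u × σ z ≡ z

    no-augment : ∀ {σ x y} → Minimum σ → x ∈ xs → y ∈ xs → adj x y ≡ true → σ x ≡ x → σ y ≢ y
    no-augment {σ} {x} {y} (M , e) i j xy fx fy = <⇒≱ (begin-strict
      length xs + fixes (flip σ x y) xs <⟨ +-monoʳ-< (length xs) (m<m+n _ (s≤s z≤n)) ⟩
      length xs + (fixes (flip σ x y) xs + 2) ≡⟨ cong (length xs +_) (F.fixes-augment xs! fy) ⟩
      length xs + fixes σ xs ≡⟨ e ⟩
      2 * c ∎) (bound _ F.flip-matching)
      where
        open ≤-Reasoning
        module F = Flip M i j (adj⇒≢ xy) xy fx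

    -- If N misses w while M misses u and z, then N can be brought closer to M without losing w.
    exchange : ∀ n {u z w M N} → u ∈ xs → z ∈ xs → w ∈ xs → u ≢ z → adj w z ≡ true →
      Minimum M → M u ≡ u → M z ≡ z → ¬ Apart u w → Minimum N → N w ≡ w →
      length xs ≤ agree M N xs + n → ⊥
    exchange n {u} {z} {w} {M} {N} u∈ z∈ w∈ u≢z wz (MM , eM) Mu Mz ¬uw (MN , eN) Nw close
      with any? (λ x → ¬? (x ≟ w) ×-dec (N x ≟ x) ×-dec ¬? (M x ≟ x)) xs
    ... | no none = <-irrefl refl (begin-strict
        fixes N xs + 1 <⟨ +-monoʳ-< (fixes N xs) (s≤s (s≤s z≤n)) ⟩
        fixes N xs + (1 + 1) ≡⟨ cong₂ (λ p q → fixes N xs + (p + q)) (sum-is u∈ xs!) (sum-is z∈ xs!) ⟨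
        fixes N xs + (sum (is u) xs + sum (is z) xs) ≡⟨ cong (fixes N xs +_) (sum-+ (is u) (is z) xs) ⟨
        fixes N xs + sum (λ p → is u p + is z p) xs ≡⟨ sum-+ (λ p → is p (N p)) _ xs ⟨
        sum (λ p → is p (N p) + (is u p + is z p)) xs ≤⟨ sum-mono xs pt ⟩
        sum (λ p → is p (M p) + is w p) xs ≡⟨ sum-+ (λ p → is p (M p)) (is w) xs ⟩
        fixes M xs + sum (is w) xs
          ≡⟨ cong₂ _+_ (+-cancelˡ-≡ (length xs) _ _ (trans eM (sym eN))) (sum-is w∈ xs!) ⟩
        fixes N xs + 1 ∎)
      where
        open ≤-Reasoning
        pt : ∀ p → p ∈ xs → is p (N p) + (is u p + is z p) ≤ is p (M p) + is w p
        pt p i with p ≟ u | p ≟ z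
        ... | yes refl | yes e = ⊥-elim (u≢z e)
        ... | yes refl | no _ rewrite Mu | is-refl u | is-≢ (λ e → ¬uw (N , (MN , eN) , e , Nw)) = s≤s z≤n
        ... | no _ | yes refl rewrite Mz | is-refl z
                | is-≢ (no-augment (MN , eN) w∈ z∈ wz Nw) = s≤s z≤n
        ... | no _ | no _ with p ≟ w | N p ≟ p | M p ≟ p
        ... | _ | no _ | _ = z≤n
        ... | yes _ | yes _ | m = m≤n+m 1 (b (does m))
        ... | no _ | yes _ | yes _ = s≤s z≤n
        ... | no a | yes f | no m = ⊥-elim (none (inject i (a , f , m)))
          where
            inject : ∀ {zs p} → p ∈ zs → (¬ (p ≡ w)) × (N p ≡ p) × (¬ (M p ≡ p)) →
                     Any (λ x → (¬ (x ≡ w)) × (N x ≡ x) × (¬ (M x ≡ x))) zs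
            inject (here refl) q = here q
            inject (there j) q = there (inject j q)
    ... | yes found = go found id
      where
        go : ∀ {zs} → Any (λ x → (¬ (x ≡ w)) × (N x ≡ x) × (¬ (M x ≡ x))) zs → (∀ {y} → y ∈ zs → y ∈ xs) → ⊥
        go (there a) s = go a (s ∘ there)
        go (here {x} (x≢w , Nx , Mx)) s = step n close
          where
            x∈ : x ∈ xs
            x∈ = s (here refl)
            y : V
            y = M x
            y∈ : y ∈ xs
            y∈ = Matching.closed MM x∈
            xy : adj x y ≡ true
            xy = Matching.edge MM x∈ Mx
            Ny : N y ≢ y
            Ny = no-augment (MN , eN) x∈ y∈ xy Nx
            module F = Flip MN x∈ y∈ (λ e → Mx (sym e)) xy Nx
            N′ : V → V
            N′ = flip N x y
            minN′ : Minimum N′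
            minN′ = F.flip-matching , trans (cong (length xs +_) (F.fixes-swap xs! Ny)) eN
            N′w : N′ w ≡ w
            N′w = by-case (w ≟ N y)
              where
                by-case : Dec (w ≡ N y) → N′ w ≡ w
                by-case (yes e) = F.flip-σy (λ { refl → Ny Nw }) e
                by-case (no d) = trans (F.flip-other (λ e → x≢w (sym e)) (λ { refl → Ny Nw }) d) Nw
            closer : agree M N xs + 1 ≤ agree M N′ xs
            closer = begin
              agree M N xs + 1 ≡⟨ cong (agree M N xs +_) (sum-is x∈ xs!) ⟨
              agree M N xs + sum (is x) xs ≡⟨ sum-+ (λ p → is (M p) (N p)) (is x) xs ⟨
              sum (λ p → is (M p) (N p) + is x p) xs ≤⟨ sum-mono xs (λ p i → pt p (F.kind p)) ⟩
              agree M N′ xs ∎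
              where
                open ≤-Reasoning
                pt : ∀ p → F.Kind p → is (M p) (N p) + is x p ≤ is (M p) (N′ p)
                pt p (F.at-x refl) rewrite F.flip-x | is-refl (M x) | Nx | is-≢ (λ e → Mx (sym e)) | is-refl x = ≤-refl
                pt p (F.at-y refl) rewrite F.flip-y | Matching.invol MM x∈ | is-refl x | is-≢ Mx
                  | is-≢ {x} {N y} (λ e → Mx (trans (sym (Matching.invol MN y∈)) (trans (cong N e) Nx))) = z≤n
                pt p (F.at-σy a c refl) rewrite is-≢ a | Matching.invol MN y∈
                  | is-≢ {M (N y)} {y} (λ e → a (trans (sym (Matching.invol MM (Matching.closed MN y∈)))
                      (trans (cong M (sym e)) (Matching.invol MM x∈)))) = z≤n
                pt p (F.other a c d) rewrite is-≢ a | F.flip-other a c d = ≤-reflexive (+-identityʳ _)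
            step : ∀ n → length xs ≤ agree M N xs + n → ⊥
            step zero le = <⇒≱ (begin-strict
              agree M N′ xs ≤⟨ sum-mono xs (λ p _ → b≤1 _) ⟩
              sum (λ _ → 1) xs ≡⟨ trans (sum-const 1 xs) (*-identityʳ _) ⟩
              length xs ≤⟨ le ⟩
              agree M N xs + 0 <⟨ +-monoʳ-< (agree M N xs) (s≤s z≤n) ⟩
              agree M N xs + 1 ∎) closer
              where open ≤-Reasoning
            step (suc n) le = exchange n u∈ z∈ w∈ u≢z wz (MM , eM) Mu Mz ¬uw minN′ N′w (begin
              length xs ≤⟨ le ⟩
              agree M N xs + suc n ≡⟨ lem (agree M N xs) n ⟩
              agree M N xs + 1 + n ≤⟨ +-monoˡ-≤ n closer ⟩
              agree M N′ xs + n ∎)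
              where
                open ≤-Reasoning
                lem : ∀ a n → a + suc n ≡ a + 1 + n
                lem = solve-∀

module Gaps {V : Set} (_≟_ : DecidableEquality V) (adj : V → V → Bool)
  (adj-sym : ∀ u v → adj u v ≡ adj v u) (adj-irr : ∀ v → adj v v ≡ false) where

  open Ambient _≟_ adj adj-sym adj-irr
  open Matchings _≟_ adj adj-sym adj-irr
  open Classes _≟_ adj adj-sym adj-irr

  classify : ∀ (P : V → Set) xs → ¬ ¬ (∃ λ (p : V → Bool) → ∀ z → z ∈ xs → (p z ≡ true × P z) ⊎ (p z ≡ false × ¬ P z))
  classify P [] k = k ((λ _ → true) , λ _ ())
  classify P (x ∷ xs) k = classify P xs λ { (p , h) → ¬¬-excluded-middle {A = P x} λ
    { (yes px) → k ((λ z → if does (z ≟ x) then true else p z) , λ z i → pos p h px z i)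
    ; (no npx) → k ((λ z → if does (z ≟ x) then false else p z) , λ z i → neg p h npx z i) } }
    where
      pos : ∀ p → (∀ z → z ∈ xs → (p z ≡ true × P z) ⊎ (p z ≡ false × ¬ P z)) → P x → ∀ z → z ∈ x ∷ xs →
            ((if does (z ≟ x) then true else p z) ≡ true × P z) ⊎ ((if does (z ≟ x) then true else p z) ≡ false × ¬ P z)
      pos p h px z i with z ≟ x
      ... | yes refl = inj₁ (refl , px)
      pos p h px z (here e) | no q = ⊥-elim (q e)
      pos p h px z (there i) | no q = h z i
      neg : ∀ p → (∀ z → z ∈ xs → (p z ≡ true × P z) ⊎ (p z ≡ false × ¬ P z)) → ¬ P x → ∀ z → z ∈ x ∷ xs →
            ((if does (z ≟ x) then false else p z) ≡ true × P z) ⊎ ((if does (z ≟ x) then false else p z) ≡ false × ¬ P z)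
      neg p h npx z i with z ≟ x
      ... | yes refl = inj₂ (refl , npx)
      neg p h npx z (here e) | no q = ⊥-elim (q e)
      neg p h npx z (there i) | no q = h z i

  minimum-matching : ∀ n xs σ → Unique xs → Matching xs σ → fixes σ xs ≤ n →
    ¬ ¬ (∃₂ λ c τ → Matching xs τ × length xs + fixes τ xs ≡ 2 * c × (∀ ρ → Matching xs ρ → 2 * c ≤ length xs + fixes ρ xs))
  minimum-matching n xs σ xs! M le k = ¬¬-excluded-middle {A = ∃ λ τ → Matching xs τ × fixes τ xs < fixes σ xs} λ
    { (yes (τ , Mτ , lt)) → descend n le τ Mτ lt
    ; (no none) → with-cover none (matching-cover (length xs) ≤-refl xs! M) }
    where
      descend : ∀ n → fixes σ xs ≤ n → ∀ τ → Matching xs τ → fixes τ xs < fixes σ xs → ⊥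
      descend zero le τ Mτ lt = <⇒≱ lt (≤-trans le z≤n)
      descend (suc n) le τ Mτ lt = minimum-matching n xs τ xs! Mτ (s≤s⁻¹ (≤-trans lt le)) k
      with-cover : ¬ (∃ λ τ → Matching xs τ × fixes τ xs < fixes σ xs) →
                   (∃ λ css → Cover xs css × 2 * length css ≡ length xs + fixes σ xs) → ⊥
      with-cover none (css , _ , e) = k (length css , σ , M , sym e , λ ρ Mρ →
        ≤-trans (≤-reflexive e) (+-monoʳ-≤ (length xs) (≮⇒≥ (λ lt → none (ρ , Mρ , lt)))))

  maximum-clique : ∀ k xs → Alpha≤ k xs →
    ¬ ¬ (∃₂ λ w zs → length zs ≡ w × Unique zs × (∀ {z} → z ∈ zs → z ∈ xs) × Indep zs × Alpha≤ w xs)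
  maximum-clique zero xs al n = n (0 , [] , refl , [] , (λ ()) , [] , al)
  maximum-clique (suc k) xs al n = ¬¬-excluded-middle {A = Alpha≤ k xs} λ
    { (yes al′) → maximum-clique k xs al′ n
    ; (no na) → na (λ zs zs! sub ind → ≤-stable (λ nle →
        n (suc k , zs , ≤-antisym (al zs zs! sub ind) (≰⇒> nle) , zs! , sub , ind , al))) }

  module Bound (F : ℕ) (g : ℕ → ℕ) (g0 : g 0 ≡ 0)
    (g-step : ∀ f → suc f ≤ F → g (suc f) ≤ 2 + g f)
    (g-super : ∀ a c → a + c ≤ F → g (a + c) ≤ g a + g c)
    (no-ramsey : ∀ c f xs → f ≤ F → f ≤ c → c ≤ g f → Unique xs → TriFree xs → Alpha≤ (c ∸ f) xs →
                 suc (length xs) ≡ 2 * c → ⊥) where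

    Bounded : List V → Set
    Bounded xs = ∀ c w f → f ≤ F → (∀ σ → Matching xs σ → 2 * c ≤ length xs + fixes σ xs) →
                 Alpha≤ w xs → w + f ≤ c → c + g f ≤ length xs

    bounded-zero : ∀ {xs} c → (∀ σ → Matching xs σ → 2 * c ≤ length xs + fixes σ xs) → c + g 0 ≤ length xs
    bounded-zero {xs} c bound = ≤-trans (≤-reflexive (trans (cong (c +_) g0) (+-identityʳ c))) (*-cancelˡ-≤ 2 (begin
      2 * c ≤⟨ bound id (id-matching xs) ⟩
      length xs + fixes id xs ≡⟨ cong (length xs +_) (fixes-id xs) ⟩
      length xs + length xs ≡⟨ cong (length xs +_) (sym (+-identityʳ _)) ⟩
      2 * length xs ∎))
      where open ≤-Reasoning

    -- The complement falls apart into xs = ys ++ zs without edges between the two parts, i.e. the graph is a join.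
    join : ∀ {xs ys zs} → Unique xs → xs ↭ ys ++ zs → (∀ {y z} → y ∈ ys → z ∈ zs → adj y z ≡ false) →
      Bounded ys → Bounded zs → ∀ c w f → f ≤ F → (∀ σ → Matching xs σ → 2 * c ≤ length xs + fixes σ xs) →
      Alpha≤ w xs → w + f ≤ c → ¬ ¬ (c + g f ≤ length xs)
    join {xs} {ys} {zs} xs! p sep By Bz c w f fF bound al wf k =
      minimum-matching (length ys) ys id ys! (id-matching ys) (fixes≤length id ys) λ (cy , σ , Mσ , eσ , boundy) →
      minimum-matching (length zs) zs id zs! (id-matching zs) (fixes≤length id zs) λ (cz , τ , Mτ , eτ , boundz) →
      maximum-clique w ys (Alpha≤-⊆ ys⊆ al) λ (wy , ks , lks , ks! , ks⊆ , ksI , aly) →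
      maximum-clique w zs (Alpha≤-⊆ zs⊆ al) λ (wz , ls , lls , ls! , ls⊆ , lsI , alz) →
      k (finish cy σ Mσ eσ boundy cz τ Mτ eτ boundz wy wz aly alz
        (≤-trans (≤-reflexive (sym (trans (length-++ ks) (cong₂ _+_ lks lls))))
          (al (ks ++ ls) (AllPairs-++⁺ ks! ls! (λ i j e → apart (ks⊆ i) (subst (_∈ zs) (sym e) (ls⊆ j))))
            (sub ks⊆ ls⊆) (AllPairs-++⁺ ksI lsI (λ i j → sep (ks⊆ i) (ls⊆ j))))))
      where
        both! : Unique (ys ++ zs)
        both! = Unique-↭ p xs!
        ys! : Unique ys
        ys! = proj₁ (AllPairs-++⁻ ys both!)
        zs! : Unique zs
        zs! = proj₂ (AllPairs-++⁻ ys both!)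
        ys⊆ : ∀ {x} → x ∈ ys → x ∈ xs
        ys⊆ i = ∈-resp-↭ (↭-sym p) (∈-++⁺ˡ i)
        zs⊆ : ∀ {x} → x ∈ zs → x ∈ xs
        zs⊆ i = ∈-resp-↭ (↭-sym p) (∈-++⁺ʳ ys i)
        disj : ∀ as {x} → Unique (as ++ zs) → x ∈ as → x ∈ zs → ⊥
        disj (a ∷ as) (q ∷ _) (here refl) j = All.lookup q (∈-++⁺ʳ as j) refl
        disj (a ∷ as) (_ ∷ u) (there i) j = disj as u i j
        apart : ∀ {x} → x ∈ ys → x ∈ zs → ⊥
        apart = disj ys both!
        sub : ∀ {ks ls} → (∀ {z} → z ∈ ks → z ∈ ys) → (∀ {z} → z ∈ ls → z ∈ zs) → ∀ {z} → z ∈ ks ++ ls → z ∈ xs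
        sub {ks} a c i with ∈-++⁻ ks i
        ... | inj₁ j = ys⊆ (a j)
        ... | inj₂ j = zs⊆ (c j)
        member? : V → Bool
        member? v = does (any? (v ≟_) ys)
        member-yes : ∀ {v} → v ∈ ys → member? v ≡ true
        member-yes {v} i with any? (v ≟_) ys
        ... | yes _ = refl
        ... | no q = ⊥-elim (q i)
        member-no : ∀ {v} → v ∈ zs → member? v ≡ false
        member-no {v} i with any? (v ≟_) ys
        ... | yes q = ⊥-elim (apart q i)
        ... | no _ = refl
        both : (V → V) → (V → V) → V → V
        both σ τ v = if member? v then σ v else τ v
        both-ys : ∀ σ τ {v} → v ∈ ys → both σ τ v ≡ σ v
        both-ys σ τ {v} i = cong (λ m → if m then σ v else τ v) (member-yes i)
        both-zs : ∀ σ τ {v} → v ∈ zs → both σ τ v ≡ τ v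
        both-zs σ τ {v} i = cong (λ m → if m then σ v else τ v) (member-no i)
        cases : ∀ {v} → v ∈ xs → v ∈ ys ⊎ v ∈ zs
        cases i = ∈-++⁻ ys (∈-resp-↭ p i)
        both-matching : ∀ {σ τ} → Matching ys σ → Matching zs τ → Matching xs (both σ τ)
        both-matching {σ} {τ} Mσ Mτ = record { closed = λ i → cl (cases i) ; invol = λ i → inv (cases i) ; edge = λ i → ed (cases i) }
          where
            cl : ∀ {v} → v ∈ ys ⊎ v ∈ zs → both σ τ v ∈ xs
            cl (inj₁ i) = subst (_∈ xs) (sym (both-ys σ τ i)) (ys⊆ (Matching.closed Mσ i))
            cl (inj₂ i) = subst (_∈ xs) (sym (both-zs σ τ i)) (zs⊆ (Matching.closed Mτ i))
            inv : ∀ {v} → v ∈ ys ⊎ v ∈ zs → both σ τ (both σ τ v) ≡ v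
            inv (inj₁ i) = trans (cong (both σ τ) (both-ys σ τ i))
              (trans (both-ys σ τ (Matching.closed Mσ i)) (Matching.invol Mσ i))
            inv (inj₂ i) = trans (cong (both σ τ) (both-zs σ τ i))
              (trans (both-zs σ τ (Matching.closed Mτ i)) (Matching.invol Mτ i))
            ed : ∀ {v} → v ∈ ys ⊎ v ∈ zs → both σ τ v ≢ v → adj v (both σ τ v) ≡ true
            ed {v} (inj₁ i) n = trans (cong (adj v) (both-ys σ τ i)) (Matching.edge Mσ i (λ e → n (trans (both-ys σ τ i) e)))
            ed {v} (inj₂ i) n = trans (cong (adj v) (both-zs σ τ i)) (Matching.edge Mτ i (λ e → n (trans (both-zs σ τ i) e)))
        both-fixes : ∀ σ τ → fixes (both σ τ) xs ≡ fixes σ ys + fixes τ zs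
        both-fixes σ τ = trans (sum-↭ _ p) (trans (sum-++ _ ys zs) (cong₂ _+_
          (sum-cong ys (λ v i → cong (is v) (both-ys σ τ i))) (sum-cong zs (λ v i → cong (is v) (both-zs σ τ i)))))
        finish : ∀ cy σ → Matching ys σ → length ys + fixes σ ys ≡ 2 * cy →
          (∀ ρ → Matching ys ρ → 2 * cy ≤ length ys + fixes ρ ys) →
          ∀ cz τ → Matching zs τ → length zs + fixes τ zs ≡ 2 * cz →
          (∀ ρ → Matching zs ρ → 2 * cz ≤ length zs + fixes ρ zs) →
          ∀ wy wz → Alpha≤ wy ys → Alpha≤ wz zs → wy + wz ≤ w → c + g f ≤ length xs
        finish cy σ Mσ eσ boundy cz τ Mτ eτ boundz wy wz aly alz ww = begin
          c + g f ≤⟨ +-mono-≤ c≤ (≤-trans (≤-reflexive (cong g (sym split-f))) (g-super fy fz (≤-trans (≤-reflexive split-f) fF))) ⟩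
          cy + cz + (g fy + g fz) ≡⟨ lem cy cz (g fy) (g fz) ⟩
          (cy + g fy) + (cz + g fz) ≤⟨ +-mono-≤ ybound zbound ⟩
          length ys + length zs ≡⟨ trans (↭-length p) (length-++ ys) ⟨
          length xs ∎
          where
            open ≤-Reasoning
            lem : ∀ a d e h → a + d + (e + h) ≡ (a + e) + (d + h)
            lem = solve-∀
            lem′ : ∀ a d e h → a + e + (d + h) ≡ (a + d) + (e + h)
            lem′ = solve-∀
            c≤ : c ≤ cy + cz
            c≤ = *-cancelˡ-≤ 2 (begin
              2 * c ≤⟨ bound _ (both-matching Mσ Mτ) ⟩
              length xs + fixes (both σ τ) xs ≡⟨ cong₂ _+_ (trans (↭-length p) (length-++ ys)) (both-fixes σ τ) ⟩
              length ys + length zs + (fixes σ ys + fixes τ zs) ≡⟨ lem (length ys) (length zs) (fixes σ ys) (fixes τ zs) ⟩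
              (length ys + fixes σ ys) + (length zs + fixes τ zs) ≡⟨ cong₂ _+_ eσ eτ ⟩
              2 * cy + 2 * cz ≡⟨ *-distribˡ-+ 2 cy cz ⟨
              2 * (cy + cz) ∎)
            fy fz : ℕ
            fy = f ⊓ (cy ∸ wy)
            fz = f ∸ fy
            split-f : fy + fz ≡ f
            split-f = m+[n∸m]≡n (m⊓n≤m f (cy ∸ wy))
            ybound : cy + g fy ≤ length ys
            ybound with fy in eq
            ... | zero = bounded-zero cy boundy
            ... | suc m = By cy wy (suc m) (≤-trans (≤-trans (≤-reflexive (sym eq)) (m⊓n≤m f (cy ∸ wy))) fF) boundy aly
                (m≤n∸m⇒ (≤-trans (≤-reflexive (sym eq)) (m⊓n≤n f (cy ∸ wy))))
              where
                m≤n∸m⇒ : suc m ≤ cy ∸ wy → wy + suc m ≤ cy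
                m≤n∸m⇒ q = ≤-trans (+-monoʳ-≤ wy q)
                  (≤-reflexive (m+[n∸m]≡n {wy} {cy} (<⇒≤ (0<∸⇒< (≤-trans (s≤s z≤n) q)))))
            zbound : cz + g fz ≤ length zs
            zbound with fz in eq
            ... | zero = bounded-zero cz boundz
            ... | suc m = Bz cz wz (suc m) (≤-trans (≤-trans (≤-reflexive (sym eq)) (m∸n≤m f fy)) fF) boundz alz
                (+-cancelˡ-≤ (wy + fy) _ _ (begin
                  wy + fy + (wz + suc m) ≡⟨ cong (λ q → wy + fy + (wz + q)) eq ⟨
                  wy + fy + (wz + fz) ≡⟨ lem′ wy wz fy fz ⟩
                  (wy + wz) + (fy + fz) ≡⟨ cong ((wy + wz) +_) split-f ⟩
                  wy + wz + f ≤⟨ +-monoˡ-≤ f ww ⟩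
                  w + f ≤⟨ wf ⟩
                  c ≤⟨ c≤ ⟩
                  cy + cz ≤⟨ +-monoˡ-≤ cz (≤-trans (m≤n+m∸n cy wy) (≤-reflexive (cong (wy +_) (sym fy≡)))) ⟩
                  wy + fy + cz ∎))
              where
                fy≡ : fy ≡ cy ∸ wy
                fy≡ with ⊓-sel f (cy ∸ wy)
                ... | inj₂ q = q
                ... | inj₁ q with trans (sym eq) (trans (cong (f ∸_) q) (n∸n≡0 f))
                ... | ()

    Alpha≤-mono : ∀ {j k xs} → j ≤ k → Alpha≤ j xs → Alpha≤ k xs
    Alpha≤-mono le al zs u s i = ≤-trans (al zs u s i) le

    extend : V → (V → V) → V → V
    extend u σ v = if does (v ≟ u) then u else σ v

    extend-fixed : ∀ u σ → extend u σ u ≡ u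
    extend-fixed u σ with u ≟ u
    ... | yes _ = refl
    ... | no q = ⊥-elim (q refl)

    extend-≢ : ∀ {u v} σ → v ≢ u → extend u σ v ≡ σ v
    extend-≢ {u} {v} σ ne with v ≟ u
    ... | yes q = ⊥-elim (ne q)
    ... | no _ = refl

    module Extend {xs ys u σ} (xs! : Unique xs) (p : xs ↭ u ∷ ys) (M : Matching ys σ) where

      u∉ : All (u ≢_) ys
      u∉ with Unique-↭ p xs!
      ... | a ∷ _ = a

      ne : ∀ {v} → v ∈ ys → v ≢ u
      ne i e = All.lookup u∉ i (sym e)

      extend-matching : Matching xs (extend u σ)
      extend-matching = Matching-↭ (↭-sym p) (record { closed = cl ; invol = inv ; edge = ed })
        where
          cl : ∀ {v} → v ∈ u ∷ ys → extend u σ v ∈ u ∷ ys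
          cl (here refl) = here (extend-fixed u σ)
          cl (there i) = subst (_∈ u ∷ ys) (sym (extend-≢ σ (ne i))) (there (Matching.closed M i))
          inv : ∀ {v} → v ∈ u ∷ ys → extend u σ (extend u σ v) ≡ v
          inv (here refl) = trans (cong (extend u σ) (extend-fixed u σ)) (extend-fixed u σ)
          inv (there i) = trans (cong (extend u σ) (extend-≢ σ (ne i)))
            (trans (extend-≢ σ (ne (Matching.closed M i))) (Matching.invol M i))
          ed : ∀ {v} → v ∈ u ∷ ys → extend u σ v ≢ v → adj v (extend u σ v) ≡ true
          ed (here refl) n = ⊥-elim (n (extend-fixed u σ))
          ed {v} (there i) n = trans (cong (adj v) (extend-≢ σ (ne i))) (Matching.edge M i (λ e → n (trans (extend-≢ σ (ne i)) e)))

      extend-fixes : fixes (extend u σ) xs ≡ suc (fixes σ ys)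
      extend-fixes = trans (sum-↭ _ p) (cong₂ _+_ (trans (cong (is u) (extend-fixed u σ)) (is-refl u))
        (sum-cong ys (λ v i → cong (is v) (extend-≢ σ (ne i)))))

    bounded : ∀ n xs → length xs ≤ n → Unique xs → TriFree xs → Bounded xs
    bounded n xs le xs! tf c w zero fF bound al wf = bounded-zero c bound
    bounded n [] le xs! tf c w (suc f) fF bound al wf =
      ⊥-elim (<⇒≱ (≤-trans (≤-trans (s≤s z≤n) (m≤n+m (suc f) w)) wf) (≤-trans (m≤m+n c (c + 0)) (bound id (id-matching []))))
    bounded (suc n) xs@(u₀ ∷ _) (s≤s le) xs! tf c w (suc f) fF bound al wf = ≤-stable (λ k →
      ¬¬-excluded-middle {A = ∃₂ λ u ys → xs ↭ u ∷ ys × (∀ σ → Matching ys σ → 2 * c ≤ length ys + fixes σ ys)} λ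
        { (yes (u , ys , p , bd)) → k (≤-trans
            (bounded n ys (≤-trans (≤-reflexive (suc-injective (sym (↭-length p)))) le) (tail (Unique-↭ p xs!))
              (TriFree-⊆ (⊆ p) tf) c w (suc f) fF bd (Alpha≤-⊆ (⊆ p) al) wf)
            (≤-trans (n≤1+n _) (≤-reflexive (sym (↭-length p)))))
        ; (no tight) → classify (λ z → z ≢ u₀ × Apart u₀ z) xs λ (p , h) →
            parts k tight p h (filterᵇ p xs) refl })
      where
        open Critical xs xs! c bound
        u₀∈ : u₀ ∈ xs
        u₀∈ = here refl
        Tight : Set
        Tight = ¬ (∃₂ λ u ys → xs ↭ u ∷ ys × (∀ σ → Matching ys σ → 2 * c ≤ length ys + fixes σ ys))
        tail : ∀ {u ys} → Unique (u ∷ ys) → Unique ys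
        tail (_ ∷ q) = q
        ⊆ : ∀ {u ys} → xs ↭ u ∷ ys → ∀ {x} → x ∈ ys → x ∈ xs
        ⊆ p i = ∈-resp-↭ (↭-sym p) (there i)
        critical : Tight → ∀ u → u ∈ xs → ¬ ¬ (∃ λ σ → Minimum σ × σ u ≡ u)
        critical tight u i k with ∈-extract i
        ... | ys , p = tight (u , ys , p , λ σ M → ≤-stable (λ nle → make σ M (≰⇒> nle)))
          where
            make : ∀ σ → Matching ys σ → length ys + fixes σ ys < 2 * c → ⊥
            make σ M lt with matching-cover (length xs) ≤-refl xs! (Extend.extend-matching xs! p M)
            ... | css , _ , e = k (extend u σ ,
                (Extend.extend-matching xs! p M , trans (sym e) (cong (2 *_) (≤-antisym upper lower))) , extend-fixed u σ)
              where
                open ≤-Reasoning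
                lower : c ≤ length css
                lower = *-cancelˡ-≤ 2 (≤-trans (bound _ (Extend.extend-matching xs! p M)) (≤-reflexive (sym e)))
                upper : length css ≤ c
                upper = s≤s⁻¹ (*-cancelˡ-< 2 _ _ (begin-strict
                  2 * length css ≡⟨ e ⟩
                  length xs + fixes (extend u σ) xs ≡⟨ cong₂ _+_ (↭-length p) (Extend.extend-fixes xs! p M) ⟩
                  suc (length ys) + suc (fixes σ ys) ≡⟨ cong suc (+-suc (length ys) (fixes σ ys)) ⟩
                  2 + (length ys + fixes σ ys) <⟨ +-monoʳ-< 2 lt ⟩
                  2 + 2 * c ≡⟨ *-suc 2 c ⟨
                  2 * suc c ∎))
        Classified : (V → Bool) → Set
        Classified p = ∀ z → z ∈ xs → (p z ≡ true × (z ≢ u₀ × Apart u₀ z)) ⊎ (p z ≡ false × ¬ (z ≢ u₀ × Apart u₀ z))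
        in-part : ∀ p → Classified p → ∀ {z} → z ∈ filterᵇ p xs → z ∈ xs × (z ≢ u₀ × Apart u₀ z)
        in-part p h {z} i with ∈-filterᵇ⁻ p xs i
        ... | j , e with h z j
        ... | inj₁ (_ , q) = j , q
        ... | inj₂ (e′ , _) with trans (sym e) e′
        ... | ()
        out-part : ∀ p → Classified p → ∀ {z} → z ∈ filterᵇ (not ∘ p) xs → z ∈ xs × ¬ (z ≢ u₀ × Apart u₀ z)
        out-part p h {z} i with ∈-filterᵇ⁻ (not ∘ p) xs i
        ... | j , e with h z j
        ... | inj₂ (_ , q) = j , q
        ... | inj₁ (e′ , _) with trans (sym (not-true e)) e′
        ... | ()
        separated : Tight → ∀ p → Classified p → ∀ {y z} → y ∈ filterᵇ p xs → z ∈ filterᵇ (not ∘ p) xs → adj y z ≡ false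
        separated tight p h {y} {z} i j with adj y z in eq
        ... | false = refl
        ... | true with in-part p h i | out-part p h j
        ... | y∈ , y≢ , (M , minM , Mu , My) | z∈ , out with z ≟ u₀
        ... | yes refl = ⊥-elim (no-augment minM u₀∈ y∈ (trans (adj-sym u₀ y) eq) Mu My)
        ... | no z≢ = ⊥-elim (critical tight z z∈ λ (N , minN , Nz) →
              exchange (length xs) u₀∈ y∈ z∈ (λ e → y≢ (sym e)) (trans (adj-sym z y) eq) minM Mu My
                (λ a → out (z≢ , a)) minN Nz (m≤n+m (length xs) (agree M N xs)))
        parts : ¬ (c + g (suc f) ≤ length xs) → Tight → ∀ p → Classified p → ∀ part → filterᵇ p xs ≡ part → ⊥
        parts k tight p h [] eq = critical tight u₀ u₀∈ λ (N , (MN , eN) , Nu) →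
          no-ramsey c (suc f) xs fF (≤-trans (m≤n+m (suc f) w) wf) (small N eN Nu MN) xs! tf
            (Alpha≤-mono (≤-trans (≤-reflexive (sym (m+n∸n≡m w (suc f)))) (∸-monoˡ-≤ (suc f) wf)) al)
            (odd N (MN , eN) Nu)
          where
            lonely : ∀ N → Minimum N → N u₀ ≡ u₀ → fixes N xs ≡ 1
            lonely N minN Nu = trans (sum-cong xs pt) (sum-is u₀∈ xs!)
              where
                pt : ∀ z → z ∈ xs → is z (N z) ≡ is u₀ z
                pt z i with z ≟ u₀
                ... | yes refl = trans (cong (is z) Nu) (is-refl z)
                ... | no z≢ = is-≢ (λ Nz → none (z≢ , N , minN , Nu , Nz))
                  where
                    none : ¬ (z ≢ u₀ × Apart u₀ z)
                    none q with h z i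
                    ... | inj₂ (_ , nq) = nq q
                    ... | inj₁ (e , _) with subst (z ∈_) eq (∈-filterᵇ⁺ p i e)
                    ... | ()
            odd : ∀ N → Minimum N → N u₀ ≡ u₀ → suc (length xs) ≡ 2 * c
            odd N (MN , eN) Nu = trans (trans (sym (+-comm (length xs) 1))
              (cong (length xs +_) (sym (lonely N (MN , eN) Nu)))) eN
            small : ∀ N → length xs + fixes N xs ≡ 2 * c → N u₀ ≡ u₀ → Matching xs N → c ≤ g (suc f)
            small N eN Nu MN = +-cancelˡ-≤ c _ _ (begin
              c + c ≡⟨ cong (c +_) (+-identityʳ c) ⟨
              2 * c ≡⟨ odd N (MN , eN) Nu ⟨
              suc (length xs) ≤⟨ ≰⇒> k ⟩
              c + g (suc f) ∎)
              where open ≤-Reasoning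
        parts k tight p h (y ∷ part) eq = join xs! (filterᵇ-split p xs) (separated tight p h)
            (bounded n _ (shorter-in) (AllPairs-filterᵇ p xs!) (TriFree-⊆ (λ i → proj₁ (in-part p h i)) tf))
            (bounded n _ (shorter-out) (AllPairs-filterᵇ (not ∘ p) xs!) (TriFree-⊆ (λ i → proj₁ (out-part p h i)) tf))
            c w (suc f) fF bound al wf k
          where
            total : length xs ≡ length (filterᵇ p xs) + length (filterᵇ (not ∘ p) xs)
            total = trans (↭-length (filterᵇ-split p xs)) (length-++ (filterᵇ p xs))
            nonempty : ∀ {z} {zs : List V} → z ∈ zs → 0 < length zs
            nonempty (here _) = s≤s z≤n
            nonempty (there _) = s≤s z≤n
            pu₀ : u₀ ∈ filterᵇ (not ∘ p) xs
            pu₀ with h u₀ u₀∈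
            ... | inj₁ (_ , ne , _) = ⊥-elim (ne refl)
            ... | inj₂ (e , _) = ∈-filterᵇ⁺ (not ∘ p) u₀∈ (cong not e)
            shorter-in : length (filterᵇ p xs) ≤ n
            shorter-in = s≤s⁻¹ (≤-trans (m<m+n (length (filterᵇ p xs)) (nonempty pu₀)) (≤-trans (≤-reflexive (sym total)) (s≤s le)))
            shorter-out : length (filterᵇ (not ∘ p) xs) ≤ n
            shorter-out = s≤s⁻¹ (≤-trans (m<n+m (length (filterᵇ (not ∘ p) xs))
              (subst (λ q → 0 < length q) (sym eq) (s≤s z≤n))) (≤-trans (≤-reflexive (sym total)) (s≤s le)))

    general : ∀ n xs → length xs ≤ n → Unique xs → ∀ c w f → f ≤ F → (∀ css → Cover xs css → c ≤ length css) →
              Alpha≤ w xs → w + f ≤ c → c + g f ≤ length xs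
    general n xs le xs! c w zero fF chrom al wf = ≤-trans (≤-reflexive (trans (cong (c +_) g0) (+-identityʳ c)))
      (≤-trans (chrom (map (_∷ []) xs) (Perm.↭-reflexive (singles xs) , cliques xs)) (≤-reflexive (length-map _ xs)))
      where
        singles : ∀ xs → concat (map (_∷ []) xs) ≡ xs
        singles [] = refl
        singles (x ∷ xs) = cong (x ∷_) (singles xs)
        cliques : ∀ xs → All (AllPairs (λ x y → adj x y ≡ true)) (map (_∷ []) xs)
        cliques [] = []
        cliques (x ∷ xs) = ([] ∷ []) ∷ cliques xs
    general n xs le xs! c w (suc f) fF chrom al wf = ≤-stable (λ k → ¬¬-excluded-middle {A = Triangle} λ
      { (yes t) → k (with-triangle n le t)
      ; (no nt) → k (bounded n xs le xs! (λ i j l a d e → nt (_ , _ , _ , i , j , l , a , d , e)) c w (suc f) fF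
          (λ σ M → covered σ M) al wf) })
      where
        Triangle : Set
        Triangle = ∃ λ x → ∃ λ y → ∃ λ z → x ∈ xs × y ∈ xs × z ∈ xs × adj x y ≡ true × adj y z ≡ true × adj x z ≡ true
        covered : ∀ σ → Matching xs σ → 2 * c ≤ length xs + fixes σ xs
        covered σ M with matching-cover (length xs) ≤-refl xs! M
        ... | css , cov , e = ≤-trans (*-monoʳ-≤ 2 (chrom css cov)) (≤-reflexive e)
        other : ∀ {x y zs} → x ∈ y ∷ zs → x ≢ y → x ∈ zs
        other (here e) ne = ⊥-elim (ne e)
        other (there i) ne = i
        with-triangle : ∀ n → length xs ≤ n → Triangle → c + g (suc f) ≤ length xs
        with-triangle n le (x , y , z , i , j , l , xy , yz , xz)
          with ∈-extract i
        ... | xs₁ , p₁ with ∈-extract (other (∈-resp-↭ p₁ j) (λ e → adj⇒≢ xy (sym e)))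
        ... | xs₂ , p₂ with ∈-extract (other (∈-resp-↭ p₂ (other (∈-resp-↭ p₁ l) (λ e → adj⇒≢ xz (sym e)))) (λ e → adj⇒≢ yz (sym e)))
        ... | ys , p₃ = descend n c le wf (λ css cov → pred-mono-≤ (chrom ((x ∷ y ∷ z ∷ []) ∷ css) (add cov))) refl
          where
            p : xs ↭ x ∷ y ∷ z ∷ ys
            p = ↭-trans p₁ (prep x (↭-trans p₂ (prep y p₃)))
            add : ∀ {css} → Cover ys css → Cover xs ((x ∷ y ∷ z ∷ []) ∷ css)
            add (q , a) = ↭-trans (prep x (prep y (prep z q))) (↭-sym p) , ((xy ∷ xz ∷ []) ∷ (yz ∷ []) ∷ [] ∷ []) ∷ a
            ys⊆ : ∀ {v} → v ∈ ys → v ∈ xs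
            ys⊆ q = ∈-resp-↭ (↭-sym p) (there (there (there q)))
            ys! : Unique ys
            ys! with Unique-↭ p xs!
            ... | _ ∷ _ ∷ _ ∷ u = u
            descend : ∀ n c′ → length xs ≤ n → w + suc f ≤ c′ → (∀ css → Cover ys css → pred c′ ≤ length css) → c′ ≡ c →
                      c + g (suc f) ≤ length xs
            descend n zero le wf′ ch e = ⊥-elim (<⇒≱ (s≤s z≤n) (≤-trans (m≤n+m (suc f) w) wf′))
            descend zero (suc c′) le wf′ ch e = ⊥-elim (<⇒≱ (≤-trans (s≤s z≤n) (≤-reflexive (sym (↭-length p)))) le)
            descend (suc n) (suc c′) le wf′ ch refl = begin
              suc c′ + g (suc f) ≤⟨ +-monoʳ-≤ (suc c′) (g-step f fF) ⟩
              suc c′ + (2 + g f) ≡⟨ lem c′ (g f) ⟩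
              3 + (c′ + g f) ≤⟨ +-monoʳ-≤ 3 (general n ys
                  (s≤s⁻¹ (≤-trans (≤-trans (s≤s (m≤n+m (length ys) 2)) (≤-reflexive (sym (↭-length p)))) le))
                  ys! c′ w f (≤-trans (n≤1+n f) fF) ch
                  (Alpha≤-⊆ ys⊆ al) (s≤s⁻¹ (≤-trans (≤-reflexive (sym (+-suc w f))) wf′))) ⟩
              3 + length ys ≡⟨ ↭-length p ⟨
              length xs ∎
              where
                open ≤-Reasoning
                lem : ∀ a d → suc a + (2 + d) ≡ 3 + (a + d)
                lem = solve-∀

table : ℕ → List ℕ
table 0 = 0 ∷ 1000 ∷ []
table 1 = map value certs1
table 2 = map value certs2
table 3 = map value certs3
table 4 = map value certs4
table 5 = map value certs5
table 6 = map value certs6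
table 7 = map value certs7
table 8 = map value certs8
table 9 = map value certs9
table _ = []

-- Lower bounds for n − χ in terms of the gap; savings′ uses R(10,3) ≤ 41 at gap 12.
savings : ℕ → ℕ
savings = at (0 ∷ 2 ∷ 4 ∷ 6 ∷ 8 ∷ 10 ∷ 11 ∷ 13 ∷ 14 ∷ 16 ∷ 17 ∷ 19 ∷ 20 ∷ 22 ∷ [])

savings′ : ℕ → ℕ
savings′ = at (0 ∷ 2 ∷ 4 ∷ 6 ∷ 8 ∷ 10 ∷ 11 ∷ 13 ∷ 14 ∷ 16 ∷ 17 ∷ 19 ∷ 21 ∷ [])

ramseyCheck : (ℕ → ℕ → Bool) → ℕ → (ℕ → ℕ) → Bool
ramseyCheck exempt F g = allBelow (suc F) (λ f → allBelow (suc (g f)) (λ c → (f ≤ᵇ c) ⇒ᵇ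
  ((c ≡ᵇ 0) ∨ ((1000 ≤ᵇ at (table (c ∸ f)) (pred (2 * c))) ∧ (pred (2 * c) * (c ∸ f) <ᵇ 2000)) ∨ exempt f c)))

stepCheck : ℕ → (ℕ → ℕ) → Bool
stepCheck F g = allBelow F (λ f → g (suc f) ≤ᵇ 2 + g f)

superCheck : ℕ → (ℕ → ℕ) → Bool
superCheck F g = allBelow (suc F) (λ a → allBelow (suc F) (λ c → (a + c ≤ᵇ F) ⇒ᵇ (g (a + c) ≤ᵇ g a + g c)))

AllPairs-lookup : ∀ {A : Set} {R : A → A → Set} → (∀ {x y} → R x y → R y x) → ∀ {xs} → AllPairs R xs →
                  ∀ i j → i ≢ j → R (lookup xs i) (lookup xs j)
AllPairs-lookup s (a ∷ r) zero zero n = ⊥-elim (n refl)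
AllPairs-lookup s {x ∷ xs} (a ∷ r) zero (suc j) n = All.lookup a (∈-lookup {xs = xs} j)
AllPairs-lookup s {x ∷ xs} (a ∷ r) (suc i) zero n = s (All.lookup a (∈-lookup {xs = xs} i))
AllPairs-lookup s (a ∷ r) (suc i) (suc j) n = AllPairs-lookup s r i j (n ∘ cong suc)

true≢false : true ≢ false
true≢false ()

lookup-injective : ∀ {A : Set} {xs : List A} → Unique xs → ∀ i j → lookup xs i ≡ lookup xs j → i ≡ j
lookup-injective u i j e with i ≟ᶠ j
... | yes p = p
... | no q = ⊥-elim (AllPairs-lookup (λ ne e → ne (sym e)) u i j q e)

module OfGraph {n : ℕ} (G : Graph n) where

  co : Fin n → Fin n → Bool
  co u v = not (adj G u v) ∧ not (does (u ≟ᶠ v))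

  co-sym : ∀ u v → co u v ≡ co v u
  co-sym u v = cong₂ (λ a c → not a ∧ not c) (Graph.sym G u v) flipped
    where
      flipped : does (u ≟ᶠ v) ≡ does (v ≟ᶠ u)
      flipped with u ≟ᶠ v | v ≟ᶠ u
      ... | yes _ | yes _ = refl
      ... | no _ | no _ = refl
      ... | yes p | no q = ⊥-elim (q (sym p))
      ... | no p | yes q = ⊥-elim (p (sym q))

  co-irr : ∀ v → co v v ≡ false
  co-irr v with v ≟ᶠ v
  ... | no q = ⊥-elim (q refl)
  ... | yes _ with adj G v v
  ... | true = refl
  ... | false = refl

  co-false : ∀ {u v} → u ≢ v → co u v ≡ false → adj G u v ≡ true
  co-false {u} {v} ne e with adj G u v | u ≟ᶠ v
  ... | true | _ = refl
  ... | false | yes q = ⊥-elim (ne q)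
  ... | false | no _ with () ← e

  adj⇒co : ∀ {u v} → adj G u v ≡ true → co u v ≡ false
  adj⇒co e rewrite e = refl

  co-true : ∀ {u v} → co u v ≡ true → adj G u v ≡ false
  co-true {u} {v} e = not-true (proj₁ (∧-true {not (adj G u v)} e))

  nonadj⇒co : ∀ {u v} → u ≢ v → adj G u v ≡ false → co u v ≡ true
  nonadj⇒co {u} {v} ne e rewrite e with u ≟ᶠ v
  ... | yes q = ⊥-elim (ne q)
  ... | no _ = refl

  open Ambient _≟ᶠ_ co co-sym co-irr
  open Ramsey _≟ᶠ_ co co-sym co-irr
  open Tables _≟ᶠ_ co co-sym co-irr
  open Matchings _≟ᶠ_ co co-sym co-irr using (Cover)
  open Gaps _≟ᶠ_ co co-sym co-irr
  module C = Chain _≟ᶠ_ co co-sym co-irr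

  level-table : ∀ k → Level k (table k)
  level-table 0 = C.lev0
  level-table 1 = C.lev1
  level-table 2 = C.lev2
  level-table 3 = C.lev3
  level-table 4 = C.lev4
  level-table 5 = C.lev5
  level-table 6 = C.lev6
  level-table 7 = C.lev7
  level-table 8 = C.lev8
  level-table 9 = C.lev9
  level-table (suc (suc (suc (suc (suc (suc (suc (suc (suc (suc k)))))))))) m xs xs! tf al len ()

  no-ramsey-table : ∀ exempt F g → ramseyCheck exempt F g ≡ true →
    (∀ f c xs → exempt f c ≡ true → Unique xs → TriFree xs → Alpha≤ (c ∸ f) xs → suc (length xs) ≡ 2 * c → ⊥) →
    ∀ c f xs → f ≤ F → f ≤ c → c ≤ g f → Unique xs → TriFree xs → Alpha≤ (c ∸ f) xs → suc (length xs) ≡ 2 * c → ⊥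
  no-ramsey-table exempt F g chk ex c f xs fF fc cg xs! tf al len
    with ∨-true {c ≡ᵇ 0} (⇒ᵇ-sound {f ≤ᵇ c}
      (allBelow-sound (suc (g f)) _ (allBelow-sound (suc F) _ chk f (s≤s fF)) c (s≤s cg)) (T⇒≡ (≤⇒≤ᵇ fc)))
  ... | inj₁ z with trans len (cong (2 *_) (≡ᵇ-sound {c} z))
  ... | ()
  no-ramsey-table exempt F g chk ex c f xs fF fc cg xs! tf al len | inj₂ q
    with ∨-true {(1000 ≤ᵇ at (table (c ∸ f)) (pred (2 * c))) ∧ _} q
  ... | inj₂ e = ex f c xs e xs! tf al len
  ... | inj₁ r with ∧-true {1000 ≤ᵇ at (table (c ∸ f)) (pred (2 * c))} r
  ... | r₁ , r₂ with level-table (c ∸ f) (pred (2 * c)) xs xs! tf al (cong pred len)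
        (≤-trans (*-cancelˡ-< 2 (edges xs) 1000 (≤-<-trans (≤-trans (2edges≤ xs! tf al)
          (≤-reflexive (cong (_* (c ∸ f)) (cong pred len)))) (<ᵇ-sound r₂))) (≤ᵇ-sound r₁))
  ... | ()

  clique-Alpha≤ : ∀ {ω} → (∀ j → Clique G j → j ≤ ω) → ∀ xs → Alpha≤ ω xs
  clique-Alpha≤ h xs zs zs! _ ind = h (length zs)
    (lookup zs , (λ {i} {j} → lookup-injective zs! i j) ,
     λ i j ne → co-false (λ e → ne (lookup-injective zs! i j e))
       (AllPairs-lookup (λ {u} {v} e → trans (co-sym v u) e) ind i j ne))

  class : ∀ (css : List (List (Fin n))) {v} → v ∈ concat css → Fin (length css)
  class (cs ∷ css) i with ∈-++⁻ cs i
  ... | inj₁ _ = zero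
  ... | inj₂ j = suc (class css j)

  class-∈ : ∀ (css : List (List (Fin n))) {v} (i : v ∈ concat css) → v ∈ lookup css (class css i)
  class-∈ (cs ∷ css) i with ∈-++⁻ cs i
  ... | inj₁ j = j
  ... | inj₂ j = class-∈ css j

  pair : ∀ {cs u v} → AllPairs (λ x y → co x y ≡ true) cs → u ∈ cs → v ∈ cs → u ≢ v → co u v ≡ true
  pair (a ∷ r) (here refl) (here refl) ne = ⊥-elim (ne refl)
  pair (a ∷ r) (here refl) (there j) ne = All.lookup a j
  pair {u = u} {v} (a ∷ r) (there i) (here refl) ne = trans (co-sym u v) (All.lookup a i)
  pair (a ∷ r) (there i) (there j) ne = pair r i j ne

  cover-colouring : ∀ css → Cover (allFin n) css → Colouring G (length css)
  cover-colouring css (p , cl) = colour , proper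
    where
      mem : ∀ v → v ∈ concat css
      mem v = ∈-resp-↭ (↭-sym p) (∈-allFin v)
      colour : Fin n → Fin (length css)
      colour v = class css (mem v)
      proper : ∀ u v → adj G u v ≡ true → colour u ≢ colour v
      proper u v e same with trans (sym e) (co-true (pair (All.lookup cl (∈-lookup {xs = css} (colour v)))
        (subst (λ i → u ∈ lookup css i) same (class-∈ css (mem u))) (class-∈ css (mem v))
        (λ { refl → true≢false (trans (sym e) (irrefl G u)) })))
      ... | ()

  module _ (F : ℕ) (g : ℕ → ℕ) (exempt : ℕ → ℕ → Bool) (g0 : g 0 ≡ 0)
    (step-ok : stepCheck F g ≡ true) (super-ok : superCheck F g ≡ true) (ramsey-ok : ramseyCheck exempt F g ≡ true)
    (ex : ∀ f c xs → exempt f c ≡ true → Unique xs → TriFree xs → Alpha≤ (c ∸ f) xs → suc (length xs) ≡ 2 * c → ⊥) where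

    savings-bound : ∀ χ ω → IsChromaticNumber G χ → IsCliqueNumber G ω → χ ∸ ω ≤ F → χ + g (χ ∸ ω) ≤ n
    savings-bound χ ω (_ , minimal) (_ , maximal) fF with χ ∸ ω in eq
    ... | zero = ≤-trans (≤-reflexive (trans (cong (χ +_) g0) (+-identityʳ χ)))
      (minimal n (id , λ u v e u≡v → true≢false (trans (sym e) (trans (cong (adj G u) (sym u≡v)) (irrefl G u)))))
    ... | suc f = ≤-trans
      (Bound.general F g g0
        (λ f l → ≤ᵇ-sound (allBelow-sound F _ step-ok f l))
        (λ a c l → ≤ᵇ-sound (⇒ᵇ-sound {a + c ≤ᵇ F} (allBelow-sound (suc F) _ (allBelow-sound (suc F) _ super-ok a
          (s≤s (≤-trans (m≤m+n a c) l))) c (s≤s (≤-trans (m≤n+m c a) l))) (T⇒≡ (≤⇒≤ᵇ l))))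
        (no-ramsey-table exempt F g ramsey-ok ex)
        (length (allFin n)) (allFin n) ≤-refl (allFin⁺ n) χ ω (suc f) fF
        (λ css cov → minimal (length css) (cover-colouring css cov)) (clique-Alpha≤ maximal (allFin n))
        (≤-reflexive (trans (cong (ω +_) (sym eq)) (m+[n∸m]≡n {ω} {χ} (<⇒≤ (0<∸⇒< (subst (0 <_) (sym eq) (s≤s z≤n))))))))
      (≤-reflexive (length-tabulate id))

  induced : (xs : List (Fin n)) → Graph (length xs)
  induced xs = record
    { adj = λ i j → adj G (lookup xs i) (lookup xs j)
    ; sym = λ i j → Graph.sym G (lookup xs i) (lookup xs j)
    ; irrefl = λ i → irrefl G (lookup xs i) }

  ramsey-list : ∀ {k m} → RamseyLe (suc k) 3 m → ∀ xs → Unique xs → TriFree xs → Alpha≤ k xs → m ≤ length xs → ⊥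
  ramsey-list {k} {m} R xs xs! tf al le with R (length xs) le (induced xs)
  ... | inj₁ (f , inj , cl) = <⇒≱ ≤-refl (≤-trans (≤-reflexive (sym (length-tabulate at′)))
      (al (tabulate at′)
        (tabulate⁺ (λ {i} {j} ne e → ne (inj (lookup-injective xs! (f i) (f j) e))))
        member
        (tabulate⁺ (λ {i} {j} ne → adj⇒co (cl i j ne)))))
    where
      at′ : Fin (suc k) → Fin n
      at′ i = lookup xs (f i)
      member : ∀ {z} → z ∈ tabulate at′ → z ∈ xs
      member i with ∈-tabulate⁻ {f = at′} i
      ... | j , refl = ∈-lookup {xs = xs} (f j)
  ... | inj₂ (f , inj , ind) = tf (∈-lookup {xs = xs} (f x)) (∈-lookup {xs = xs} (f y)) (∈-lookup {xs = xs} (f z))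
      (edge x y (λ ())) (edge y z (λ ())) (edge x z (λ ()))
    where
      x y z : Fin 3
      x = zero
      y = suc zero
      z = suc (suc zero)
      edge : ∀ i j → i ≢ j → co (lookup xs (f i)) (lookup xs (f j)) ≡ true
      edge i j ne = nonadj⇒co (λ e → ne (inj (lookup-injective xs! (f i) (f j) e))) (ind i j)

  exempt : ℕ → ℕ → Bool
  exempt f c = (f ≡ᵇ 12) ∧ (c ≡ᵇ 21)

  exempt-ramsey : RamseyLe 10 3 41 → ∀ f c xs → exempt f c ≡ true → Unique xs → TriFree xs → Alpha≤ (c ∸ f) xs →
                  suc (length xs) ≡ 2 * c → ⊥
  exempt-ramsey R f c xs e xs! tf al len with ∧-true {f ≡ᵇ 12} e
  ... | e₁ , e₂ with ≡ᵇ-sound {f} e₁ | ≡ᵇ-sound {c} e₂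
  ... | refl | refl = ramsey-list R xs xs! tf al (≤-reflexive (sym (suc-injective len)))

theorem4p2 : ∀ {n} (G : Graph n) (χ ω : ℕ) →
    IsChromaticNumber G χ → IsCliqueNumber G ω → (χ ∸ ω) ≤ 13 →
    (χ + 2 * (χ ∸ ω) ≤ ∣V∣ G + 4)
    × ((χ ∸ ω) ≡ 12 → RamseyLe 10 3 41 → χ + 2 * (χ ∸ ω) < ∣V∣ G + 4)
theorem4p2 {n} G χ ω isχ isω gap≤13 = partA , partB
  where
    open OfGraph G
    open ≤-Reasoning
    partA : χ + 2 * (χ ∸ ω) ≤ n + 4
    partA = begin
      χ + 2 * (χ ∸ ω) ≤⟨ +-monoʳ-≤ χ (≤ᵇ-sound (allBelow-sound 14 (λ f → 2 * f ≤ᵇ savings f + 4) refl (χ ∸ ω) (s≤s gap≤13))) ⟩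
      χ + (savings (χ ∸ ω) + 4) ≡⟨ +-assoc χ _ 4 ⟨
      χ + savings (χ ∸ ω) + 4
        ≤⟨ +-monoˡ-≤ 4 (savings-bound 13 savings (λ _ _ → false) refl refl refl refl (λ _ _ _ ()) χ ω isχ isω gap≤13) ⟩
      n + 4 ∎
    partB : χ ∸ ω ≡ 12 → RamseyLe 10 3 41 → χ + 2 * (χ ∸ ω) < n + 4
    partB eq R = begin-strict
      χ + 2 * (χ ∸ ω) ≡⟨ cong (λ f → χ + 2 * f) eq ⟩
      χ + 24 <⟨ +-monoʳ-< χ (n<1+n 24) ⟩
      χ + (21 + 4) ≡⟨ +-assoc χ 21 4 ⟨
      χ + 21 + 4 ≡⟨ cong (λ f → χ + savings′ f + 4) eq ⟨
      χ + savings′ (χ ∸ ω) + 4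
        ≤⟨ +-monoˡ-≤ 4 (savings-bound 12 savings′ exempt refl refl refl refl (exempt-ramsey R) χ ω isχ isω (≤-reflexive eq)) ⟩
      n + 4 ∎
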